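{- Let $n\ge3$ and $b\ge2$, and let $P=P_b$ be the transition matrix of the base-$b$ carries chain for adding $n$ numbers, with stationary distribution $\pi(j)=A(n,j)/n!$. Then for every starting state $i\in\{0,\dots,n-1\}$ and every $r\ge0$, $$\|P^r(i,\cdot)-\pi\|_{TV}\le\Big(\frac{n-1}{2}+i\Big)\Big/b^r.$$ Conversely, for every $0<\epsilon<1$, if $r$ is an integer with $1\le r\le\log_b\!\Big[\frac{\epsilon\,|i-\frac{n-1}{2}|}{\sqrt n}\Big]$, then $\|P^r(i,\cdot)-\pi\|_{TV}\ge1-\epsilon$.
   Context: $A(n,j)$ is the number of permutations in $S_n$ with exactly $j$ descents. The base-$b$ carries chain for adding $n$ numbers is the Markov chain on $\{0,\dots,n-1\}$ given by $\kappa_{t+1}=\lfloor(\kappa_t+X_{t+1,1}+\dots+X_{t+1,n})/b\rfloor$ with $X_{t,k}$ i.i.d. uniform on $\{0,\dots,b-1\}$; its transition matrix is $P_b(i,j)=b^{ -n}\sum_{l=0}^{j-\lfloor i/b\rfloor}(-1)^l\binom{n+1}{l}\binom{n-1-i+(j+1-l)b}{n}$ (with $\binom{m}{n}=0$ for $m<n$). $\|P-Q\|_{TV}=\frac12\sum_x|P(x)-Q(x)|$. -}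

module Defs where

open import Data.Nat.Base as ℕ using (ℕ; zero; suc; NonZero; _^_; _!; z≤n; s≤s)
import Data.Nat.Properties as ℕ
open import Data.Nat.DivMod using () renaming (_/_ to _div_)
open import Data.Nat.Tactic.RingSolver using (solve-∀)
open import Data.Integer.Base as ℤ using (+_)
import Data.Integer.Properties as ℤ
import Data.Integer.Solver as ℤ-Solver
open import Data.Rational.Base as ℚ using (ℚ; _/_; 0ℚ; 1ℚ; ½; ∣_∣)
import Data.Rational.Properties as ℚ
import Data.Rational.Unnormalised.Base as ℚᵘ
import Data.Rational.Unnormalised.Properties as ℚᵘ
open import Data.Rational.Solver using (module +-*-Solver)
open import Data.Fin.Base using (Fin; toℕ)
import Data.Fin.Properties as Fin
open import Data.List.Base using (List; []; _∷_; length; filter; allFin; cartesianProductWith)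
open import Data.Vec.Base as Vec using (Vec; []; _∷_)
open import Data.Vec.Relation.Unary.AllPairs using (allPairs?)
open import Data.Product.Base using (∃-syntax; _×_; _,_; proj₁; proj₂)
open import Data.Sum.Base using (inj₁; inj₂)
open import Data.Bool.Base using (if_then_else_)
open import Relation.Nullary using (yes; no)
open import Relation.Nullary.Decidable using (¬?; _×-dec_; ⌊_⌋)
open import Relation.Binary.PropositionalEquality
open import Algebra.Properties.CommutativeMonoid.Sum ℚ.+-0-commutativeMonoid using (sum)

words : (m n : ℕ) → List (Vec (Fin m) n)
words m zero    = [] ∷ []
words m (suc n) = cartesianProductWith _∷_ (allFin m) (words m n)

newCarry : ∀ {n} (b : ℕ) .{{_ : NonZero b}} → ℕ → Vec (Fin b) n → ℕ
newCarry b κ x = (κ ℕ.+ Vec.sum (Vec.map toℕ x)) div b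

Matrix : ℕ → Set
Matrix n = Fin n → Fin n → ℚ

-- P(i,j) is the probability that carry i is followed by carry j, the n digits
-- being independent and uniform, i.e. all bⁿ digit vectors equally likely.
carriesMatrix : (b n : ℕ) .{{_ : NonZero b}} → Matrix n
carriesMatrix b n i j =
  (+ length (filter (λ x → newCarry b (toℕ i) x ℕ.≟ toℕ j) (words b n)) / (b ^ n))
    {{ℕ.m^n≢0 b n}}

identity : ∀ {n} → Matrix n
identity i j = if ⌊ i Fin.≟ j ⌋ then 1ℚ else 0ℚ

_^ᴹ_ : ∀ {n} → Matrix n → ℕ → Matrix n
P ^ᴹ zero  = identity
P ^ᴹ suc r = λ i j → sum (λ k → P i k ℚ.* (P ^ᴹ r) k j)

descents : ∀ {m n} → Vec (Fin m) n → ℕ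
descents []          = 0
descents (_ ∷ [])    = 0
descents (x ∷ y ∷ w) =
  (if ⌊ y Fin.<? x ⌋ then 1 else 0) ℕ.+ descents (y ∷ w)

-- A permutation is given in one-line notation, as a word of n distinct
-- letters from Fin n.
eulerian : ℕ → ℕ → ℕ
eulerian n j = length (filter
  (λ w → allPairs? (λ x y → ¬? (x Fin.≟ y)) w ×-dec (descents w ℕ.≟ j))
  (words n n))

stationary : (n : ℕ) → Fin n → ℚ
stationary n j = (+ eulerian n (toℕ j) / (n !)) {{n ℕ.!≢0}}

tv : ∀ {n} → (Fin n → ℚ) → (Fin n → ℚ) → ℚ
tv p q = ½ ℚ.* sum (λ x → ∣ p x ℚ.- q x ∣)

fromℕ : ℕ → ℚ
fromℕ m = + m / 1

midpoint : ℕ → ℚ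
midpoint n = ½ ℚ.* (fromℕ n ℚ.- 1ℚ)

-- Cauchy real: a sequence of rationals with a modulus of convergence.  Two
-- sequences denote the same real when each is ≤ᴿ the other.
record ℝ : Set where
  constructor mkℝ
  field
    seq    : ℕ → ℚ
    cauchy : ∀ δ → 0ℚ ℚ.< δ →
             ∃[ N ] ∀ k l → N ℕ.≤ k → N ℕ.≤ l → ∣ seq k ℚ.- seq l ∣ ℚ.< δ
open ℝ public

infix 4 _<ᴿ_ _≤ᴿ_
infixl 6 _-ᴿ_
infixl 7 _*ᴿ_

_<ᴿ_ : ℝ → ℝ → Set
x <ᴿ y = ∃[ δ ] (0ℚ ℚ.< δ × ∃[ N ] ∀ k → N ℕ.≤ k → seq x k ℚ.+ δ ℚ.≤ seq y k)

_≤ᴿ_ : ℝ → ℝ → Set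
x ≤ᴿ y = ∀ δ → 0ℚ ℚ.< δ → ∃[ N ] ∀ k → N ℕ.≤ k → seq x k ℚ.≤ seq y k ℚ.+ δ

private
  half-pos : ∀ {δ} → 0ℚ ℚ.< δ → 0ℚ ℚ.< δ ℚ.* ½
  half-pos {δ} p = subst (ℚ._< δ ℚ.* ½) (ℚ.*-zeroˡ ½) (ℚ.*-monoˡ-<-pos ½ p)

  half+half : ∀ δ → δ ℚ.* ½ ℚ.+ δ ℚ.* ½ ≡ δ
  half+half δ = trans (sym (ℚ.*-distribˡ-+ δ ½ ½)) (ℚ.*-identityʳ δ)

  *-pos : ∀ {p q} → 0ℚ ℚ.< p → 0ℚ ℚ.< q → 0ℚ ℚ.< p ℚ.* q
  *-pos {p} {q} 0<p 0<q =
    ℚ.positive⁻¹ _ {{ℚ.pos*pos⇒pos p {{ℚ.positive 0<p}} q {{ℚ.positive 0<q}}}}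

  inv : ∀ p → 0ℚ ℚ.< p → ℚ
  inv p 0<p = (ℚ.1/ p) {{ℚ.>-nonZero 0<p}}

  inv-pos : ∀ {p} (0<p : 0ℚ ℚ.< p) → 0ℚ ℚ.< inv p 0<p
  inv-pos {p} 0<p = ℚ.positive⁻¹ _ {{ℚ.1/pos⇒pos p {{ℚ.positive 0<p}}}}

  *-inv : ∀ {p} (0<p : 0ℚ ℚ.< p) → p ℚ.* inv p 0<p ≡ 1ℚ
  *-inv {p} 0<p = ℚ.*-inverseʳ p {{ℚ.>-nonZero 0<p}}

  *-mono-≤ : ∀ {a b c d} → 0ℚ ℚ.≤ c → 0ℚ ℚ.≤ b → a ℚ.≤ b → c ℚ.≤ d →
             a ℚ.* c ℚ.≤ b ℚ.* d
  *-mono-≤ {a} {b} {c} {d} 0≤c 0≤b a≤b c≤d = ℚ.≤-trans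
    (ℚ.*-monoʳ-≤-nonNeg c {{ℚ.nonNegative 0≤c}} a≤b)
    (ℚ.*-monoˡ-≤-nonNeg b {{ℚ.nonNegative 0≤b}} c≤d)

  ≤ˡ : ∀ {m n k} → m ℕ.⊔ n ℕ.≤ k → m ℕ.≤ k
  ≤ˡ {m} {n} = ℕ.≤-trans (ℕ.m≤m⊔n m n)

  ≤ʳ : ∀ {m n k} → m ℕ.⊔ n ℕ.≤ k → n ℕ.≤ k
  ≤ʳ {m} {n} = ℕ.≤-trans (ℕ.m≤n⊔m m n)

  bound : (x : ℝ) → ∃[ B ] (0ℚ ℚ.< B × ∃[ N ] ∀ k → N ℕ.≤ k → ∣ seq x k ∣ ℚ.≤ B)
  bound x = 1ℚ ℚ.+ ∣ a ∣ , 0<B , N , λ k N≤k → ℚ.≤-trans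
      (ℚ.≤-trans (ℚ.≤-reflexive (cong ∣_∣ (split (seq x k)))) (ℚ.∣p+q∣≤∣p∣+∣q∣ (seq x k ℚ.- a) a))
      (ℚ.+-monoˡ-≤ ∣ a ∣ (ℚ.<⇒≤ (proj₂ c k N N≤k ℕ.≤-refl)))
    where
    c = cauchy x 1ℚ (ℚ.positive⁻¹ 1ℚ)
    N = proj₁ c
    a = seq x N
    0<B = ℚ.<-≤-trans (ℚ.positive⁻¹ 1ℚ)
            (subst (ℚ._≤ 1ℚ ℚ.+ ∣ a ∣) (ℚ.+-identityʳ 1ℚ) (ℚ.+-monoʳ-≤ 1ℚ (ℚ.0≤∣p∣ a)))
    split : ∀ y → y ≡ (y ℚ.- a) ℚ.+ a
    split y = solve 2 (λ y a → y := (y :- a) :+ a) refl y a where open +-*-Solver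

fromℚ : ℚ → ℝ
fromℚ q = mkℝ (λ _ → q) λ δ 0<δ → 0 , λ _ _ _ _ →
  subst (ℚ._< δ) (sym (cong ∣_∣ (ℚ.+-inverseʳ q))) 0<δ

_-ᴿ_ : ℝ → ℝ → ℝ
x -ᴿ y = mkℝ (λ k → seq x k ℚ.- seq y k) λ δ 0<δ →
  let M , p = cauchy x (δ ℚ.* ½) (half-pos 0<δ)
      N , q = cauchy y (δ ℚ.* ½) (half-pos 0<δ)
  in M ℕ.⊔ N , λ k l k≥ l≥ → begin-strict
      ∣ (seq x k ℚ.- seq y k) ℚ.- (seq x l ℚ.- seq y l) ∣
        ≡⟨ cong ∣_∣ (rearrange (seq x k) (seq y k) (seq x l) (seq y l)) ⟩
      ∣ (seq x k ℚ.- seq x l) ℚ.- (seq y k ℚ.- seq y l) ∣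
        ≤⟨ ℚ.∣p-q∣≤∣p∣+∣q∣ (seq x k ℚ.- seq x l) (seq y k ℚ.- seq y l) ⟩
      ∣ seq x k ℚ.- seq x l ∣ ℚ.+ ∣ seq y k ℚ.- seq y l ∣
        <⟨ ℚ.+-mono-< (p k l (≤ˡ k≥) (≤ˡ l≥)) (q k l (≤ʳ {M} k≥) (≤ʳ {M} l≥)) ⟩
      δ ℚ.* ½ ℚ.+ δ ℚ.* ½
        ≡⟨ half+half δ ⟩
      δ ∎
  where
  open ℚ.≤-Reasoning
  rearrange : ∀ a b c d → (a ℚ.- b) ℚ.- (c ℚ.- d) ≡ (a ℚ.- c) ℚ.- (b ℚ.- d)
  rearrange = solve 4 (λ a b c d → (a :- b) :- (c :- d) := (a :- c) :- (b :- d)) refl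
    where open +-*-Solver

_*ᴿ_ : ℝ → ℝ → ℝ
x *ᴿ y = mkℝ (λ k → seq x k ℚ.* seq y k) λ δ 0<δ →
  let B , 0<B , Nx , bx = bound x
      C , 0<C , Ny , by = bound y
      M , p = cauchy x (δ ℚ.* ½ ℚ.* inv C 0<C) (*-pos (half-pos 0<δ) (inv-pos 0<C))
      N , q = cauchy y (δ ℚ.* ½ ℚ.* inv B 0<B) (*-pos (half-pos 0<δ) (inv-pos 0<B))
  in (Nx ℕ.⊔ Ny) ℕ.⊔ (M ℕ.⊔ N) , λ k l k≥ l≥ →
    let x∼ = p k l (≤ˡ (≤ʳ {Nx ℕ.⊔ Ny} k≥)) (≤ˡ (≤ʳ {Nx ℕ.⊔ Ny} l≥))
        y∼ = q k l (≤ʳ {M} (≤ʳ {Nx ℕ.⊔ Ny} k≥)) (≤ʳ {M} (≤ʳ {Nx ℕ.⊔ Ny} l≥))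
        instance
          _ = ℚ.positive 0<B
          _ = ℚ.positive 0<C
    in begin-strict
      ∣ seq x k ℚ.* seq y k ℚ.- seq x l ℚ.* seq y l ∣
        ≡⟨ cong ∣_∣ (rearrange (seq x k) (seq y k) (seq x l) (seq y l)) ⟩
      ∣ seq x k ℚ.* (seq y k ℚ.- seq y l) ℚ.+ seq y l ℚ.* (seq x k ℚ.- seq x l) ∣
        ≤⟨ ℚ.∣p+q∣≤∣p∣+∣q∣ (seq x k ℚ.* (seq y k ℚ.- seq y l)) (seq y l ℚ.* (seq x k ℚ.- seq x l)) ⟩
      ∣ seq x k ℚ.* (seq y k ℚ.- seq y l) ∣ ℚ.+ ∣ seq y l ℚ.* (seq x k ℚ.- seq x l) ∣
        ≡⟨ cong₂ ℚ._+_ (ℚ.∣p*q∣≡∣p∣*∣q∣ (seq x k) _) (ℚ.∣p*q∣≡∣p∣*∣q∣ (seq y l) _) ⟩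
      ∣ seq x k ∣ ℚ.* ∣ seq y k ℚ.- seq y l ∣ ℚ.+ ∣ seq y l ∣ ℚ.* ∣ seq x k ℚ.- seq x l ∣
        ≤⟨ ℚ.+-mono-≤
             (*-mono-≤ (ℚ.0≤∣p∣ _) (ℚ.<⇒≤ 0<B) (bx k (≤ˡ (≤ˡ {Nx ℕ.⊔ Ny} k≥))) ℚ.≤-refl)
             (*-mono-≤ (ℚ.0≤∣p∣ _) (ℚ.<⇒≤ 0<C) (by l (≤ʳ {Nx} (≤ˡ {Nx ℕ.⊔ Ny} l≥))) ℚ.≤-refl) ⟩
      B ℚ.* ∣ seq y k ℚ.- seq y l ∣ ℚ.+ C ℚ.* ∣ seq x k ℚ.- seq x l ∣
        <⟨ ℚ.+-mono-< (ℚ.*-monoʳ-<-pos B y∼) (ℚ.*-monoʳ-<-pos C x∼) ⟩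
      B ℚ.* (δ ℚ.* ½ ℚ.* inv B 0<B) ℚ.+ C ℚ.* (δ ℚ.* ½ ℚ.* inv C 0<C)
        ≡⟨ cong₂ ℚ._+_ (cancel (δ ℚ.* ½) 0<B) (cancel (δ ℚ.* ½) 0<C) ⟩
      δ ℚ.* ½ ℚ.+ δ ℚ.* ½
        ≡⟨ half+half δ ⟩
      δ ∎
  where
  open ℚ.≤-Reasoning
  rearrange : ∀ a b c d → a ℚ.* b ℚ.- c ℚ.* d ≡ a ℚ.* (b ℚ.- d) ℚ.+ d ℚ.* (a ℚ.- c)
  rearrange = solve 4 (λ a b c d → a :* b :- c :* d := a :* (b :- d) :+ d :* (a :- c)) refl
    where open +-*-Solver
  cancel : ∀ {B} e (0<B : 0ℚ ℚ.< B) → B ℚ.* (e ℚ.* inv B 0<B) ≡ e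
  cancel {B} e 0<B = trans
    (solve 3 (λ B e i → B :* (e :* i) := e :* (B :* i)) refl B e (inv B 0<B))
    (trans (cong (e ℚ.*_) (*-inv 0<B)) (ℚ.*-identityʳ e))
    where open +-*-Solver

-- The first N terms of y, which may vanish, are dropped before inverting.
recip : (y : ℝ) → fromℚ 0ℚ <ᴿ y → ℝ
recip y (d , 0<d , N , d≤y) = mkℝ (λ k → inv (t k) (0<t k)) λ δ 0<δ →
  let M , p = cauchy y (δ ℚ.* (d ℚ.* d)) (*-pos 0<δ (*-pos 0<d 0<d))
  in M , λ k l k≥ l≥ →
    let u = inv (t k) (0<t k)
        v = inv (t l) (0<t l)
        instance
          _ = ℚ.positive (*-pos (inv-pos (0<t k)) (inv-pos (0<t l)))
          _ = ℚ.nonNegative (ℚ.<⇒≤ 0<δ)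
    in begin-strict
      ∣ u ℚ.- v ∣
        ≡⟨ cong ∣_∣ (common-denominator k l) ⟩
      ∣ (t l ℚ.- t k) ℚ.* (u ℚ.* v) ∣
        ≡⟨ ℚ.∣p*q∣≡∣p∣*∣q∣ (t l ℚ.- t k) (u ℚ.* v) ⟩
      ∣ t l ℚ.- t k ∣ ℚ.* ∣ u ℚ.* v ∣
        ≡⟨ cong (∣ t l ℚ.- t k ∣ ℚ.*_) (ℚ.0≤p⇒∣p∣≡p (ℚ.<⇒≤ (*-pos (inv-pos (0<t k)) (inv-pos (0<t l))))) ⟩
      ∣ t l ℚ.- t k ∣ ℚ.* (u ℚ.* v)
        <⟨ ℚ.*-monoˡ-<-pos (u ℚ.* v) (p (N ℕ.+ l) (N ℕ.+ k) (ℕ.m≤n⇒m≤o+n N l≥) (ℕ.m≤n⇒m≤o+n N k≥)) ⟩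
      δ ℚ.* (d ℚ.* d) ℚ.* (u ℚ.* v)
        ≡⟨ regroup δ d u v ⟩
      δ ℚ.* ((d ℚ.* u) ℚ.* (d ℚ.* v))
        ≤⟨ ℚ.*-monoˡ-≤-nonNeg δ (*-mono-≤ (0≤du l) (ℚ.<⇒≤ (ℚ.positive⁻¹ 1ℚ)) (du≤1 k) (du≤1 l)) ⟩
      δ ℚ.* (1ℚ ℚ.* 1ℚ)
        ≡⟨ ℚ.*-identityʳ δ ⟩
      δ ∎
  where
  open ℚ.≤-Reasoning
  t : ℕ → ℚ
  t k = seq y (N ℕ.+ k)
  d≤t : ∀ k → d ℚ.≤ t k
  d≤t k = subst (ℚ._≤ t k) (ℚ.+-identityˡ d) (d≤y (N ℕ.+ k) (ℕ.m≤m+n N k))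
  0<t : ∀ k → 0ℚ ℚ.< t k
  0<t k = ℚ.<-≤-trans 0<d (d≤t k)
  0≤du : ∀ k → 0ℚ ℚ.≤ d ℚ.* inv (t k) (0<t k)
  0≤du k = ℚ.<⇒≤ (*-pos 0<d (inv-pos (0<t k)))
  du≤1 : ∀ k → d ℚ.* inv (t k) (0<t k) ℚ.≤ 1ℚ
  du≤1 k = subst (d ℚ.* inv (t k) (0<t k) ℚ.≤_) (*-inv (0<t k))
    (ℚ.*-monoʳ-≤-nonNeg (inv (t k) (0<t k))
      {{ℚ.nonNegative (ℚ.<⇒≤ (inv-pos (0<t k)))}} (d≤t k))
  common-denominator : ∀ k l → let u = inv (t k) (0<t k) ; v = inv (t l) (0<t l) in
    u ℚ.- v ≡ (t l ℚ.- t k) ℚ.* (u ℚ.* v)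
  common-denominator k l = begin-equality
    u ℚ.- v
      ≡⟨ cong₂ ℚ._-_ (sym (ℚ.*-identityˡ u)) (sym (ℚ.*-identityˡ v)) ⟩
    1ℚ ℚ.* u ℚ.- 1ℚ ℚ.* v
      ≡⟨ cong₂ (λ a b → a ℚ.* u ℚ.- b ℚ.* v) (sym (*-inv (0<t l))) (sym (*-inv (0<t k))) ⟩
    (t l ℚ.* v) ℚ.* u ℚ.- (t k ℚ.* u) ℚ.* v
      ≡⟨ solve 4 (λ a b u v → (b :* v) :* u :- (a :* u) :* v := (b :- a) :* (u :* v))
           refl (t k) (t l) u v ⟩
    (t l ℚ.- t k) ℚ.* (u ℚ.* v) ∎
    where
    open +-*-Solver
    u = inv (t k) (0<t k)
    v = inv (t l) (0<t l)
  regroup : ∀ e d u v → e ℚ.* (d ℚ.* d) ℚ.* (u ℚ.* v) ≡ e ℚ.* ((d ℚ.* u) ℚ.* (d ℚ.* v))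
  regroup = solve 4 (λ e d u v → e :* (d :* d) :* (u :* v) := e :* ((d :* u) :* (d :* v))) refl
    where open +-*-Solver

_÷_[_] : ℝ → (y : ℝ) → fromℚ 0ℚ <ᴿ y → ℝ
x ÷ y [ 0<y ] = x *ᴿ recip y 0<y

-- ⌊√m⌋
isqrt : ℕ → ℕ
isqrt zero    = 0
isqrt (suc m) with suc (isqrt m) ℕ.* suc (isqrt m) ℕ.≤? suc m
... | yes _ = suc (isqrt m)
... | no  _ = isqrt m

isqrt-lower : ∀ m → isqrt m ℕ.* isqrt m ℕ.≤ m
isqrt-lower zero    = z≤n
isqrt-lower (suc m) with suc (isqrt m) ℕ.* suc (isqrt m) ℕ.≤? suc m
... | yes p = p
... | no  _ = ℕ.m≤n⇒m≤1+n (isqrt-lower m)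

isqrt-upper : ∀ m → m ℕ.< suc (isqrt m) ℕ.* suc (isqrt m)
isqrt-upper zero    = s≤s z≤n
isqrt-upper (suc m) with suc (isqrt m) ℕ.* suc (isqrt m) ℕ.≤? suc m
... | yes _ = ℕ.≤-<-trans (isqrt-upper m)
                (ℕ.*-mono-< (ℕ.n<1+n (suc (isqrt m))) (ℕ.n<1+n (suc (isqrt m))))
... | no ¬p = ℕ.≰⇒> ¬p

private
  square-cancel-< : ∀ {a b} → a ℕ.* a ℕ.< b ℕ.* b → a ℕ.< b
  square-cancel-< {a} {b} a²<b² with a ℕ.<? b
  ... | yes a<b = a<b
  ... | no  a≮b with () ← ℕ.<⇒≱ a²<b² (ℕ.*-mono-≤ (ℕ.≮⇒≥ a≮b) (ℕ.≮⇒≥ a≮b))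

  /-mono-≤ : ∀ a b c d → a ℕ.* suc d ℕ.≤ c ℕ.* suc b → + a / suc b ℚ.≤ + c / suc d
  /-mono-≤ a b c d p = ℚ.toℚᵘ-cancel-≤
    (ℚᵘ.≤-respˡ-≃ (ℚᵘ.≃-sym (ℚ.toℚᵘ-fromℚᵘ (ℚᵘ.mkℚᵘ (+ a) b)))
      (ℚᵘ.≤-respʳ-≃ (ℚᵘ.≃-sym (ℚ.toℚᵘ-fromℚᵘ (ℚᵘ.mkℚᵘ (+ c) d)))
        (ℚᵘ.*≤* (subst₂ ℤ._≤_ (ℤ.pos-* a (suc d)) (ℤ.pos-* c (suc b)) (ℤ.+≤+ p)))))

  /-suc : ∀ a b → + suc a / suc b ≡ + a / suc b ℚ.+ + 1 / suc b
  /-suc a b = ℚ.toℚᵘ-injective (begin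
    ℚ.toℚᵘ (+ suc a / suc b)
      ≈⟨ ℚ.toℚᵘ-fromℚᵘ (ℚᵘ.mkℚᵘ (+ suc a) b) ⟩
    ℚᵘ.mkℚᵘ (+ suc a) b
      ≈⟨ ℚᵘ.*≡* (cross (+ a) (+ suc b)) ⟩
    ℚᵘ.mkℚᵘ (+ a) b ℚᵘ.+ ℚᵘ.mkℚᵘ (+ 1) b
      ≈⟨ ℚᵘ.+-cong (ℚ.toℚᵘ-fromℚᵘ (ℚᵘ.mkℚᵘ (+ a) b)) (ℚ.toℚᵘ-fromℚᵘ (ℚᵘ.mkℚᵘ (+ 1) b)) ⟨
    ℚ.toℚᵘ (+ a / suc b) ℚᵘ.+ ℚ.toℚᵘ (+ 1 / suc b)
      ≈⟨ ℚ.toℚᵘ-homo-+ (+ a / suc b) (+ 1 / suc b) ⟨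
    ℚ.toℚᵘ (+ a / suc b ℚ.+ + 1 / suc b) ∎)
    where
    open ℚᵘ.≃-Reasoning
    cross : ∀ a d → (+ 1 ℤ.+ a) ℤ.* (d ℤ.* d) ≡ (a ℤ.* d ℤ.+ + 1 ℤ.* d) ℤ.* d
    cross = solve 2 (λ a d → (con (+ 1) :+ a) :* (d :* d) := (a :* d :+ con (+ 1) :* d) :* d) refl
      where open ℤ-Solver.+-*-Solver

  archimedean : ∀ δ → 0ℚ ℚ.< δ → ∃[ N ] + 1 / suc N ℚ.≤ δ
  archimedean (ℚ.mkℚ (+ suc a) d c) _ = d , subst (+ 1 / suc d ℚ.≤_)
    (ℚ.↥p/↧p≡p (ℚ.mkℚ (+ suc a) d c))
    (/-mono-≤ 1 d (suc a) d (ℕ.*-monoˡ-≤ (suc d) (s≤s (z≤n {a}))))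
  archimedean (ℚ.mkℚ (+ 0) _ _)      (ℚ.*<* (ℤ.+<+ ()))
  archimedean (ℚ.mkℚ ℤ.-[1+ _ ] _ _) (ℚ.*<* ())

  √-approx : ℕ → ℕ → ℕ
  √-approx n k = isqrt (n ℕ.* (suc k ℕ.* suc k))

  √-cross : ∀ n k l → √-approx n k ℕ.* suc l ℕ.< suc (√-approx n l) ℕ.* suc k
  √-cross n k l = square-cancel-< (begin-strict
    (p ℕ.* suc l) ℕ.* (p ℕ.* suc l)          ≡⟨ swap p (suc l) ⟩
    (p ℕ.* p) ℕ.* (suc l ℕ.* suc l)
      ≤⟨ ℕ.*-monoˡ-≤ (suc l ℕ.* suc l) (isqrt-lower (n ℕ.* (suc k ℕ.* suc k))) ⟩
    (n ℕ.* (suc k ℕ.* suc k)) ℕ.* (suc l ℕ.* suc l)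
      ≡⟨ rotate n (suc k ℕ.* suc k) (suc l ℕ.* suc l) ⟩
    (n ℕ.* (suc l ℕ.* suc l)) ℕ.* (suc k ℕ.* suc k)
      <⟨ ℕ.*-monoˡ-< (suc k ℕ.* suc k) (isqrt-upper (n ℕ.* (suc l ℕ.* suc l))) ⟩
    (suc q ℕ.* suc q) ℕ.* (suc k ℕ.* suc k)  ≡⟨ swap (suc q) (suc k) ⟨
    (suc q ℕ.* suc k) ℕ.* (suc q ℕ.* suc k)  ∎)
    where
    open ℕ.≤-Reasoning
    p = √-approx n k
    q = √-approx n l
    swap : ∀ a b → (a ℕ.* b) ℕ.* (a ℕ.* b) ≡ (a ℕ.* a) ℕ.* (b ℕ.* b)
    swap = solve-∀
    rotate : ∀ a b c → (a ℕ.* b) ℕ.* c ≡ (a ℕ.* c) ℕ.* b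
    rotate = solve-∀

-- ⌊√(n(k+1)²)⌋ / (k+1) = ⌊(k+1)√n⌋ / (k+1), which is within 1/(k+1) of √n.
√ : ℕ → ℝ
√ n = mkℝ s λ δ 0<δ →
  let N , 1/N≤ = archimedean (δ ℚ.* ½) (half-pos 0<δ)
  in N , λ k l k≥ l≥ → ℚ.≤-<-trans
    (∣-∣-≤ (ℚ.≤-trans (close k l) (ℚ.+-monoʳ-≤ (s l) (ℚ.≤-trans (step N l l≥) 1/N≤)))
           (ℚ.≤-trans (close l k) (ℚ.+-monoʳ-≤ (s k) (ℚ.≤-trans (step N k k≥) 1/N≤))))
    (half< 0<δ)
  where
  s : ℕ → ℚ
  s k = + √-approx n k / suc k
  close : ∀ k l → s k ℚ.≤ s l ℚ.+ + 1 / suc l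
  close k l = subst (s k ℚ.≤_) (/-suc (√-approx n l) l)
    (/-mono-≤ (√-approx n k) k (suc (√-approx n l)) l (ℕ.<⇒≤ (√-cross n k l)))
  step : ∀ N l → N ℕ.≤ l → + 1 / suc l ℚ.≤ + 1 / suc N
  step N l N≤l = /-mono-≤ 1 l 1 N (ℕ.*-monoʳ-≤ 1 (s≤s N≤l))
  half< : ∀ {δ} → 0ℚ ℚ.< δ → δ ℚ.* ½ ℚ.< δ
  half< {δ} 0<δ = subst₂ ℚ._<_ (ℚ.+-identityʳ (δ ℚ.* ½)) (half+half δ)
    (ℚ.+-monoʳ-< (δ ℚ.* ½) (half-pos 0<δ))
  sub-≤ : ∀ {a b e} → a ℚ.≤ b ℚ.+ e → a ℚ.- b ℚ.≤ e
  sub-≤ {a} {b} {e} p = subst (a ℚ.- b ℚ.≤_)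
    (solve 2 (λ b e → (b :+ e) :- b := e) refl b e) (ℚ.+-monoˡ-≤ (ℚ.- b) p)
    where open +-*-Solver
  ∣-∣-≤ : ∀ {a b e} → a ℚ.≤ b ℚ.+ e → b ℚ.≤ a ℚ.+ e → ∣ a ℚ.- b ∣ ℚ.≤ e
  ∣-∣-≤ {a} {b} {e} p q with ℚ.∣p∣≡p∨∣p∣≡-p (a ℚ.- b)
  ... | inj₁ eq = subst (ℚ._≤ e) (sym eq) (sub-≤ {a} p)
  ... | inj₂ eq = subst (ℚ._≤ e)
          (sym (trans eq (solve 2 (λ a b → :- (a :- b) := b :- a) refl a b))) (sub-≤ {b} q)
    where open +-*-Solver

√-positive : ∀ n → .{{_ : NonZero n}} → fromℚ 0ℚ <ᴿ √ n
√-positive n@(suc _) = 1ℚ , ℚ.positive⁻¹ 1ℚ , 0 , λ k _ →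
  subst (ℚ._≤ seq (√ n) k) (sym (ℚ.+-identityˡ 1ℚ))
    (/-mono-≤ 1 0 (√-approx n k) k (subst₂ ℕ._≤_
      (sym (ℕ.*-identityˡ (suc k))) (sym (ℕ.*-identityʳ (√-approx n k)))
      (ℕ.s≤s⁻¹ (square-cancel-< (ℕ.≤-<-trans
        (ℕ.m≤n*m (suc k ℕ.* suc k) n) (isqrt-upper (n ℕ.* (suc k ℕ.* suc k))))))))

-- r ≤ log_b x for an integer r, log_b being the increasing inverse of y ↦ b^y
-- (b > 1) and log_b 0 = -∞.
_≤log[_]_ : ℕ → ℕ → ℝ → Set
r ≤log[ b ] x = fromℚ (fromℕ (b ^ r)) ≤ᴿ x

{-# OPTIONS --safe #-}
module Submission where

open import Defs
open import Data.Nat.Base as ℕ using (ℕ; zero; suc; NonZero; _≤_; _^_; _!)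
import Data.Nat.Properties as ℕ
open import Data.Nat.Properties using (m^n≢0)
open import Data.Nat.DivMod as ℕ using () renaming (_/_ to _div_)
open import Data.Integer.Base as ℤ using (+_)
import Data.Integer.Properties as ℤ
open import Data.Rational.Base as ℚ using (ℚ; 0ℚ; 1ℚ; ½; ∣_∣; _+_; _*_; _-_; -_)
import Data.Rational.Properties as ℚ
import Data.Rational.Unnormalised.Base as ℚᵘ
import Data.Rational.Unnormalised.Properties as ℚᵘ
open import Data.Fin.Base using (Fin; zero; suc; toℕ; fromℕ<; punchIn)
import Data.Fin.Properties as Fin
open import Data.List.Base as List using (List; []; _∷_; length; filter; tabulate; allFin; cartesianProductWith)
open import Data.Vec.Base as Vec using (Vec; []; _∷_)
open import Data.Vec.Relation.Unary.All as All using (All)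
open import Data.Vec.Relation.Unary.AllPairs using (AllPairs; allPairs?)
open import Data.Product.Base using (∃-syntax; _×_; _,_; proj₁; proj₂)
open import Data.Sum.Base using (inj₁; inj₂)
open import Data.Bool.Base using (Bool; true; false; T; _∧_; not; if_then_else_)
open import Function.Base using (_∘_; id)
open import Level using (0ℓ)
open import Relation.Nullary using (¬_; Dec; does; yes; no; contradiction)
open import Relation.Nullary.Decidable using (dec⇒maybe; ¬?; _×-dec_; dec-true; dec-false; isYes≗does)
open import Relation.Unary using (Pred; Decidable)
open import Relation.Binary.PropositionalEquality
open import Algebra.Bundles using (CommutativeRing)
open import Algebra.Properties.Semiring.Sum (CommutativeRing.semiring ℚ.+-*-commutativeRing)
  using (sum; sum-remove; sum-cong-≗; ∑-distrib-+; ∑-comm; *-distribˡ-sum)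
open import Tactic.RingSolver using (solve-∀)
open import Tactic.RingSolver.Core.AlmostCommutativeRing using (AlmostCommutativeRing; fromCommutativeRing)

-- Upper bound.  Chains from i ≤ j fed the same digits stay ordered and the mean of their gap is
-- divided by b at each step (Hermite's identity Σ_{s<b} ⌊(y+s)/b⌋ = y), so Pʳ maps 1-Lipschitz
-- functions to b⁻ʳ-Lipschitz ones.  Total variation tests against functions with oscillation at
-- most 1, which are 1-Lipschitz on integers, and |i - k| ≤ i + k averages to i + (n-1)/2 under π.
--
-- Lower bound.  The centred carry is an eigenfunction with eigenvalue 1/b and its second moment
-- satisfies P f² ≤ b⁻² f² + V (1 - b⁻²) with V = (n+3)/12.  Hence the variances of Pʳ(i,·) and π
-- are at most V while their means are |i - (n-1)/2| b⁻ʳ apart.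
--
-- Stationarity.  Sorting permutations by their first letter k gives, for the descent counts,
-- Sⁿ a_{n,k}(m) = mᵏ (m+1)ⁿ⁻¹⁻ᵏ, with S the prefix sum; so Sⁿ A(n,·) is (m+1)ⁿ - mⁿ.  Adding one
-- uniform digit is convolution U with a window of length b, division by b is summation over
-- blocks, and S ∘ block ∘ U = block ∘ S because windows of length b tile ℕ.  As block sums of
-- (m+1)ⁿ - mⁿ telescope to bⁿ times the same sequence, A(n,·)/n! is invariant.

-- The matrix counts digit words and no closed formula for its entries is used. In the moments one
-- digit is summed first by Hermite's identity, which removes the floor. Exact second moments would
-- need the law of a residue; it is replaced by the largest variance, 1/4, of a variable with two
-- adjacent integer values. This gives V = (n+3)/12 where the true stationary variance is (n+1)/12,
-- and the loss is affordable. The overlap of Pʳ(i,·) and π is at most 4V b²ʳ / |i - (n-1)/2|²,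
-- hence at most ε²(n+3)/(3n), which is at most 2ε²/3 for n ≥ 3. The factor 2/3 leaves room for
-- rational approximations of √n.
--
-- The exponent in Sⁿ is the number of digits, because each prefix sum absorbs one of the n
-- convolutions. In generating functions S is division by 1 - x, and the formula for Sⁿ A(n,·) is
-- Euler's identity Σ (m+1)ⁿ xᵐ = A_n(x)/(1-x)ⁿ⁺¹ with one factor 1 - x cleared.

ℚ-ring : AlmostCommutativeRing _ _
ℚ-ring = fromCommutativeRing ℚ.+-*-commutativeRing (λ q → dec⇒maybe (0ℚ ℚ.≟ q))

-- Inequalities are proved by certificates: the difference is exhibited as a visibly nonnegative
-- expression `e`, and the ring solver checks the identity.
≤-by : ∀ {p q} e → e ≡ q - p → 0ℚ ℚ.≤ e → p ℚ.≤ q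
≤-by {p} {q} e eq 0≤e = subst₂ ℚ._≤_ (ℚ.+-identityˡ p) (cancel p q)
  (ℚ.+-monoˡ-≤ p (subst (0ℚ ℚ.≤_) eq 0≤e))
  where
  cancel : ∀ p q → (q - p) + p ≡ q
  cancel = solve-∀ ℚ-ring

0≤- : ∀ {p q} → p ℚ.≤ q → 0ℚ ℚ.≤ q - p
0≤- {p} {q} p≤q = subst (ℚ._≤ q - p) (ℚ.+-inverseʳ p) (ℚ.+-monoˡ-≤ (- p) p≤q)

0≤+ : ∀ {p q} → 0ℚ ℚ.≤ p → 0ℚ ℚ.≤ q → 0ℚ ℚ.≤ p + q
0≤+ 0≤p 0≤q = ℚ.+-mono-≤ 0≤p 0≤q

0≤* : ∀ {p q} → 0ℚ ℚ.≤ p → 0ℚ ℚ.≤ q → 0ℚ ℚ.≤ p * q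
0≤* {p} {q} 0≤p 0≤q = subst (ℚ._≤ p * q) (ℚ.*-zeroʳ p)
  (ℚ.*-monoˡ-≤-nonNeg p {{ℚ.nonNegative 0≤p}} 0≤q)

0≤² : ∀ p → 0ℚ ℚ.≤ p * p
0≤² p with ℚ.≤-total 0ℚ p
... | inj₁ 0≤p = 0≤* 0≤p 0≤p
... | inj₂ p≤0 = subst (0ℚ ℚ.≤_) (neg-sq p)
  (0≤* (ℚ.neg-antimono-≤ p≤0) (ℚ.neg-antimono-≤ p≤0))
  where
  neg-sq : ∀ p → - p * - p ≡ p * p
  neg-sq = solve-∀ ℚ-ring

0≤1 : 0ℚ ℚ.≤ 1ℚ
0≤1 = ℚ.<⇒≤ (ℚ.positive⁻¹ 1ℚ)

*-monoˡ-≤ : ∀ {p q} r → 0ℚ ℚ.≤ r → p ℚ.≤ q → r * p ℚ.≤ r * q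
*-monoˡ-≤ r 0≤r = ℚ.*-monoˡ-≤-nonNeg r {{ℚ.nonNegative 0≤r}}

*-cancelˡ-≤ : ∀ {p q} r → 0ℚ ℚ.< r → r * p ℚ.≤ r * q → p ℚ.≤ q
*-cancelˡ-≤ r 0<r = ℚ.*-cancelˡ-≤-pos r {{ℚ.positive 0<r}}

*-cancelˡ-≡ : ∀ {p q} r → 0ℚ ℚ.< r → r * p ≡ r * q → p ≡ q
*-cancelˡ-≡ r 0<r eq = ℚ.≤-antisym (*-cancelˡ-≤ r 0<r (ℚ.≤-reflexive eq))
  (*-cancelˡ-≤ r 0<r (ℚ.≤-reflexive (sym eq)))

∣p∣≤ : ∀ {p q} → p ℚ.≤ q → - p ℚ.≤ q → ∣ p ∣ ℚ.≤ q
∣p∣≤ {p} {q} p≤q -p≤q with ℚ.∣p∣≡p∨∣p∣≡-p p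
... | inj₁ eq = subst (ℚ._≤ q) (sym eq) p≤q
... | inj₂ eq = subst (ℚ._≤ q) (sym eq) -p≤q

p≤∣p∣ : ∀ p → p ℚ.≤ ∣ p ∣
p≤∣p∣ p with ℚ.≤-total 0ℚ p
... | inj₁ 0≤p = ℚ.≤-reflexive (sym (ℚ.0≤p⇒∣p∣≡p 0≤p))
... | inj₂ p≤0 = ℚ.≤-trans p≤0 (ℚ.0≤∣p∣ p)

toℚᵘ-/ : ∀ m n .{{_ : NonZero n}} → ℚ.toℚᵘ (+ m ℚ./ n) ℚᵘ.≃ (+ m ℚᵘ./ n)
toℚᵘ-/ m (suc n) = ℚ.toℚᵘ-fromℚᵘ (ℚᵘ.mkℚᵘ (+ m) n)

-- `ℚ._/_` divides by a gcd and is stuck on variables, so quotients are compared in the unnormalised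
-- rationals, where equality is cross multiplication of integers.
fromℕ-+ : ∀ m n → fromℕ (m ℕ.+ n) ≡ fromℕ m + fromℕ n
fromℕ-+ m n = ℚ.toℚᵘ-injective (begin
  ℚ.toℚᵘ (fromℕ (m ℕ.+ n))                 ≈⟨ toℚᵘ-/ (m ℕ.+ n) 1 ⟩
  ℚᵘ.mkℚᵘ (+ (m ℕ.+ n)) 0                   ≈⟨ ℚᵘ.*≡* (cong (ℤ._* + 1) (sym
                                               (cong₂ ℤ._+_ (ℤ.*-identityʳ (+ m)) (ℤ.*-identityʳ (+ n))))) ⟩
  ℚᵘ.mkℚᵘ (+ m) 0 ℚᵘ.+ ℚᵘ.mkℚᵘ (+ n) 0      ≈⟨ ℚᵘ.+-cong (toℚᵘ-/ m 1) (toℚᵘ-/ n 1) ⟨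
  ℚ.toℚᵘ (fromℕ m) ℚᵘ.+ ℚ.toℚᵘ (fromℕ n)    ≈⟨ ℚ.toℚᵘ-homo-+ (fromℕ m) (fromℕ n) ⟨
  ℚ.toℚᵘ (fromℕ m + fromℕ n)                ∎)
  where open ℚᵘ.≃-Reasoning

fromℕ-suc : ∀ n → fromℕ (suc n) ≡ 1ℚ + fromℕ n
fromℕ-suc = fromℕ-+ 1

/-fromℕ : ∀ m n .{{_ : NonZero n}} → + m ℚ./ n ≡ fromℕ m * (+ 1 ℚ./ n)
/-fromℕ m n@(suc n-1) = ℚ.toℚᵘ-injective (begin
  ℚ.toℚᵘ (+ m ℚ./ n)                           ≈⟨ toℚᵘ-/ m n ⟩
  ℚᵘ.mkℚᵘ (+ m) n-1                            ≈⟨ ℚᵘ.*≡* (sym (cong₂ (λ x k → x ℤ.* + suc k)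
                                                  (ℤ.*-identityʳ (+ m)) (sym (ℕ.+-identityʳ n-1)))) ⟩
  ℚᵘ.mkℚᵘ (+ m) 0 ℚᵘ.* ℚᵘ.mkℚᵘ (+ 1) n-1       ≈⟨ ℚᵘ.*-cong (toℚᵘ-/ m 1) (toℚᵘ-/ 1 n) ⟨
  ℚ.toℚᵘ (fromℕ m) ℚᵘ.* ℚ.toℚᵘ (+ 1 ℚ./ n)     ≈⟨ ℚ.toℚᵘ-homo-* (fromℕ m) (+ 1 ℚ./ n) ⟨
  ℚ.toℚᵘ (fromℕ m * (+ 1 ℚ./ n))               ∎)
  where open ℚᵘ.≃-Reasoning

fromℕ-inverse : ∀ n .{{_ : NonZero n}} → fromℕ n * (+ 1 ℚ./ n) ≡ 1ℚ
fromℕ-inverse n@(suc n-1) = trans (sym (/-fromℕ n n)) (ℚ.toℚᵘ-injective (begin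
  ℚ.toℚᵘ (+ n ℚ./ n)  ≈⟨ toℚᵘ-/ n n ⟩
  ℚᵘ.mkℚᵘ (+ n) n-1   ≈⟨ ℚᵘ.*≡* (ℤ.*-comm (+ n) (+ 1)) ⟩
  ℚᵘ.1ℚᵘ              ∎))
  where open ℚᵘ.≃-Reasoning

fromℕ-* : ∀ m n → fromℕ (m ℕ.* n) ≡ fromℕ m * fromℕ n
fromℕ-* zero    n = sym (ℚ.*-zeroˡ (fromℕ n))
fromℕ-* (suc m) n = begin
  fromℕ (n ℕ.+ m ℕ.* n)              ≡⟨ fromℕ-+ n (m ℕ.* n) ⟩
  fromℕ n + fromℕ (m ℕ.* n)          ≡⟨ cong (fromℕ n ℚ.+_) (fromℕ-* m n) ⟩
  fromℕ n + fromℕ m * fromℕ n        ≡⟨ factor (fromℕ m) (fromℕ n) ⟩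
  (1ℚ + fromℕ m) * fromℕ n           ≡⟨ cong (_* fromℕ n) (fromℕ-suc m) ⟨
  fromℕ (suc m) * fromℕ n            ∎
  where
  open ≡-Reasoning
  factor : ∀ p q → q + p * q ≡ (1ℚ + p) * q
  factor = solve-∀ ℚ-ring

0≤fromℕ : ∀ n → 0ℚ ℚ.≤ fromℕ n
0≤fromℕ n = ℚ.nonNegative⁻¹ _ {{ℚ.normalize-nonNeg n 1}}

fromℕ-mono-≤ : ∀ {m n} → m ≤ n → fromℕ m ℚ.≤ fromℕ n
fromℕ-mono-≤ {m} {n} m≤n = ≤-by (fromℕ (n ℕ.∸ m)) eq (0≤fromℕ (n ℕ.∸ m))
  where
  open ≡-Reasoning
  cancel : ∀ p q → q ≡ (p + q) - p
  cancel = solve-∀ ℚ-ring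
  eq : fromℕ (n ℕ.∸ m) ≡ fromℕ n - fromℕ m
  eq = begin
    fromℕ (n ℕ.∸ m)                       ≡⟨ cancel (fromℕ m) (fromℕ (n ℕ.∸ m)) ⟩
    (fromℕ m + fromℕ (n ℕ.∸ m)) - fromℕ m ≡⟨ cong (_- fromℕ m) (fromℕ-+ m (n ℕ.∸ m)) ⟨
    fromℕ (m ℕ.+ (n ℕ.∸ m)) - fromℕ m     ≡⟨ cong (λ k → fromℕ k - fromℕ m) (ℕ.m+[n∸m]≡n m≤n) ⟩
    fromℕ n - fromℕ m                     ∎

0<fromℕ : ∀ n .{{_ : NonZero n}} → 0ℚ ℚ.< fromℕ n
0<fromℕ (suc n) = ℚ.<-≤-trans (ℚ.positive⁻¹ 1ℚ) (fromℕ-mono-≤ (ℕ.s≤s (ℕ.z≤n {n})))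

0<1/ : ∀ n .{{_ : NonZero n}} → 0ℚ ℚ.< + 1 ℚ./ n
0<1/ n = ℚ.positive⁻¹ _ {{ℚ.normalize-pos 1 n}}

-- Finite sums

sum-cong : ∀ {n} {f g : Fin n → ℚ} → (∀ i → f i ≡ g i) → sum f ≡ sum g
sum-cong {n} {f} {g} = sum-cong-≗ {n} {f} {g}

sum-*ˡ : ∀ {n} c (f : Fin n → ℚ) → sum (λ i → c * f i) ≡ c * sum f
sum-*ˡ c f = sym (*-distribˡ-sum c f)

sum-*ʳ : ∀ {n} c (f : Fin n → ℚ) → sum (λ i → f i * c) ≡ sum f * c
sum-*ʳ c f = trans (sum-cong λ i → ℚ.*-comm (f i) c) (trans (sum-*ˡ c f) (ℚ.*-comm c (sum f)))

sum-0 : ∀ n → sum {n} (λ _ → 0ℚ) ≡ 0ℚ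
sum-0 zero    = refl
sum-0 (suc n) = trans (ℚ.+-identityˡ _) (sum-0 n)

sum-const : ∀ n c → sum {n} (λ _ → c) ≡ fromℕ n * c
sum-const zero    c = sym (ℚ.*-zeroˡ c)
sum-const (suc n) c = begin
  c + sum {n} (λ _ → c)  ≡⟨ cong (c ℚ.+_) (sum-const n c) ⟩
  c + fromℕ n * c        ≡⟨ factor (fromℕ n) c ⟩
  (1ℚ + fromℕ n) * c     ≡⟨ cong (_* c) (fromℕ-suc n) ⟨
  fromℕ (suc n) * c      ∎
  where
  open ≡-Reasoning
  factor : ∀ p q → q + p * q ≡ (1ℚ + p) * q
  factor = solve-∀ ℚ-ring

sum-- : ∀ {n} (f g : Fin n → ℚ) → sum (λ i → f i - g i) ≡ sum f - sum g
sum-- f g = begin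
  sum (λ i → f i - g i)               ≡⟨ ∑-distrib-+ f (λ i → - g i) ⟩
  sum f + sum (λ i → - g i)           ≡⟨ cong (sum f ℚ.+_) (sum-cong λ i → neg (g i)) ⟩
  sum f + sum (λ i → - 1ℚ * g i)      ≡⟨ cong (sum f ℚ.+_) (sum-*ˡ (- 1ℚ) g) ⟩
  sum f + - 1ℚ * sum g                ≡⟨ cong (sum f ℚ.+_) (neg (sum g)) ⟨
  sum f - sum g                       ∎
  where
  open ≡-Reasoning
  neg : ∀ p → - p ≡ - 1ℚ * p
  neg = solve-∀ ℚ-ring

sum-mono-≤ : ∀ {n} {f g : Fin n → ℚ} → (∀ i → f i ℚ.≤ g i) → sum f ℚ.≤ sum g
sum-mono-≤ {zero}  f≤g = ℚ.≤-refl
sum-mono-≤ {suc n} f≤g = ℚ.+-mono-≤ (f≤g zero) (sum-mono-≤ (f≤g ∘ suc))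

-- Iverson brackets and sums over words

⟦_⟧ : Bool → ℚ
⟦ true  ⟧ = 1ℚ
⟦ false ⟧ = 0ℚ

⟦∧⟧ : ∀ a b → ⟦ a ∧ b ⟧ ≡ ⟦ a ⟧ * ⟦ b ⟧
⟦∧⟧ true  b = sym (ℚ.*-identityˡ ⟦ b ⟧)
⟦∧⟧ false b = sym (ℚ.*-zeroˡ ⟦ b ⟧)

sum-pick : ∀ {n} (k : Fin n) (g : Fin n → ℚ) →
           sum (λ j → ⟦ toℕ k ℕ.≡ᵇ toℕ j ⟧ * g j) ≡ g k
sum-pick {suc n} zero g = begin
  1ℚ * g zero + sum (λ j → 0ℚ * g (suc j))  ≡⟨ cong₂ _+_ (ℚ.*-identityˡ (g zero))
                                                (trans (sum-cong λ j → ℚ.*-zeroˡ (g (suc j))) (sum-0 n)) ⟩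
  g zero + 0ℚ                               ≡⟨ ℚ.+-identityʳ (g zero) ⟩
  g zero                                    ∎
  where open ≡-Reasoning
sum-pick (suc k) g = trans (cong₂ _+_ (ℚ.*-zeroˡ (g zero)) (sum-pick k (g ∘ suc)))
  (ℚ.+-identityˡ (g (suc k)))

-- Recursion on the first letter in place of a sum over the list `words m n`, so that digits can be
-- summed out one at a time.
∑ʷ : ∀ m n → (Vec (Fin m) n → ℚ) → ℚ
∑ʷ m zero    f = f []
∑ʷ m (suc n) f = sum λ s → ∑ʷ m n λ x → f (s ∷ x)

module _ {m : ℕ} where

  ∑ʷ-cong : ∀ {n} {f g : Vec (Fin m) n → ℚ} → (∀ x → f x ≡ g x) → ∑ʷ m n f ≡ ∑ʷ m n g
  ∑ʷ-cong {zero}  f≡g = f≡g []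
  ∑ʷ-cong {suc n} f≡g = sum-cong λ s → ∑ʷ-cong λ x → f≡g (s ∷ x)

  ∑ʷ-*ˡ : ∀ {n} c (f : Vec (Fin m) n → ℚ) → ∑ʷ m n (λ x → c * f x) ≡ c * ∑ʷ m n f
  ∑ʷ-*ˡ {zero}  c f = refl
  ∑ʷ-*ˡ {suc n} c f = trans (sum-cong λ s → ∑ʷ-*ˡ c (λ x → f (s ∷ x)))
    (sum-*ˡ c (λ s → ∑ʷ m n λ x → f (s ∷ x)))

  ∑ʷ-+ : ∀ {n} (f g : Vec (Fin m) n → ℚ) → ∑ʷ m n (λ x → f x + g x) ≡ ∑ʷ m n f + ∑ʷ m n g
  ∑ʷ-+ {zero}  f g = refl
  ∑ʷ-+ {suc n} f g = trans (sum-cong λ s → ∑ʷ-+ (λ x → f (s ∷ x)) (λ x → g (s ∷ x)))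
    (∑-distrib-+ (λ s → ∑ʷ m n λ x → f (s ∷ x)) (λ s → ∑ʷ m n λ x → g (s ∷ x)))

  ∑ʷ-- : ∀ {n} (f g : Vec (Fin m) n → ℚ) → ∑ʷ m n (λ x → f x - g x) ≡ ∑ʷ m n f - ∑ʷ m n g
  ∑ʷ-- {zero}  f g = refl
  ∑ʷ-- {suc n} f g = trans (sum-cong λ s → ∑ʷ-- (λ x → f (s ∷ x)) (λ x → g (s ∷ x)))
    (sum-- (λ s → ∑ʷ m n λ x → f (s ∷ x)) (λ s → ∑ʷ m n λ x → g (s ∷ x)))

  ∑ʷ-const : ∀ n c → ∑ʷ m n (λ _ → c) ≡ fromℕ (m ^ n) * c
  ∑ʷ-const zero    c = sym (ℚ.*-identityˡ c)
  ∑ʷ-const (suc n) c = begin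
    sum {m} (λ _ → ∑ʷ m n λ _ → c)   ≡⟨ sum-const m _ ⟩
    fromℕ m * ∑ʷ m n (λ _ → c)       ≡⟨ cong (fromℕ m *_) (∑ʷ-const n c) ⟩
    fromℕ m * (fromℕ (m ^ n) * c)    ≡⟨ ℚ.*-assoc (fromℕ m) (fromℕ (m ^ n)) c ⟨
    fromℕ m * fromℕ (m ^ n) * c      ≡⟨ cong (_* c) (fromℕ-* m (m ^ n)) ⟨
    fromℕ (m ^ suc n) * c            ∎
    where open ≡-Reasoning

  ∑ʷ-mono-≤ : ∀ {n} {f g : Vec (Fin m) n → ℚ} → (∀ x → f x ℚ.≤ g x) → ∑ʷ m n f ℚ.≤ ∑ʷ m n g
  ∑ʷ-mono-≤ {zero}  f≤g = f≤g []
  ∑ʷ-mono-≤ {suc n} f≤g = sum-mono-≤ λ s → ∑ʷ-mono-≤ λ x → f≤g (s ∷ x)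

  ∑ʷ-sum : ∀ {n k} (f : Vec (Fin m) n → Fin k → ℚ) →
           ∑ʷ m n (λ x → sum (f x)) ≡ sum (λ j → ∑ʷ m n (λ x → f x j))
  ∑ʷ-sum {zero}          f = refl
  ∑ʷ-sum {suc n} {k} f = trans (sum-cong λ s → ∑ʷ-sum (λ x → f (s ∷ x)))
    (∑-comm {m} {k} λ s j → ∑ʷ m n λ x → f (s ∷ x) j)

∑ᴸ : {A : Set} → List A → (A → ℚ) → ℚ
∑ᴸ []       h = 0ℚ
∑ᴸ (x ∷ xs) h = h x + ∑ᴸ xs h

module _ {A : Set} where

  length-filter : ∀ {P : Pred A 0ℓ} (P? : Decidable P) xs →
                  fromℕ (length (filter P? xs)) ≡ ∑ᴸ xs (λ x → ⟦ does (P? x) ⟧)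
  length-filter P? []       = refl
  length-filter P? (x ∷ xs) with does (P? x)
  ... | true  = trans (fromℕ-suc (length (filter P? xs))) (cong (1ℚ ℚ.+_) (length-filter P? xs))
  ... | false = trans (length-filter P? xs) (sym (ℚ.+-identityˡ _))

  ∑ᴸ-++ : ∀ xs ys (h : A → ℚ) → ∑ᴸ (xs List.++ ys) h ≡ ∑ᴸ xs h + ∑ᴸ ys h
  ∑ᴸ-++ []       ys h = sym (ℚ.+-identityˡ _)
  ∑ᴸ-++ (x ∷ xs) ys h = trans (cong (h x ℚ.+_) (∑ᴸ-++ xs ys h)) (sym (ℚ.+-assoc (h x) _ _))

  ∑ᴸ-map : ∀ {B : Set} (f : B → A) ys (h : A → ℚ) → ∑ᴸ (List.map f ys) h ≡ ∑ᴸ ys (h ∘ f)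
  ∑ᴸ-map f []       h = refl
  ∑ᴸ-map f (y ∷ ys) h = cong (h (f y) ℚ.+_) (∑ᴸ-map f ys h)

  ∑ᴸ-tabulate : ∀ {n} (f : Fin n → A) (h : A → ℚ) → ∑ᴸ (tabulate f) h ≡ sum (h ∘ f)
  ∑ᴸ-tabulate {zero}  f h = refl
  ∑ᴸ-tabulate {suc n} f h = cong (h (f zero) ℚ.+_) (∑ᴸ-tabulate (f ∘ suc) h)

∑ᴸ-cong : ∀ {A : Set} xs {g h : A → ℚ} → (∀ x → g x ≡ h x) → ∑ᴸ xs g ≡ ∑ᴸ xs h
∑ᴸ-cong []       g≡h = refl
∑ᴸ-cong (x ∷ xs) g≡h = cong₂ _+_ (g≡h x) (∑ᴸ-cong xs g≡h)

∑ᴸ-cartesianProductWith : ∀ {A B C : Set} (f : A → B → C) xs ys (h : C → ℚ) →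
  ∑ᴸ (cartesianProductWith f xs ys) h ≡ ∑ᴸ xs (λ x → ∑ᴸ ys (λ y → h (f x y)))
∑ᴸ-cartesianProductWith f []       ys h = refl
∑ᴸ-cartesianProductWith f (x ∷ xs) ys h = trans (∑ᴸ-++ (List.map (f x) ys) _ h)
  (cong₂ _+_ (∑ᴸ-map (f x) ys h) (∑ᴸ-cartesianProductWith f xs ys h))

∑ᴸ-words : ∀ m n (h : Vec (Fin m) n → ℚ) → ∑ᴸ (words m n) h ≡ ∑ʷ m n h
∑ᴸ-words m zero    h = ℚ.+-identityʳ (h [])
∑ᴸ-words m (suc n) h = begin
  ∑ᴸ (cartesianProductWith _∷_ (allFin m) (words m n)) h
    ≡⟨ ∑ᴸ-cartesianProductWith _∷_ (allFin m) (words m n) h ⟩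
  ∑ᴸ (allFin m) (λ s → ∑ᴸ (words m n) (λ x → h (s ∷ x)))
    ≡⟨ ∑ᴸ-tabulate {n = m} id _ ⟩
  sum (λ s → ∑ᴸ (words m n) (λ x → h (s ∷ x)))
    ≡⟨ sum-cong (λ s → ∑ᴸ-words m n (λ x → h (s ∷ x))) ⟩
  ∑ʷ m (suc n) h ∎
  where open ≡-Reasoning

count-words : ∀ m n {P : Pred (Vec (Fin m) n) 0ℓ} (P? : Decidable P) →
              fromℕ (length (filter P? (words m n))) ≡ ∑ʷ m n (λ x → ⟦ does (P? x) ⟧)
count-words m n P? = trans (length-filter P? (words m n)) (∑ᴸ-words m n _)

-- The carry as a random map

digitSum : ∀ {b n} → Vec (Fin b) n → ℕ
digitSum x = Vec.sum (Vec.map toℕ x)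

-- Each digit is at most b - 1; the `n` missing units are what keeps the new carry below `n`.
digitSum-bound : ∀ {b n} (x : Vec (Fin b) n) → n ℕ.+ digitSum x ≤ n ℕ.* b
digitSum-bound []              = ℕ.z≤n
digitSum-bound {b} {suc n} (s ∷ x) = begin
  suc (n ℕ.+ (toℕ s ℕ.+ digitSum x))  ≡⟨ cong suc (swap n (toℕ s) (digitSum x)) ⟩
  suc (toℕ s) ℕ.+ (n ℕ.+ digitSum x)  ≤⟨ ℕ.+-mono-≤ (Fin.toℕ<n s) (digitSum-bound x) ⟩
  b ℕ.+ n ℕ.* b                       ∎
  where
  open ℕ.≤-Reasoning
  swap : ∀ a c d → a ℕ.+ (c ℕ.+ d) ≡ c ℕ.+ (a ℕ.+ d)
  swap a c d = trans (sym (ℕ.+-assoc a c d)) (trans (cong (ℕ._+ d) (ℕ.+-comm a c)) (ℕ.+-assoc c a d))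

newCarry<n : ∀ {n} b .{{_ : NonZero b}} (i : Fin n) (x : Vec (Fin b) n) → newCarry b (toℕ i) x ℕ.< n
newCarry<n b i x = ℕ.m<n*o⇒m/o<n
  (ℕ.<-≤-trans (ℕ.+-monoˡ-< (digitSum x) (Fin.toℕ<n i)) (digitSum-bound x))

step : ∀ {n} b .{{_ : NonZero b}} → Fin n → Vec (Fin b) n → Fin n
step b i x = fromℕ< (newCarry<n b i x)

toℕ-step : ∀ {n} b .{{_ : NonZero b}} (i : Fin n) x → toℕ (step b i x) ≡ newCarry b (toℕ i) x
toℕ-step b i x = Fin.toℕ-fromℕ< (newCarry<n b i x)

-- For a transition matrix this is the conditional expectation of `g` after one step from `i`.
infixr 8 _∙_
_∙_ : ∀ {n} → Matrix n → (Fin n → ℚ) → Fin n → ℚ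
(M ∙ g) i = sum λ j → M i j * g j

1/^ : ∀ b .{{_ : NonZero b}} → ℕ → ℚ
1/^ b r = (+ 1 ℚ./ (b ^ r)) {{ℕ.m^n≢0 b r}}

module _ (b n : ℕ) .{{_ : NonZero b}} where

  private
    w = 1/^ b n

  carriesMatrix-words : ∀ i j → carriesMatrix b n i j ≡
    w * ∑ʷ b n (λ x → ⟦ newCarry b (toℕ i) x ℕ.≡ᵇ toℕ j ⟧)
  carriesMatrix-words i j = trans (/-fromℕ (length (filter (λ x → newCarry b (toℕ i) x ℕ.≟ toℕ j) (words b n))) (b ^ n) {{ℕ.m^n≢0 b n}})
    (trans (cong (_* w) (count-words b n λ x → newCarry b (toℕ i) x ℕ.≟ toℕ j))
      (ℚ.*-comm (∑ʷ b n λ x → ⟦ newCarry b (toℕ i) x ℕ.≡ᵇ toℕ j ⟧) w))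

  -- A step is the image of `i` under a random map. The same word `x` serves every starting state,
  -- which is what couples two chains later.
  carriesMatrix-∙ : ∀ g i → (carriesMatrix b n ∙ g) i ≡ w * ∑ʷ b n (λ x → g (step b i x))
  carriesMatrix-∙ g i = begin
    sum (λ j → carriesMatrix b n i j * g j)
      ≡⟨ sum-cong (λ j → cong (_* g j) (carriesMatrix-words i j)) ⟩
    sum (λ j → w * ∑ʷ b n (λ x → hit x j) * g j)
      ≡⟨ sum-cong (λ j → regroup w _ (g j)) ⟩
    sum (λ j → w * (g j * ∑ʷ b n (λ x → hit x j)))
      ≡⟨ sum-*ˡ w (λ j → g j * ∑ʷ b n (λ x → hit x j)) ⟩
    w * sum (λ j → g j * ∑ʷ b n (λ x → hit x j))
      ≡⟨ cong (w *_) (sum-cong λ j → trans (sym (∑ʷ-*ˡ (g j) (λ x → hit x j)))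
           (∑ʷ-cong λ x → ℚ.*-comm (g j) (hit x j))) ⟩
    w * sum (λ j → ∑ʷ b n (λ x → hit x j * g j))
      ≡⟨ cong (w *_) (∑ʷ-sum λ x j → hit x j * g j) ⟨
    w * ∑ʷ b n (λ x → sum (λ j → hit x j * g j))
      ≡⟨ cong (w *_) (∑ʷ-cong λ x → trans
           (sum-cong λ j → cong (λ z → ⟦ z ℕ.≡ᵇ toℕ j ⟧ * g j) (sym (toℕ-step b i x)))
           (sum-pick (step b i x) g)) ⟩
    w * ∑ʷ b n (λ x → g (step b i x)) ∎
    where
    open ≡-Reasoning
    hit : Vec (Fin b) n → Fin n → ℚ
    hit x j = ⟦ newCarry b (toℕ i) x ℕ.≡ᵇ toℕ j ⟧
    regroup : ∀ p q r → p * q * r ≡ p * (r * q)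
    regroup = solve-∀ ℚ-ring

-- Moments of the carry

-- Both sides are the sum of `h` over 0, ..., b. This yields Hermite's identity and the telescoping
-- of block sums.
sum-shift : ∀ b (h : ℕ → ℚ) →
            sum {b} (λ s → h (suc (toℕ s))) + h 0 ≡ sum {b} (λ s → h (toℕ s)) + h b
sum-shift zero    h = refl
sum-shift (suc b) h = begin
  (h 1 + sum {b} (λ s → h (suc (suc (toℕ s))))) + h 0  ≡⟨ rotate (h 1) _ (h 0) ⟩
  h 0 + (sum {b} (λ s → h (suc (suc (toℕ s)))) + h 1)  ≡⟨ cong (h 0 ℚ.+_) (sum-shift b (h ∘ suc)) ⟩
  h 0 + (sum {b} (λ s → h (suc (toℕ s))) + h (suc b))  ≡⟨ ℚ.+-assoc (h 0) _ _ ⟨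
  (h 0 + sum {b} (λ s → h (suc (toℕ s)))) + h (suc b)  ∎
  where
  open ≡-Reasoning
  rotate : ∀ p q r → (p + q) + r ≡ r + (q + p)
  rotate = solve-∀ ℚ-ring

¼ ⅓ : ℚ
¼ = + 1 ℚ./ 4
⅓ = + 1 ℚ./ 3

¹⁄₁₂ : ℚ
¹⁄₁₂ = + 1 ℚ./ 12

-- The offset `c` closes the induction: dropping the first term replaces `c` by `c + 1`.
sum-+toℕ : ∀ b c → sum {b} (λ s → c + fromℕ (toℕ s)) ≡ fromℕ b * (c + ½ * (fromℕ b - 1ℚ))
sum-+toℕ zero    c = sym (ℚ.*-zeroˡ (c + ½ * (0ℚ - 1ℚ)))
sum-+toℕ (suc b) c = begin
  (c + 0ℚ) + sum {b} (λ s → c + fromℕ (suc (toℕ s)))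
    ≡⟨ cong ((c + 0ℚ) ℚ.+_) (sum-cong λ s → shift s) ⟩
  (c + 0ℚ) + sum {b} (λ s → (c + 1ℚ) + fromℕ (toℕ s))
    ≡⟨ cong ((c + 0ℚ) ℚ.+_) (sum-+toℕ b (c + 1ℚ)) ⟩
  (c + 0ℚ) + fromℕ b * ((c + 1ℚ) + ½ * (fromℕ b - 1ℚ))
    ≡⟨ algebra c (fromℕ b) ⟩
  (1ℚ + fromℕ b) * (c + ½ * ((1ℚ + fromℕ b) - 1ℚ))
    ≡⟨ cong (λ β → β * (c + ½ * (β - 1ℚ))) (fromℕ-suc b) ⟨
  fromℕ (suc b) * (c + ½ * (fromℕ (suc b) - 1ℚ)) ∎
  where
  open ≡-Reasoning
  shift : ∀ (s : Fin b) → c + fromℕ (suc (toℕ s)) ≡ (c + 1ℚ) + fromℕ (toℕ s)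
  shift s = trans (cong (c ℚ.+_) (fromℕ-suc (toℕ s))) (sym (ℚ.+-assoc c 1ℚ _))
  algebra : ∀ c β → (c + 0ℚ) + β * ((c + 1ℚ) + ½ * (β - 1ℚ)) ≡ (1ℚ + β) * (c + ½ * ((1ℚ + β) - 1ℚ))
  algebra = solve-∀ ℚ-ring

-- The right side is squared mean plus variance, (b² - 1)/12 being the variance of a uniform digit.
sum-[+toℕ]² : ∀ b c → sum {b} (λ s → (c + fromℕ (toℕ s)) * (c + fromℕ (toℕ s))) ≡
  fromℕ b * ((c + ½ * (fromℕ b - 1ℚ)) * (c + ½ * (fromℕ b - 1ℚ)) + ¹⁄₁₂ * (fromℕ b * fromℕ b - 1ℚ))
sum-[+toℕ]² zero    c = sym (ℚ.*-zeroˡ ((c + ½ * (0ℚ - 1ℚ)) * (c + ½ * (0ℚ - 1ℚ)) + ¹⁄₁₂ * (0ℚ * 0ℚ - 1ℚ)))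
sum-[+toℕ]² (suc b) c = begin
  (c + 0ℚ) * (c + 0ℚ) + sum {b} (λ s → (c + fromℕ (suc (toℕ s))) * (c + fromℕ (suc (toℕ s))))
    ≡⟨ cong ((c + 0ℚ) * (c + 0ℚ) ℚ.+_) (sum-cong λ s → cong (λ z → z * z) (shift s)) ⟩
  (c + 0ℚ) * (c + 0ℚ) + sum {b} (λ s → ((c + 1ℚ) + fromℕ (toℕ s)) * ((c + 1ℚ) + fromℕ (toℕ s)))
    ≡⟨ cong ((c + 0ℚ) * (c + 0ℚ) ℚ.+_) (sum-[+toℕ]² b (c + 1ℚ)) ⟩
  (c + 0ℚ) * (c + 0ℚ) + fromℕ b * (((c + 1ℚ) + ½ * (fromℕ b - 1ℚ)) * ((c + 1ℚ) + ½ * (fromℕ b - 1ℚ))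
                + ¹⁄₁₂ * (fromℕ b * fromℕ b - 1ℚ))
    ≡⟨ algebra c (fromℕ b) ⟩
  (1ℚ + fromℕ b) * ((c + ½ * ((1ℚ + fromℕ b) - 1ℚ)) * (c + ½ * ((1ℚ + fromℕ b) - 1ℚ))
    + ¹⁄₁₂ * ((1ℚ + fromℕ b) * (1ℚ + fromℕ b) - 1ℚ))
    ≡⟨ cong (λ β → β * ((c + ½ * (β - 1ℚ)) * (c + ½ * (β - 1ℚ)) + ¹⁄₁₂ * (β * β - 1ℚ))) (fromℕ-suc b) ⟨
  fromℕ (suc b) * ((c + ½ * (fromℕ (suc b) - 1ℚ)) * (c + ½ * (fromℕ (suc b) - 1ℚ))
    + ¹⁄₁₂ * (fromℕ (suc b) * fromℕ (suc b) - 1ℚ)) ∎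
  where
  open ≡-Reasoning
  shift : ∀ (s : Fin b) → c + fromℕ (suc (toℕ s)) ≡ (c + 1ℚ) + fromℕ (toℕ s)
  shift s = trans (cong (c ℚ.+_) (fromℕ-suc (toℕ s))) (sym (ℚ.+-assoc c 1ℚ _))
  algebra : ∀ c β → (c + 0ℚ) * (c + 0ℚ) + β * (((c + 1ℚ) + ½ * (β - 1ℚ)) * ((c + 1ℚ) + ½ * (β - 1ℚ))
                + (+ 1 ℚ./ 12) * (β * β - 1ℚ))
    ≡ (1ℚ + β) * ((c + ½ * ((1ℚ + β) - 1ℚ)) * (c + ½ * ((1ℚ + β) - 1ℚ))
    + (+ 1 ℚ./ 12) * ((1ℚ + β) * (1ℚ + β) - 1ℚ))
  algebra = solve-∀ ℚ-ring

module _ (b : ℕ) .{{_ : NonZero b}} where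

  private
    β = fromℕ b

  ∑ʷ-+digitSum : ∀ m c → ∑ʷ b m (λ x → c + fromℕ (digitSum x)) ≡
    fromℕ (b ^ m) * (c + fromℕ m * (½ * (β - 1ℚ)))
  ∑ʷ-+digitSum zero    c = zero-case c (½ * (β - 1ℚ))
    where
    zero-case : ∀ c d → c + 0ℚ ≡ 1ℚ * (c + 0ℚ * d)
    zero-case = solve-∀ ℚ-ring
  ∑ʷ-+digitSum (suc m) c = begin
    sum {b} (λ s → ∑ʷ b m (λ x → c + fromℕ (toℕ s ℕ.+ digitSum x)))
      ≡⟨ sum-cong {b} (λ s → trans (∑ʷ-cong λ x → split s x) (∑ʷ-+digitSum m (c + fromℕ (toℕ s)))) ⟩
    sum {b} (λ s → B * ((c + fromℕ (toℕ s)) + M * D))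
      ≡⟨ sum-*ˡ {b} B (λ s → (c + fromℕ (toℕ s)) + M * D) ⟩
    B * sum {b} (λ s → (c + fromℕ (toℕ s)) + M * D)
      ≡⟨ cong (B *_) (trans (sum-cong {b} λ s → swap c (fromℕ (toℕ s)) (M * D)) (sum-+toℕ b (c + M * D))) ⟩
    B * (β * ((c + M * D) + D))
      ≡⟨ algebra B β c M D ⟩
    (β * B) * (c + (1ℚ + M) * D)
      ≡⟨ cong₂ (λ p q → p * (c + q * D)) (fromℕ-* b (b ^ m)) (fromℕ-suc m) ⟨
    fromℕ (b ^ suc m) * (c + fromℕ (suc m) * D) ∎
    where
    open ≡-Reasoning
    B = fromℕ (b ^ m)
    M = fromℕ m
    D = ½ * (β - 1ℚ)
    split : ∀ (s : Fin b) (x : Vec (Fin b) m) →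
            c + fromℕ (toℕ s ℕ.+ digitSum x) ≡ (c + fromℕ (toℕ s)) + fromℕ (digitSum x)
    split s x = trans (cong (c ℚ.+_) (fromℕ-+ (toℕ s) (digitSum x))) (sym (ℚ.+-assoc c _ _))
    swap : ∀ p q r → (p + q) + r ≡ (p + r) + q
    swap = solve-∀ ℚ-ring
    algebra : ∀ B β c M D → B * (β * ((c + M * D) + D)) ≡ (β * B) * (c + (1ℚ + M) * D)
    algebra = solve-∀ ℚ-ring

  -- Squared mean plus variance again. Each digit in turn joins the offset `c`, so independence
  -- shows up as additivity of the variances, without cross terms.
  ∑ʷ-[+digitSum]² : ∀ m c → ∑ʷ b m (λ x → (c + fromℕ (digitSum x)) * (c + fromℕ (digitSum x))) ≡
    fromℕ (b ^ m) * ((c + fromℕ m * (½ * (β - 1ℚ))) * (c + fromℕ m * (½ * (β - 1ℚ)))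
                     + fromℕ m * (¹⁄₁₂ * (β * β - 1ℚ)))
  ∑ʷ-[+digitSum]² zero    c = zero-case c (½ * (β - 1ℚ)) (¹⁄₁₂ * (β * β - 1ℚ))
    where
    zero-case : ∀ c d e → (c + 0ℚ) * (c + 0ℚ) ≡ 1ℚ * ((c + 0ℚ * d) * (c + 0ℚ * d) + 0ℚ * e)
    zero-case = solve-∀ ℚ-ring
  ∑ʷ-[+digitSum]² (suc m) c = begin
    sum {b} (λ s → ∑ʷ b m (λ x → (c + fromℕ (toℕ s ℕ.+ digitSum x)) * (c + fromℕ (toℕ s ℕ.+ digitSum x))))
      ≡⟨ sum-cong {b} (λ s → trans (∑ʷ-cong λ x → cong (λ z → z * z) (split s x))
                               (∑ʷ-[+digitSum]² m (c + fromℕ (toℕ s)))) ⟩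
    sum {b} (λ s → B * (((c + fromℕ (toℕ s)) + M * D) * ((c + fromℕ (toℕ s)) + M * D) + M * E))
      ≡⟨ sum-*ˡ {b} B (λ s → ((c + fromℕ (toℕ s)) + M * D) * ((c + fromℕ (toℕ s)) + M * D) + M * E) ⟩
    B * sum {b} (λ s → ((c + fromℕ (toℕ s)) + M * D) * ((c + fromℕ (toℕ s)) + M * D) + M * E)
      ≡⟨ cong (B *_) (trans (∑-distrib-+ {b} (λ s → ((c + fromℕ (toℕ s)) + M * D) * ((c + fromℕ (toℕ s)) + M * D)) (λ _ → M * E))
           (cong₂ _+_ (trans (sum-cong {b} λ s → cong (λ z → z * z) (swap c (fromℕ (toℕ s)) (M * D)))
                        (sum-[+toℕ]² b (c + M * D)))
                      (sum-const b (M * E)))) ⟩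
    B * (β * (((c + M * D) + D) * ((c + M * D) + D) + E) + β * (M * E))
      ≡⟨ algebra B β c M D E ⟩
    (β * B) * ((c + (1ℚ + M) * D) * (c + (1ℚ + M) * D) + (1ℚ + M) * E)
      ≡⟨ cong₂ (λ p q → p * ((c + q * D) * (c + q * D) + q * E)) (fromℕ-* b (b ^ m)) (fromℕ-suc m) ⟨
    fromℕ (b ^ suc m) * ((c + fromℕ (suc m) * D) * (c + fromℕ (suc m) * D) + fromℕ (suc m) * E) ∎
    where
    open ≡-Reasoning
    B = fromℕ (b ^ m)
    M = fromℕ m
    D = ½ * (β - 1ℚ)
    E = ¹⁄₁₂ * (β * β - 1ℚ)
    split : ∀ (s : Fin b) (x : Vec (Fin b) m) →
            c + fromℕ (toℕ s ℕ.+ digitSum x) ≡ (c + fromℕ (toℕ s)) + fromℕ (digitSum x)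
    split s x = trans (cong (c ℚ.+_) (fromℕ-+ (toℕ s) (digitSum x))) (sym (ℚ.+-assoc c _ _))
    swap : ∀ p q r → (p + q) + r ≡ (p + r) + q
    swap = solve-∀ ℚ-ring
    algebra : ∀ B β c M D E → B * (β * (((c + M * D) + D) * ((c + M * D) + D) + E) + β * (M * E))
      ≡ (β * B) * ((c + (1ℚ + M) * D) * (c + (1ℚ + M) * D) + (1ℚ + M) * E)
    algebra = solve-∀ ℚ-ring

  [y+b]/b : ∀ y → (y ℕ.+ b) div b ≡ suc (y div b)
  [y+b]/b y = trans (ℕ.m/n≡1+[m∸n]/n (ℕ.m≤n+m b y)) (cong (λ z → suc (z div b)) (ℕ.m+n∸n≡m y b))

  -- Raising `y` by one drops the term ⌊y/b⌋ and gains ⌊(y + b)/b⌋, which is larger by one.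
  hermite : ∀ y → sum {b} (λ s → fromℕ ((y ℕ.+ toℕ s) div b)) ≡ fromℕ y
  hermite zero    = trans (sum-cong {b} λ s → cong fromℕ (ℕ.m<n⇒m/n≡0 (Fin.toℕ<n s))) (sum-0 b)
  hermite (suc y) = begin
    sum {b} (λ s → fromℕ ((suc y ℕ.+ toℕ s) div b))
      ≡⟨ sum-cong {b} (λ s → cong (λ z → fromℕ (z div b)) (sym (ℕ.+-suc y (toℕ s)))) ⟩
    sum {b} (λ s → h (suc (toℕ s)))
      ≡⟨ insert _ (h 0) ⟩
    (sum {b} (λ s → h (suc (toℕ s))) + h 0) - h 0
      ≡⟨ cong (_- h 0) (sum-shift b h) ⟩
    (sum {b} (λ s → h (toℕ s)) + h b) - h 0
      ≡⟨ cong₂ (λ p q → (p + q) - h 0) (hermite y) last ⟩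
    (fromℕ y + (1ℚ + h 0)) - h 0
      ≡⟨ algebra (fromℕ y) (h 0) ⟩
    1ℚ + fromℕ y
      ≡⟨ fromℕ-suc y ⟨
    fromℕ (suc y) ∎
    where
    open ≡-Reasoning
    h : ℕ → ℚ
    h s = fromℕ ((y ℕ.+ s) div b)
    last : h b ≡ 1ℚ + h 0
    last = trans (cong fromℕ ([y+b]/b y)) (trans (fromℕ-suc (y div b))
      (cong (λ z → 1ℚ + fromℕ (z div b)) (sym (ℕ.+-identityʳ y))))
    insert : ∀ p q → p ≡ (p + q) - q
    insert = solve-∀ ℚ-ring
    algebra : ∀ p q → (p + (1ℚ + q)) - q ≡ 1ℚ + p
    algebra = solve-∀ ℚ-ring

  -- Adding s < b crosses at most one multiple of `b`. The alternative is stated as a vanishing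
  -- product so that ring algebra can eliminate the square of `h`.
  [y+s]/b-values : ∀ y (s : Fin b) → let h = fromℕ ((y ℕ.+ toℕ s) div b); q = fromℕ (y div b) in
    (h - q) * (h - (q + 1ℚ)) ≡ 0ℚ
  [y+s]/b-values y s with ℕ.m≤n⇒m<n∨m≡n (ℕ./-monoˡ-≤ b (ℕ.m≤m+n y (toℕ s)))
  ... | inj₂ eq = trans (cong (λ z → (fromℕ z - q) * (fromℕ z - (q + 1ℚ))) (sym eq)) (low q)
    where
    q = fromℕ (y div b)
    low : ∀ q → (q - q) * (q - (q + 1ℚ)) ≡ 0ℚ
    low = solve-∀ ℚ-ring
  ... | inj₁ lt = trans (cong (λ z → (z - q) * (z - (q + 1ℚ)))
      (trans (cong fromℕ (ℕ.≤-antisym upper lt)) (fromℕ-suc (y div b)))) (high q)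
    where
    q = fromℕ (y div b)
    upper : (y ℕ.+ toℕ s) div b ≤ suc (y div b)
    upper = ℕ.≤-trans (ℕ./-monoˡ-≤ b (ℕ.+-monoʳ-≤ y (ℕ.<⇒≤ (Fin.toℕ<n s)))) (ℕ.≤-reflexive ([y+b]/b y))
    high : ∀ q → ((1ℚ + q) - q) * ((1ℚ + q) - (q + 1ℚ)) ≡ 0ℚ
    high = solve-∀ ℚ-ring

  -- Around each y the summand takes two consecutive values q, q + 1, so the square is an affine
  -- function of it and Hermite's identity applies; the defect is the square (y - bq - b/2)².
  hermite-² : ∀ y c → let h = λ (s : Fin b) → fromℕ ((y ℕ.+ toℕ s) div b) in
    β * sum (λ s → (h s - c) * (h s - c)) ℚ.≤ (fromℕ y - β * c) * (fromℕ y - β * c) + ¼ * (β * β)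
  hermite-² y c = ≤-by (defect * defect)
    (trans (algebra β Y c q) (cong (λ z → ((Y - β * c) * (Y - β * c) + ¼ * (β * β)) - β * z) (sym total)))
    (0≤² defect)
    where
    open ≡-Reasoning
    Y = fromℕ y
    q = fromℕ (y div b)
    h : Fin b → ℚ
    h s = fromℕ ((y ℕ.+ toℕ s) div b)
    defect = (Y - β * q) - ½ * β
    affine : ∀ h c q → (h - q) * (h - (q + 1ℚ)) + (((q + q + 1ℚ) - (c + c)) * h + (c * c - q * q - q)) ≡ (h - c) * (h - c)
    affine = solve-∀ ℚ-ring
    pointwise : ∀ s → (h s - c) * (h s - c) ≡ ((q + q + 1ℚ) - (c + c)) * h s + (c * c - q * q - q)
    pointwise s = trans (sym (affine (h s) c q))
      (trans (cong (ℚ._+ (((q + q + 1ℚ) - (c + c)) * h s + (c * c - q * q - q))) ([y+s]/b-values y s)) (ℚ.+-identityˡ _))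
    total : sum (λ s → (h s - c) * (h s - c)) ≡ ((q + q + 1ℚ) - (c + c)) * Y + β * (c * c - q * q - q)
    total = begin
      sum (λ s → (h s - c) * (h s - c))
        ≡⟨ sum-cong pointwise ⟩
      sum (λ s → ((q + q + 1ℚ) - (c + c)) * h s + (c * c - q * q - q))
        ≡⟨ ∑-distrib-+ (λ s → ((q + q + 1ℚ) - (c + c)) * h s) (λ _ → c * c - q * q - q) ⟩
      sum (λ s → ((q + q + 1ℚ) - (c + c)) * h s) + sum {b} (λ _ → c * c - q * q - q)
        ≡⟨ cong₂ _+_ (trans (sum-*ˡ ((q + q + 1ℚ) - (c + c)) h) (cong (((q + q + 1ℚ) - (c + c)) *_) (hermite y)))
                     (sum-const b (c * c - q * q - q)) ⟩
      ((q + q + 1ℚ) - (c + c)) * Y + β * (c * c - q * q - q) ∎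
    algebra : ∀ β Y c q → ((Y - β * q) - ½ * β) * ((Y - β * q) - ½ * β) ≡
      ((Y - β * c) * (Y - β * c) + (+ 1 ℚ./ 4) * (β * β)) -
        β * (((q + q + 1ℚ) - (c + c)) * Y + β * (c * c - q * q - q))
    algebra = solve-∀ ℚ-ring

∙-cong : ∀ {n} (M : Matrix n) {g h : Fin n → ℚ} → (∀ i → g i ≡ h i) → ∀ i → (M ∙ g) i ≡ (M ∙ h) i
∙-cong M g≡h i = sum-cong λ j → cong (M i j *_) (g≡h j)

∙-*ˡ : ∀ {n} (M : Matrix n) c g (i : Fin n) → (M ∙ λ j → c * g j) i ≡ c * (M ∙ g) i
∙-*ˡ M c g i = trans (sum-cong λ j → swap (M i j) c (g j)) (sum-*ˡ c λ j → M i j * g j)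
  where
  swap : ∀ p q r → p * (q * r) ≡ q * (p * r)
  swap = solve-∀ ℚ-ring

∙-+ : ∀ {n} (M : Matrix n) g h (i : Fin n) → (M ∙ λ j → g j + h j) i ≡ (M ∙ g) i + (M ∙ h) i
∙-+ M g h i = trans (sum-cong λ j → ℚ.*-distribˡ-+ (M i j) (g j) (h j))
  (∑-distrib-+ (λ j → M i j * g j) (λ j → M i j * h j))

identity-∙ : ∀ {n} (g : Fin n → ℚ) i → (identity ∙ g) i ≡ g i
identity-∙ g i = trans (sum-cong λ j → cong (_* g j) (indicator j)) (sum-pick i g)
  where
  ≡ᵇ-refl : ∀ k → (k ℕ.≡ᵇ k) ≡ true
  ≡ᵇ-refl zero    = refl
  ≡ᵇ-refl (suc k) = ≡ᵇ-refl k
  indicator : ∀ j → identity i j ≡ ⟦ toℕ i ℕ.≡ᵇ toℕ j ⟧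
  indicator j with i Fin.≟ j
  ... | yes refl = cong ⟦_⟧ (sym (≡ᵇ-refl (toℕ i)))
  ... | no  i≢j with toℕ i ℕ.≡ᵇ toℕ j in eq
  ...   | false = refl
  ...   | true  = contradiction (Fin.toℕ-injective (ℕ.≡ᵇ⇒≡ (toℕ i) (toℕ j) (subst T (sym eq) _))) i≢j

^ᴹ-suc-∙ : ∀ {n} (M : Matrix n) r g (i : Fin n) → ((M ^ᴹ suc r) ∙ g) i ≡ (M ∙ ((M ^ᴹ r) ∙ g)) i
^ᴹ-suc-∙ {n} M r g i = begin
  sum (λ j → sum (λ k → M i k * R k j) * g j)    ≡⟨ sum-cong (λ j → sum-*ʳ (g j) λ k → M i k * R k j) ⟨
  sum (λ j → sum (λ k → M i k * R k j * g j))    ≡⟨ ∑-comm {n} {n} (λ j k → M i k * R k j * g j) ⟩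
  sum (λ k → sum (λ j → M i k * R k j * g j))    ≡⟨ sum-cong (λ k → trans
                                                      (sum-cong λ j → ℚ.*-assoc (M i k) (R k j) (g j))
                                                      (sum-*ˡ (M i k) λ j → R k j * g j)) ⟩
  sum (λ k → M i k * sum (λ j → R k j * g j))    ∎
  where
  open ≡-Reasoning
  R = M ^ᴹ r

module _ (b : ℕ) .{{_ : NonZero b}} where

  1/^-inverse : ∀ r → fromℕ (b ^ r) * 1/^ b r ≡ 1ℚ
  1/^-inverse r = fromℕ-inverse (b ^ r) {{ℕ.m^n≢0 b r}}

  0<b^ : ∀ r → 0ℚ ℚ.< fromℕ (b ^ r)
  0<b^ r = 0<fromℕ (b ^ r) {{ℕ.m^n≢0 b r}}

  0≤1/^ : ∀ r → 0ℚ ℚ.≤ 1/^ b r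
  0≤1/^ r = ℚ.<⇒≤ (0<1/ (b ^ r) {{ℕ.m^n≢0 b r}})

  1/^-suc : ∀ r → 1/^ b (suc r) ≡ (+ 1 ℚ./ b) * 1/^ b r
  1/^-suc r = *-cancelˡ-≡ (fromℕ (b ^ suc r)) (0<b^ (suc r)) (trans (1/^-inverse (suc r)) (begin
    1ℚ
      ≡⟨ cong₂ _*_ (fromℕ-inverse b) (1/^-inverse r) ⟨
    (fromℕ b * (+ 1 ℚ./ b)) * (fromℕ (b ^ r) * 1/^ b r)
      ≡⟨ interchange (fromℕ b) (+ 1 ℚ./ b) (fromℕ (b ^ r)) (1/^ b r) ⟩
    (fromℕ b * fromℕ (b ^ r)) * ((+ 1 ℚ./ b) * 1/^ b r)
      ≡⟨ cong (_* ((+ 1 ℚ./ b) * 1/^ b r)) (fromℕ-* b (b ^ r)) ⟨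
    fromℕ (b ^ suc r) * ((+ 1 ℚ./ b) * 1/^ b r) ∎))
    where
    open ≡-Reasoning
    interchange : ∀ p q r s → (p * q) * (r * s) ≡ (p * r) * (q * s)
    interchange = solve-∀ ℚ-ring

centred : ∀ {n} → Fin n → ℚ
centred {n} i = fromℕ (toℕ i) - midpoint n

centred² : ∀ {n} → Fin n → ℚ
centred² i = centred i * centred i

module Chain (b m : ℕ) .{{_ : NonZero b}} where

  n : ℕ
  n = suc m

  P : Matrix n
  P = carriesMatrix b n

  private
    β β⁻¹ B w : ℚ
    β   = fromℕ b
    β⁻¹ = + 1 ℚ./ b
    B   = fromℕ (b ^ m)
    w   = 1/^ b n

  β*B*w≡1 : (β * B) * w ≡ 1ℚ
  β*B*w≡1 = trans (cong (_* w) (sym (fromℕ-* b (b ^ m)))) (1/^-inverse b n)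

  β*β⁻¹≡1 : β * β⁻¹ ≡ 1ℚ
  β*β⁻¹≡1 = fromℕ-inverse b

  midpoint-suc : midpoint n ≡ ½ * fromℕ m
  midpoint-suc = cong (½ *_) (trans (cong (_- 1ℚ) (fromℕ-suc m)) (drop (fromℕ m)))
    where
    drop : ∀ p → (1ℚ + p) - 1ℚ ≡ p
    drop = solve-∀ ℚ-ring

  0≤P : ∀ i j → 0ℚ ℚ.≤ P i j
  0≤P i j = ℚ.nonNegative⁻¹ (P i j) {{ℚ.normalize-nonNeg
    (length (filter (λ x → newCarry b (toℕ i) x ℕ.≟ toℕ j) (words b n))) (b ^ n) {{ℕ.m^n≢0 b n}}}}

  ∙-mono-≤ : ∀ {g h : Fin n → ℚ} → (∀ i → g i ℚ.≤ h i) → ∀ i → (P ∙ g) i ℚ.≤ (P ∙ h) i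
  ∙-mono-≤ g≤h i = sum-mono-≤ λ j → *-monoˡ-≤ (P i j) (0≤P i j) (g≤h j)

  P∙const : ∀ c i → (P ∙ λ _ → c) i ≡ c
  P∙const c i = begin
    (P ∙ λ _ → c) i                ≡⟨ carriesMatrix-∙ b n (λ _ → c) i ⟩
    w * ∑ʷ b n (λ _ → c)           ≡⟨ cong (w *_) (∑ʷ-const {b} n c) ⟩
    w * (fromℕ (b ^ n) * c)        ≡⟨ regroup w (fromℕ (b ^ n)) c ⟩
    (fromℕ (b ^ n) * w) * c        ≡⟨ cong (_* c) (1/^-inverse b n) ⟩
    1ℚ * c                         ≡⟨ ℚ.*-identityˡ c ⟩
    c                              ∎
    where
    open ≡-Reasoning
    regroup : ∀ p q r → p * (q * r) ≡ (q * p) * r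
    regroup = solve-∀ ℚ-ring

  -- The first digit of the word is moved innermost. With the others fixed the new carry runs over
  -- ⌊(y + s)/b⌋, the shape of Hermite's identity.
  ∑ʷ-newCarry : ∀ (F : ℕ → ℚ) i → ∑ʷ b n (λ x → F (newCarry b i x)) ≡
    ∑ʷ b m (λ x → sum {b} (λ s → F (((i ℕ.+ digitSum x) ℕ.+ toℕ s) div b)))
  ∑ʷ-newCarry F i = trans
    (sum-cong {b} λ s → ∑ʷ-cong {b} {m} λ x → cong (λ z → F (z div b)) (last s x))
    (sym (∑ʷ-sum {b} {m} {b} λ x s → F (((i ℕ.+ digitSum x) ℕ.+ toℕ s) div b)))
    where
    last : ∀ (s : Fin b) (x : Vec (Fin b) m) →
           i ℕ.+ (toℕ s ℕ.+ digitSum x) ≡ (i ℕ.+ digitSum x) ℕ.+ toℕ s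
    last s x = trans (cong (i ℕ.+_) (ℕ.+-comm (toℕ s) (digitSum x))) (sym (ℕ.+-assoc i _ _))

  -- The m = n - 1 remaining digits have mean total (n-1)(b-1)/2, which is b - 1 times the midpoint
  -- and so turns the centre `β * midpoint n` into `midpoint n`.
  centre-sum : ∀ i → (fromℕ i - β * midpoint n) + fromℕ m * (½ * (β - 1ℚ)) ≡ fromℕ i - midpoint n
  centre-sum i = trans
    (cong (λ μ → (fromℕ i - β * μ) + fromℕ m * (½ * (β - 1ℚ))) midpoint-suc)
    (trans (algebra (fromℕ i) β (fromℕ m)) (cong (λ μ → fromℕ i - μ) (sym midpoint-suc)))
    where
    algebra : ∀ i β M → (i - β * (½ * M)) + M * (½ * (β - 1ℚ)) ≡ i - ½ * M
    algebra = solve-∀ ℚ-ring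

  carry-split : ∀ i (x : Vec (Fin b) m) →
          fromℕ (i ℕ.+ digitSum x) - β * midpoint n ≡ (fromℕ i - β * midpoint n) + fromℕ (digitSum x)
  carry-split i x = trans (cong (_- β * midpoint n) (fromℕ-+ i (digitSum x))) (swap (fromℕ i) _ (β * midpoint n))
    where
    swap : ∀ p q r → (p + q) - r ≡ (p - r) + q
    swap = solve-∀ ℚ-ring

  -- Hermite's identity removes the floor, and what is left is affine in the other `m` digits. These
  -- have only bᵐ words against the normalisation bⁿ, whence the eigenvalue 1/b.
  P∙centred : ∀ i → (P ∙ centred) i ≡ β⁻¹ * centred i
  P∙centred i = begin
    (P ∙ centred) i
      ≡⟨ carriesMatrix-∙ b n centred i ⟩
    w * ∑ʷ b n (λ x → fromℕ (toℕ (step b i x)) - μ)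
      ≡⟨ cong (w *_) (∑ʷ-cong {b} {n} λ x → cong (λ z → fromℕ z - μ) (toℕ-step b i x)) ⟩
    w * ∑ʷ b n (λ x → fromℕ (newCarry b (toℕ i) x) - μ)
      ≡⟨ cong (w *_) (∑ʷ-newCarry (λ z → fromℕ z - μ) (toℕ i)) ⟩
    w * ∑ʷ b m (λ x → sum {b} (λ s → h x s - μ))
      ≡⟨ cong (w *_) (∑ʷ-cong {b} {m} λ x → trans (sum-- {b} (h x) (λ _ → μ))
           (cong₂ _-_ (hermite b (toℕ i ℕ.+ digitSum x)) (sum-const b μ))) ⟩
    w * ∑ʷ b m (λ x → fromℕ (toℕ i ℕ.+ digitSum x) - β * μ)
      ≡⟨ cong (w *_) (∑ʷ-cong {b} {m} (carry-split (toℕ i))) ⟩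
    w * ∑ʷ b m (λ x → (fromℕ (toℕ i) - β * μ) + fromℕ (digitSum x))
      ≡⟨ cong (w *_) (trans (∑ʷ-+digitSum b m (fromℕ (toℕ i) - β * μ)) (cong (B *_) (centre-sum (toℕ i)))) ⟩
    w * (B * centred i)
      ≡⟨ ℚ.*-identityˡ (w * (B * centred i)) ⟨
    1ℚ * (w * (B * centred i))
      ≡⟨ cong (_* (w * (B * centred i))) β*β⁻¹≡1 ⟨
    (β * β⁻¹) * (w * (B * centred i))
      ≡⟨ regroup β β⁻¹ w B (centred i) ⟩
    ((β * B) * w) * (β⁻¹ * centred i)
      ≡⟨ cong (_* (β⁻¹ * centred i)) β*B*w≡1 ⟩
    1ℚ * (β⁻¹ * centred i)
      ≡⟨ ℚ.*-identityˡ (β⁻¹ * centred i) ⟩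
    β⁻¹ * centred i ∎
    where
    open ≡-Reasoning
    μ = midpoint n
    h : Vec (Fin b) m → Fin b → ℚ
    h x s = fromℕ (((toℕ i ℕ.+ digitSum x) ℕ.+ toℕ s) div b)
    regroup : ∀ β γ w B f → (β * γ) * (w * (B * f)) ≡ ((β * B) * w) * (γ * f)
    regroup = solve-∀ ℚ-ring

  -- With n = m + 1 this is (n+3)/12. The share m/12 comes from the `m` digits; the remaining 1/3
  -- pays for the 1/4 in `hermite-²`, because 1/4 ≤ (1 - b⁻²)/3 for b ≥ 2.
  V : ℚ
  V = ¹⁄₁₂ * (fromℕ m + fromℕ 4)

  P∙centred² : 2 ≤ b → ∀ i → (P ∙ centred²) i ℚ.≤ (β⁻¹ * β⁻¹) * centred² i + V * (1ℚ - β⁻¹ * β⁻¹)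
  P∙centred² 2≤b i = ℚ.≤-trans (ℚ.≤-reflexive (begin
    (P ∙ centred²) i
      ≡⟨ carriesMatrix-∙ b n centred² i ⟩
    w * ∑ʷ b n (λ x → (fromℕ (toℕ (step b i x)) - μ) * (fromℕ (toℕ (step b i x)) - μ))
      ≡⟨ cong (w *_) (∑ʷ-cong {b} {n} λ x → cong (λ z → (fromℕ z - μ) * (fromℕ z - μ)) (toℕ-step b i x)) ⟩
    w * ∑ʷ b n (λ x → (fromℕ (newCarry b (toℕ i) x) - μ) * (fromℕ (newCarry b (toℕ i) x) - μ))
      ≡⟨ cong (w *_) (∑ʷ-newCarry (λ z → (fromℕ z - μ) * (fromℕ z - μ)) (toℕ i)) ⟩
    w * ∑ʷ b m (λ x → sum {b} (λ s → (h x s - μ) * (h x s - μ)))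
      ≡⟨ ℚ.*-identityˡ (w * S) ⟨
    1ℚ * (w * S)
      ≡⟨ cong (_* (w * S)) β*β⁻¹≡1 ⟨
    (β * β⁻¹) * (w * S)
      ≡⟨ regroup₁ β β⁻¹ w S ⟩
    (β⁻¹ * w) * (β * S)
      ≡⟨ cong ((β⁻¹ * w) *_) (∑ʷ-*ˡ {b} {m} β (λ x → sum {b} (λ s → (h x s - μ) * (h x s - μ)))) ⟨
    (β⁻¹ * w) * ∑ʷ b m (λ x → β * sum {b} (λ s → (h x s - μ) * (h x s - μ))) ∎))
    (ℚ.≤-trans (*-monoˡ-≤ (β⁻¹ * w) (0≤* (ℚ.<⇒≤ (0<1/ b)) (0≤1/^ b n))
      (∑ʷ-mono-≤ {b} {m} λ x → hermite-² b (toℕ i ℕ.+ digitSum x) μ))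
    (ℚ.≤-trans (ℚ.≤-reflexive (begin
      (β⁻¹ * w) * ∑ʷ b m (λ x → (Y x - β * μ) * (Y x - β * μ) + ¼ * (β * β))
        ≡⟨ cong ((β⁻¹ * w) *_) total ⟩
      (β⁻¹ * w) * (B * (f * f + M * E + ¼ * (β * β)))
        ≡⟨ ℚ.*-identityˡ _ ⟨
      1ℚ * ((β⁻¹ * w) * (B * (f * f + M * E + ¼ * (β * β))))
        ≡⟨ cong (_* ((β⁻¹ * w) * (B * (f * f + M * E + ¼ * (β * β))))) β*β⁻¹≡1 ⟨
      (β * β⁻¹) * ((β⁻¹ * w) * (B * (f * f + M * E + ¼ * (β * β))))
        ≡⟨ regroup₂ β β⁻¹ w B (f * f + M * E + ¼ * (β * β)) ⟩
      ((β * B) * w) * ((β⁻¹ * β⁻¹) * (f * f + M * E + ¼ * (β * β)))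
        ≡⟨ cong (_* ((β⁻¹ * β⁻¹) * (f * f + M * E + ¼ * (β * β)))) β*B*w≡1 ⟩
      1ℚ * ((β⁻¹ * β⁻¹) * (f * f + M * E + ¼ * (β * β)))
        ≡⟨ ℚ.*-identityˡ _ ⟩
      (β⁻¹ * β⁻¹) * (f * f + M * E + ¼ * (β * β)) ∎))
    -- The slack is (β² - 4)/(12β²), so the choice of `V` is tight at b = 2.
    (≤-by ((β⁻¹ * β⁻¹) * (¹⁄₁₂ * ((β - fromℕ 2) * (β - fromℕ 2 + fromℕ 4))))
      final
      (0≤* (0≤² β⁻¹) (0≤* (ℚ.<⇒≤ (0<1/ 12))
        (0≤* 0≤β-2 (0≤+ 0≤β-2 (0≤fromℕ 4))))))))
    where
    open ≡-Reasoning
    μ = midpoint n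
    f = centred i
    M = fromℕ m
    E = ¹⁄₁₂ * (β * β - 1ℚ)
    Y : Vec (Fin b) m → ℚ
    Y x = fromℕ (toℕ i ℕ.+ digitSum x)
    h : Vec (Fin b) m → Fin b → ℚ
    h x s = fromℕ (((toℕ i ℕ.+ digitSum x) ℕ.+ toℕ s) div b)
    S = ∑ʷ b m (λ x → sum {b} (λ s → (h x s - μ) * (h x s - μ)))
    0≤β-2 : 0ℚ ℚ.≤ β - fromℕ 2
    0≤β-2 = 0≤- (fromℕ-mono-≤ 2≤b)
    regroup₁ : ∀ β γ w S → (β * γ) * (w * S) ≡ (γ * w) * (β * S)
    regroup₁ = solve-∀ ℚ-ring
    regroup₂ : ∀ β γ w B Q → (β * γ) * ((γ * w) * (B * Q)) ≡ ((β * B) * w) * ((γ * γ) * Q)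
    regroup₂ = solve-∀ ℚ-ring
    collect : ∀ B p q → B * p + B * q ≡ B * (p + q)
    collect = solve-∀ ℚ-ring
    total : ∑ʷ b m (λ x → (Y x - β * μ) * (Y x - β * μ) + ¼ * (β * β)) ≡
            B * (f * f + M * E + ¼ * (β * β))
    total = begin
      ∑ʷ b m (λ x → (Y x - β * μ) * (Y x - β * μ) + ¼ * (β * β))
        ≡⟨ ∑ʷ-+ {b} {m} (λ x → (Y x - β * μ) * (Y x - β * μ)) (λ _ → ¼ * (β * β)) ⟩
      ∑ʷ b m (λ x → (Y x - β * μ) * (Y x - β * μ)) + ∑ʷ b m (λ _ → ¼ * (β * β))
        ≡⟨ cong₂ _+_ (∑ʷ-cong {b} {m} λ x → cong (λ z → z * z) (carry-split (toℕ i) x)) (∑ʷ-const m (¼ * (β * β))) ⟩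
      ∑ʷ b m (λ x → (c + fromℕ (digitSum x)) * (c + fromℕ (digitSum x))) + B * (¼ * (β * β))
        ≡⟨ cong (ℚ._+ B * (¼ * (β * β))) (trans (∑ʷ-[+digitSum]² b m c)
             (cong (λ z → B * (z * z + M * E)) (centre-sum (toℕ i)))) ⟩
      B * (f * f + M * E) + B * (¼ * (β * β))
        ≡⟨ collect B (f * f + M * E) (¼ * (β * β)) ⟩
      B * (f * f + M * E + ¼ * (β * β)) ∎
      where
      c = fromℕ (toℕ i) - β * μ
    algebra : ∀ β γ M f →
      (γ * γ) * ((+ 1 ℚ./ 12) * ((β - fromℕ 2) * (β - fromℕ 2 + fromℕ 4)))
      + ((+ 1 ℚ./ 12) * (M + fromℕ 4)) * ((β * γ) * (β * γ) - (β * γ) * (β * γ)) ≡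
      ((γ * γ) * (f * f) + ((+ 1 ℚ./ 12) * (M + fromℕ 4)) * ((β * γ) * (β * γ) - γ * γ))
      - (γ * γ) * (f * f + M * ((+ 1 ℚ./ 12) * (β * β - 1ℚ)) + (+ 1 ℚ./ 4) * (β * β))
    algebra = solve-∀ ℚ-ring
    final : (β⁻¹ * β⁻¹) * (¹⁄₁₂ * ((β - fromℕ 2) * (β - fromℕ 2 + fromℕ 4))) ≡
      ((β⁻¹ * β⁻¹) * centred² i + V * (1ℚ - β⁻¹ * β⁻¹)) - (β⁻¹ * β⁻¹) * (f * f + M * E + ¼ * (β * β))
    -- For the solver 1 is written as the square of `β * β⁻¹`, which makes the identity polynomial;
    -- `β*β⁻¹≡1` is applied afterwards.
    final = trans (trans (sym (drop _ V ((β * β⁻¹) * (β * β⁻¹)))) (algebra β β⁻¹ M f))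
      (cong (λ z → ((β⁻¹ * β⁻¹) * centred² i + V * (z * z - β⁻¹ * β⁻¹)) - (β⁻¹ * β⁻¹) * (f * f + M * E + ¼ * (β * β))) β*β⁻¹≡1)
      where
      drop : ∀ p q r → p + q * (r - r) ≡ p
      drop = solve-∀ ℚ-ring

-- Powers of the chain

-- The gap is measured by the eigenfunction `centred` and only for ordered pairs, so no absolute
-- value stands on the right and a step of the chain evaluates it exactly.
Lipschitz : ∀ {n} → ℚ → (Fin n → ℚ) → Set
Lipschitz L g = ∀ i j → toℕ i ≤ toℕ j → ∣ g i - g j ∣ ℚ.≤ L * (centred j - centred i)

centred-gap : ∀ {n} (k l : Fin n) → fromℕ (toℕ l) - fromℕ (toℕ k) ≡ centred l - centred k
centred-gap {n} k l = algebra (fromℕ (toℕ l)) (fromℕ (toℕ k)) (midpoint n)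
  where
  algebra : ∀ x y μ → x - y ≡ (x - μ) - (y - μ)
  algebra = solve-∀ ℚ-ring

oscillation≤1⇒Lipschitz : ∀ {n} {g : Fin n → ℚ} → (∀ k l → ∣ g k - g l ∣ ℚ.≤ 1ℚ) → Lipschitz 1ℚ g
oscillation≤1⇒Lipschitz {g = g} g≤1 k l k≤l with ℕ.m≤n⇒m<n∨m≡n k≤l
... | inj₂ eq = ℚ.≤-reflexive (trans
    (cong (λ z → ∣ g k - g z ∣) (sym (Fin.toℕ-injective eq)))
    (trans (cong ∣_∣ (ℚ.+-inverseʳ (g k)))
      (trans (sym (zero-gap (centred k))) (cong (λ z → 1ℚ * (centred z - centred k)) (Fin.toℕ-injective eq)))))
  where
  zero-gap : ∀ c → 1ℚ * (c - c) ≡ 0ℚ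
  zero-gap = solve-∀ ℚ-ring
... | inj₁ k<l = ℚ.≤-trans (g≤1 k l) (≤-by (fromℕ (toℕ l) - fromℕ (suc (toℕ k)))
    (trans (cong (λ z → fromℕ (toℕ l) - z) (fromℕ-suc (toℕ k)))
      (trans (algebra (fromℕ (toℕ l)) (fromℕ (toℕ k))) (cong (λ z → 1ℚ * z - 1ℚ) (centred-gap k l))))
    (0≤- (fromℕ-mono-≤ k<l)))
  where
  algebra : ∀ x y → x - (1ℚ + y) ≡ 1ℚ * (x - y) - 1ℚ
  algebra = solve-∀ ℚ-ring

-- The bound |i - k| ≤ i + k, arranged so that `k` enters only through `centred k`, whose stationary
-- mean vanishes.
Lipschitz⇒≤ : ∀ {n L} {H : Fin n → ℚ} → 0ℚ ℚ.≤ L → Lipschitz L H → ∀ i k →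
              H i - H k ℚ.≤ L * (centred k + (fromℕ (toℕ i) + midpoint n))
Lipschitz⇒≤ {n} {L} {H} 0≤L lip i k with ℕ.≤-total (toℕ i) (toℕ k)
... | inj₁ i≤k = ℚ.≤-trans (p≤∣p∣ (H i - H k)) (ℚ.≤-trans (lip i k i≤k)
    (*-monoˡ-≤ L 0≤L (≤-by (x + x) (above x (fromℕ (toℕ k)) (midpoint n)) (0≤+ 0≤x 0≤x))))
  where
  x = fromℕ (toℕ i)
  0≤x = 0≤fromℕ (toℕ i)
  above : ∀ x y μ → x + x ≡ ((y - μ) + (x + μ)) - ((y - μ) - (x - μ))
  above = solve-∀ ℚ-ring
... | inj₂ k≤i = ℚ.≤-trans (p≤∣p∣ (H i - H k)) (ℚ.≤-trans (ℚ.≤-reflexive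
    (trans (cong ∣_∣ (negate (H i) (H k))) (ℚ.∣-p∣≡∣p∣ (H k - H i)))) (ℚ.≤-trans (lip k i k≤i)
    (*-monoˡ-≤ L 0≤L (≤-by (y + y) (below (fromℕ (toℕ i)) y (midpoint n)) (0≤+ 0≤y 0≤y)))))
  where
  y = fromℕ (toℕ k)
  0≤y = 0≤fromℕ (toℕ k)
  negate : ∀ p q → p - q ≡ - (q - p)
  negate = solve-∀ ℚ-ring
  below : ∀ x y μ → y + y ≡ ((y - μ) + (x + μ)) - ((x - μ) - (y - μ))
  below = solve-∀ ℚ-ring

-- Total variation and test functions

½sign : ∀ {q} → Dec (0ℚ ℚ.≤ q) → ℚ
½sign (yes _) = ½
½sign (no  _) = - ½

½sign-* : ∀ {q} (0≤?q : Dec (0ℚ ℚ.≤ q)) → ½ * ∣ q ∣ ≡ ½sign 0≤?q * q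
½sign-* {q} (yes 0≤q) = cong (½ *_) (ℚ.0≤p⇒∣p∣≡p 0≤q)
½sign-* {q} (no  0≰q) = trans (cong (½ *_) (trans (sym (ℚ.∣-p∣≡∣p∣ q))
    (ℚ.0≤p⇒∣p∣≡p (ℚ.neg-antimono-≤ (ℚ.<⇒≤ (ℚ.≰⇒> 0≰q)))))) (move q)
  where
  move : ∀ q → ½ * - q ≡ - ½ * q
  move = solve-∀ ℚ-ring

½sign-gap : ∀ {q q′} (d : Dec (0ℚ ℚ.≤ q)) (d′ : Dec (0ℚ ℚ.≤ q′)) → ∣ ½sign d - ½sign d′ ∣ ℚ.≤ 1ℚ
½sign-gap (yes _) (yes _) = 0≤1
½sign-gap (yes _) (no  _) = ℚ.≤-refl
½sign-gap (no  _) (yes _) = ℚ.≤-refl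
½sign-gap (no  _) (no  _) = 0≤1

-- Half the sign of p - q is an optimal test function: it attains the total variation, and its
-- values ±½ are at most 1 apart.
½sign-witness : ∀ {n} (p q : Fin n → ℚ) → ∃[ g ] ((∀ k l → ∣ g k - g l ∣ ℚ.≤ 1ℚ) ×
  tv p q ≡ sum (λ x → p x * g x) - sum (λ x → q x * g x))
½sign-witness p q = g , (λ k l → ½sign-gap (0ℚ ℚ.≤? (p k - q k)) (0ℚ ℚ.≤? (p l - q l))) , (begin
  ½ * sum (λ x → ∣ p x - q x ∣)
    ≡⟨ sum-*ˡ ½ (λ x → ∣ p x - q x ∣) ⟨
  sum (λ x → ½ * ∣ p x - q x ∣)
    ≡⟨ sum-cong (λ x → trans (½sign-* (0ℚ ℚ.≤? (p x - q x))) (distribute (g x) (p x) (q x))) ⟩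
  sum (λ x → p x * g x - q x * g x)
    ≡⟨ sum-- (λ x → p x * g x) (λ x → q x * g x) ⟩
  sum (λ x → p x * g x) - sum (λ x → q x * g x) ∎)
  where
  open ≡-Reasoning
  g : _ → ℚ
  g x = ½sign (0ℚ ℚ.≤? (p x - q x))
  distribute : ∀ g p q → g * (p - q) ≡ p * g - q * g
  distribute = solve-∀ ℚ-ring

-- The overlap min(p, q) has mass 1 - tv, and a² ≤ 2(f - a)² + 2f².
overlap-bound : ∀ {n} (p q : Fin n → ℚ) → (∀ x → 0ℚ ℚ.≤ p x) → (∀ x → 0ℚ ℚ.≤ q x) →
  sum p ≡ 1ℚ → sum q ≡ 1ℚ → (f : Fin n → ℚ) (a : ℚ) →
  (1ℚ - tv p q) * (a * a) ℚ.≤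
    sum (λ x → p x * (fromℕ 2 * (f x * f x) + (- (fromℕ 4 * a) * f x + fromℕ 2 * (a * a))))
    + sum (λ x → q x * (fromℕ 2 * (f x * f x)))
overlap-bound {n} p q 0≤p 0≤q ∑p≡1 ∑q≡1 f a = begin
  (1ℚ - tv p q) * (a * a)
    ≡⟨ cong (_* (a * a)) mass ⟨
  sum o * (a * a)
    ≡⟨ sum-*ʳ (a * a) o ⟨
  sum (λ x → o x * (a * a))
    ≤⟨ sum-mono-≤ pointwise ⟩
  sum (λ x → p x * h x + q x * (fromℕ 2 * (f x * f x)))
    ≡⟨ ∑-distrib-+ (λ x → p x * h x) (λ x → q x * (fromℕ 2 * (f x * f x))) ⟩
  sum (λ x → p x * h x) + sum (λ x → q x * (fromℕ 2 * (f x * f x))) ∎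
  where
  open ℚ.≤-Reasoning
  o h : Fin n → ℚ
  o x = ½ * (p x + q x) - ½ * ∣ p x - q x ∣
  -- This is 2(f - a)², expanded so that its expectation splits into the moments of `f`.
  h x = fromℕ 2 * (f x * f x) + (- (fromℕ 4 * a) * f x + fromℕ 2 * (a * a))
  mass : sum o ≡ 1ℚ - tv p q
  mass = trans (sum-- (λ x → ½ * (p x + q x)) (λ x → ½ * ∣ p x - q x ∣))
    (cong₂ _-_ (trans (sum-*ˡ ½ (λ x → p x + q x)) (cong (½ *_) (trans (∑-distrib-+ p q) (cong₂ _+_ ∑p≡1 ∑q≡1))))
               (sum-*ˡ ½ (λ x → ∣ p x - q x ∣)))
  0≤½ : 0ℚ ℚ.≤ ½
  0≤½ = ℚ.<⇒≤ (0<1/ 2)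
  0≤d+∣d∣ : ∀ d → 0ℚ ℚ.≤ d + ∣ d ∣
  0≤d+∣d∣ d = subst (0ℚ ℚ.≤_) (commute ∣ d ∣ d)
    (0≤- (ℚ.≤-trans (p≤∣p∣ (- d)) (ℚ.≤-reflexive (ℚ.∣-p∣≡∣p∣ d))))
    where
    commute : ∀ p q → p - - q ≡ q + p
    commute = solve-∀ ℚ-ring
  0≤o : ∀ x → 0ℚ ℚ.≤ o x
  0≤o x = 0≤- (*-monoˡ-≤ ½ 0≤½ (∣p∣≤ {p x - q x} {p x + q x}
    (≤-by (q x + q x) (below (p x) (q x)) (0≤+ (0≤q x) (0≤q x)))
    (≤-by (p x + p x) (above (p x) (q x)) (0≤+ (0≤p x) (0≤p x)))))
    where
    below : ∀ p q → q + q ≡ (p + q) - (p - q)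
    below = solve-∀ ℚ-ring
    above : ∀ p q → p + p ≡ (p + q) - - (p - q)
    above = solve-∀ ℚ-ring
  -- `p` is the overlap plus ((p - q) + δ)/2 and `q` is the overlap plus (δ - (p - q))/2. On the
  -- overlap, 2(f - a)² + 2f² - a² is the square of 2f - a.
  decompose : ∀ p q δ f a →
    (((p - q) + δ) * ½) * (fromℕ 2 * ((f - a) * (f - a))) + ((δ - (p - q)) * ½) * (fromℕ 2 * (f * f))
    + (½ * (p + q) - ½ * δ) * ((f + f - a) * (f + f - a))
    ≡ (p * (fromℕ 2 * (f * f) + (- (fromℕ 4 * a) * f + fromℕ 2 * (a * a))) + q * (fromℕ 2 * (f * f)))
      - (½ * (p + q) - ½ * δ) * (a * a)
  decompose = solve-∀ ℚ-ring
  pointwise : ∀ x → o x * (a * a) ℚ.≤ p x * h x + q x * (fromℕ 2 * (f x * f x))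
  pointwise x = ≤-by
    (((d + ∣ d ∣) * ½) * (fromℕ 2 * ((f x - a) * (f x - a))) + ((∣ d ∣ - d) * ½) * (fromℕ 2 * (f x * f x))
      + o x * ((f x + f x - a) * (f x + f x - a)))
    (decompose (p x) (q x) ∣ d ∣ (f x) a)
    (0≤+ (0≤+ (0≤* (0≤* (0≤d+∣d∣ d) 0≤½) (0≤* (0≤fromℕ 2) (0≤² (f x - a))))
              (0≤* (0≤* (0≤- (p≤∣p∣ d)) 0≤½) (0≤* (0≤fromℕ 2) (0≤² (f x)))))
         (0≤* (0≤o x) (0≤² (f x + f x - a))))
    where
    d = p x - q x

module Powers (b m : ℕ) .{{_ : NonZero b}} where

  open Chain b m

  private
    β β⁻¹ w : ℚ
    β   = fromℕ b
    β⁻¹ = + 1 ℚ./ b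
    w   = 1/^ b n

  P^∙const : ∀ r c i → ((P ^ᴹ r) ∙ λ _ → c) i ≡ c
  P^∙const zero    c i = identity-∙ (λ _ → c) i
  P^∙const (suc r) c i = trans (^ᴹ-suc-∙ P r (λ _ → c) i)
    (trans (∙-cong P (P^∙const r c) i) (P∙const c i))

  P^∙centred : ∀ r i → ((P ^ᴹ r) ∙ centred) i ≡ 1/^ b r * centred i
  P^∙centred zero    i = trans (identity-∙ centred i) (sym (ℚ.*-identityˡ (centred i)))
  P^∙centred (suc r) i = begin
    ((P ^ᴹ suc r) ∙ centred) i                ≡⟨ ^ᴹ-suc-∙ P r centred i ⟩
    (P ∙ ((P ^ᴹ r) ∙ centred)) i              ≡⟨ ∙-cong P (P^∙centred r) i ⟩
    (P ∙ λ j → 1/^ b r * centred j) i         ≡⟨ ∙-*ˡ P (1/^ b r) centred i ⟩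
    1/^ b r * (P ∙ centred) i                 ≡⟨ cong (1/^ b r *_) (P∙centred i) ⟩
    1/^ b r * (β⁻¹ * centred i)               ≡⟨ regroup (1/^ b r) β⁻¹ (centred i) ⟩
    (β⁻¹ * 1/^ b r) * centred i               ≡⟨ cong (_* centred i) (1/^-suc b r) ⟨
    1/^ b (suc r) * centred i                 ∎
    where
    open ≡-Reasoning
    regroup : ∀ p q r → p * (q * r) ≡ (q * p) * r
    regroup = solve-∀ ℚ-ring

  -- The one-step bound is a convex combination of f² and `V` with weights b⁻² and 1 - b⁻². Such
  -- bounds compose, the weights of f² being multiplied.
  P^∙centred² : 2 ≤ b → ∀ r i → let W = 1/^ b r in
    ((P ^ᴹ r) ∙ centred²) i ℚ.≤ (W * W) * centred² i + V * (1ℚ - W * W)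
  P^∙centred² 2≤b zero    i = ℚ.≤-reflexive (trans (identity-∙ centred² i) (algebra (centred² i) V))
    where
    algebra : ∀ f V → f ≡ (1ℚ * 1ℚ) * f + V * (1ℚ - 1ℚ * 1ℚ)
    algebra = solve-∀ ℚ-ring
  P^∙centred² 2≤b (suc r) i = begin
    ((P ^ᴹ suc r) ∙ centred²) i
      ≡⟨ ^ᴹ-suc-∙ P r centred² i ⟩
    (P ∙ ((P ^ᴹ r) ∙ centred²)) i
      ≤⟨ ∙-mono-≤ (P^∙centred² 2≤b r) i ⟩
    (P ∙ λ j → (W * W) * centred² j + V * (1ℚ - W * W)) i
      ≡⟨ ∙-+ P (λ j → (W * W) * centred² j) (λ _ → V * (1ℚ - W * W)) i ⟩
    (P ∙ λ j → (W * W) * centred² j) i + (P ∙ λ _ → V * (1ℚ - W * W)) i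
      ≡⟨ cong₂ _+_ (∙-*ˡ P (W * W) centred² i) (P∙const (V * (1ℚ - W * W)) i) ⟩
    (W * W) * (P ∙ centred²) i + V * (1ℚ - W * W)
      ≤⟨ ℚ.+-monoˡ-≤ (V * (1ℚ - W * W)) (*-monoˡ-≤ (W * W) (0≤² W) (P∙centred² 2≤b i)) ⟩
    (W * W) * ((β⁻¹ * β⁻¹) * centred² i + V * (1ℚ - β⁻¹ * β⁻¹)) + V * (1ℚ - W * W)
      ≡⟨ algebra W β⁻¹ V (centred² i) ⟩
    ((β⁻¹ * W) * (β⁻¹ * W)) * centred² i + V * (1ℚ - (β⁻¹ * W) * (β⁻¹ * W))
      ≡⟨ cong (λ U → (U * U) * centred² i + V * (1ℚ - U * U)) (1/^-suc b r) ⟨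
    (1/^ b (suc r) * 1/^ b (suc r)) * centred² i + V * (1ℚ - 1/^ b (suc r) * 1/^ b (suc r)) ∎
    where
    open ℚ.≤-Reasoning
    W = 1/^ b r
    algebra : ∀ W γ V f → (W * W) * ((γ * γ) * f + V * (1ℚ - γ * γ)) + V * (1ℚ - W * W)
      ≡ ((γ * W) * (γ * W)) * f + V * (1ℚ - (γ * W) * (γ * W))
    algebra = solve-∀ ℚ-ring

  step-mono : ∀ {i j : Fin n} → toℕ i ≤ toℕ j → ∀ x → toℕ (step b i x) ≤ toℕ (step b j x)
  step-mono {i} {j} i≤j x = subst₂ _≤_ (sym (toℕ-step b i x)) (sym (toℕ-step b j x))
    (ℕ./-monoˡ-≤ b (ℕ.+-monoˡ-≤ (digitSum x) i≤j))

  -- Common digits preserve the order of the two states, so the pointwise bound stays a signed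
  -- difference of `centred` and its average is found by `P∙centred`.
  P-Lipschitz : ∀ {L g} → Lipschitz L g → Lipschitz (β⁻¹ * L) (P ∙ g)
  P-Lipschitz {L} {g} lip i j i≤j = ∣p∣≤
    (bound i j λ x → ℚ.≤-trans (p≤∣p∣ _) (gap x))
    (subst (ℚ._≤ β⁻¹ * L * (centred j - centred i)) (flip ((P ∙ g) i) ((P ∙ g) j))
      (bound j i λ x → ℚ.≤-trans (ℚ.≤-reflexive (flip (g (step b i x)) (g (step b j x))))
        (ℚ.≤-trans (p≤∣p∣ _) (ℚ.≤-trans (ℚ.≤-reflexive (ℚ.∣-p∣≡∣p∣ (g (step b i x) - g (step b j x)))) (gap x)))))
    where
    flip : ∀ p q → q - p ≡ - (p - q)
    flip = solve-∀ ℚ-ring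
    gap : ∀ x → ∣ g (step b i x) - g (step b j x) ∣ ℚ.≤ L * (centred (step b j x) - centred (step b i x))
    gap x = lip (step b i x) (step b j x) (step-mono i≤j x)
    ∙-- : ∀ h k l → (P ∙ h) k - (P ∙ h) l ≡ w * ∑ʷ b n (λ x → h (step b k x) - h (step b l x))
    ∙-- h k l = trans (cong₂ _-_ (carriesMatrix-∙ b n h k) (carriesMatrix-∙ b n h l))
      (trans (factor w _ _) (cong (w *_) (sym (∑ʷ-- {b} {n} (λ x → h (step b k x)) (λ x → h (step b l x))))))
      where
      factor : ∀ w p q → w * p - w * q ≡ w * (p - q)
      factor = solve-∀ ℚ-ring
    bound : ∀ k l → (∀ x → g (step b k x) - g (step b l x) ℚ.≤ L * (centred (step b j x) - centred (step b i x))) →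
            (P ∙ g) k - (P ∙ g) l ℚ.≤ β⁻¹ * L * (centred j - centred i)
    bound k l pointwise = begin
      (P ∙ g) k - (P ∙ g) l
        ≡⟨ ∙-- g k l ⟩
      w * ∑ʷ b n (λ x → g (step b k x) - g (step b l x))
        ≤⟨ *-monoˡ-≤ w (0≤1/^ b n) (∑ʷ-mono-≤ {b} {n} pointwise) ⟩
      w * ∑ʷ b n (λ x → L * (centred (step b j x) - centred (step b i x)))
        ≡⟨ cong (w *_) (∑ʷ-*ˡ {b} {n} L (λ x → centred (step b j x) - centred (step b i x))) ⟩
      w * (L * ∑ʷ b n (λ x → centred (step b j x) - centred (step b i x)))
        ≡⟨ swap w L _ ⟩
      L * (w * ∑ʷ b n (λ x → centred (step b j x) - centred (step b i x)))
        ≡⟨ cong (L *_) (∙-- centred j i) ⟨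
      L * ((P ∙ centred) j - (P ∙ centred) i)
        ≡⟨ cong (L *_) (cong₂ _-_ (P∙centred j) (P∙centred i)) ⟩
      L * (β⁻¹ * centred j - β⁻¹ * centred i)
        ≡⟨ factor L β⁻¹ (centred j) (centred i) ⟩
      β⁻¹ * L * (centred j - centred i) ∎
      where
      open ℚ.≤-Reasoning
      swap : ∀ p q r → p * (q * r) ≡ q * (p * r)
      swap = solve-∀ ℚ-ring
      factor : ∀ L γ p q → L * (γ * p - γ * q) ≡ γ * L * (p - q)
      factor = solve-∀ ℚ-ring

  P^-Lipschitz : ∀ r {g} → Lipschitz 1ℚ g → Lipschitz (1/^ b r) ((P ^ᴹ r) ∙ g)
  P^-Lipschitz zero    {g} lip i j i≤j = subst (ℚ._≤ 1ℚ * (centred j - centred i))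
    (cong ∣_∣ (sym (cong₂ _-_ (identity-∙ g i) (identity-∙ g j)))) (lip i j i≤j)
  P^-Lipschitz (suc r) {g} lip i j i≤j = subst₂ ℚ._≤_
    (cong ∣_∣ (sym (cong₂ _-_ (^ᴹ-suc-∙ P r g i) (^ᴹ-suc-∙ P r g j))))
    (cong (_* (centred j - centred i)) (sym (1/^-suc b r)))
    (P-Lipschitz {1/^ b r} {(P ^ᴹ r) ∙ g} (P^-Lipschitz r {g} lip) i j i≤j)

  0≤P^ : ∀ r i j → 0ℚ ℚ.≤ (P ^ᴹ r) i j
  0≤P^ zero    i j with i Fin.≟ j
  ... | yes _ = 0≤1
  ... | no  _ = ℚ.≤-refl
  0≤P^ (suc r) i j = subst (ℚ._≤ (P ^ᴹ suc r) i j) (sum-0 n)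
    (sum-mono-≤ {n} {λ _ → 0ℚ} {λ k → P i k * (P ^ᴹ r) k j} λ k → 0≤* (0≤P i k) (0≤P^ r k j))

  -- Both bounds are derived for an arbitrary invariant probability vector; the Eulerian numbers are
  -- substituted only at the end.
  module Stationary (2≤b : 2 ≤ b) (π : Fin n → ℚ) (0≤π : ∀ j → 0ℚ ℚ.≤ π j)
    (∑π≡1 : sum π ≡ 1ℚ)
    (π∙P≡π : ∀ g → sum (λ j → π j * (P ∙ g) j) ≡ sum (λ j → π j * g j)) where

    E : (Fin n → ℚ) → ℚ
    E g = sum λ j → π j * g j

    E-const : ∀ c → E (λ _ → c) ≡ c
    E-const c = trans (sum-*ʳ c π) (trans (cong (_* c) ∑π≡1) (ℚ.*-identityˡ c))

    E-cong : ∀ {g h} → (∀ j → g j ≡ h j) → E g ≡ E h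
    E-cong g≡h = sum-cong λ j → cong (π j *_) (g≡h j)

    E-mono-≤ : ∀ {g h} → (∀ j → g j ℚ.≤ h j) → E g ℚ.≤ E h
    E-mono-≤ g≤h = sum-mono-≤ λ j → *-monoˡ-≤ (π j) (0≤π j) (g≤h j)

    E-*ˡ : ∀ c g → E (λ j → c * g j) ≡ c * E g
    E-*ˡ c g = trans (sum-cong λ j → swap (π j) c (g j)) (sum-*ˡ c λ j → π j * g j)
      where
      swap : ∀ p q r → p * (q * r) ≡ q * (p * r)
      swap = solve-∀ ℚ-ring

    E-+ : ∀ g h → E (λ j → g j + h j) ≡ E g + E h
    E-+ g h = trans (sum-cong λ j → ℚ.*-distribˡ-+ (π j) (g j) (h j))
      (∑-distrib-+ (λ j → π j * g j) (λ j → π j * h j))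

    E-P^ : ∀ r g → E ((P ^ᴹ r) ∙ g) ≡ E g
    E-P^ zero    g = E-cong (identity-∙ g)
    E-P^ (suc r) g = trans (E-cong (^ᴹ-suc-∙ P r g)) (trans (π∙P≡π ((P ^ᴹ r) ∙ g)) (E-P^ r g))

    private
      0<β-1 : 0ℚ ℚ.< β - 1ℚ
      0<β-1 = ℚ.<-≤-trans (ℚ.positive⁻¹ 1ℚ)
        (≤-by (β - fromℕ 2) (algebra β) (0≤- (fromℕ-mono-≤ 2≤b)))
        where
        algebra : ∀ β → β - fromℕ 2 ≡ (β - 1ℚ) - 1ℚ
        algebra = solve-∀ ℚ-ring

    -- By invariance the mean equals 1/b times itself, and b > 1 forces it to vanish.
    E-centred : E centred ≡ 0ℚ
    E-centred = *-cancelˡ-≡ (β - 1ℚ) 0<β-1 (begin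
      (β - 1ℚ) * E centred                             ≡⟨ expand β (E centred) ⟩
      β * E centred - E centred                        ≡⟨ cong (λ z → β * z - E centred) eigen ⟩
      β * (β⁻¹ * E centred) - E centred                ≡⟨ cong (_- E centred) (ℚ.*-assoc β β⁻¹ (E centred)) ⟨
      β * β⁻¹ * E centred - E centred                  ≡⟨ cong (λ z → z * E centred - E centred) β*β⁻¹≡1 ⟩
      1ℚ * E centred - E centred                       ≡⟨ vanish (E centred) (β - 1ℚ) ⟩
      (β - 1ℚ) * 0ℚ                                    ∎)
      where
      open ≡-Reasoning
      eigen : E centred ≡ β⁻¹ * E centred
      eigen = trans (sym (π∙P≡π centred)) (trans (E-cong P∙centred) (E-*ˡ β⁻¹ centred))
      expand : ∀ β e → (β - 1ℚ) * e ≡ β * e - e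
      expand = solve-∀ ℚ-ring
      vanish : ∀ e c → 1ℚ * e - e ≡ c * 0ℚ
      vanish = solve-∀ ℚ-ring

    -- Invariance turns the one-step bound into e ≤ b⁻² e + V(1 - b⁻²) for the stationary variance
    -- e, and 1 - b⁻² is positive. The factor cancelled is b² - 1, written (b - 1)((b - 1) + 2).
    E-centred² : E centred² ℚ.≤ V
    E-centred² = *-cancelˡ-≤ ((β - 1ℚ) * (β - 1ℚ + fromℕ 2)) 0<β²-1
      (≤-by ((β * β) * (((β⁻¹ * β⁻¹) * E centred² + V * (1ℚ - β⁻¹ * β⁻¹)) - E centred²))
        (trans (expand β β⁻¹ (E centred²) V) (trans (cong (λ z → ((z * z) * E centred² + V * (β * β - z * z)) - (β * β) * E centred²)
          β*β⁻¹≡1) (collect β (E centred²) V)))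
        (0≤* (0≤² β) (0≤- drift)))
      where
      0<β²-1 : 0ℚ ℚ.< (β - 1ℚ) * (β - 1ℚ + fromℕ 2)
      0<β²-1 = ℚ.positive⁻¹ _ {{ℚ.pos*pos⇒pos (β - 1ℚ) {{ℚ.positive 0<β-1}} (β - 1ℚ + fromℕ 2)
        {{ℚ.positive (ℚ.+-mono-< 0<β-1 (0<fromℕ 2))}}}}
      drift : E centred² ℚ.≤ (β⁻¹ * β⁻¹) * E centred² + V * (1ℚ - β⁻¹ * β⁻¹)
      drift = begin
        E centred²
          ≡⟨ π∙P≡π centred² ⟨
        E (P ∙ centred²)
          ≤⟨ E-mono-≤ (P∙centred² 2≤b) ⟩
        E (λ j → (β⁻¹ * β⁻¹) * centred² j + V * (1ℚ - β⁻¹ * β⁻¹))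
          ≡⟨ E-+ (λ j → (β⁻¹ * β⁻¹) * centred² j) (λ _ → V * (1ℚ - β⁻¹ * β⁻¹)) ⟩
        E (λ j → (β⁻¹ * β⁻¹) * centred² j) + E (λ _ → V * (1ℚ - β⁻¹ * β⁻¹))
          ≡⟨ cong₂ _+_ (E-*ˡ (β⁻¹ * β⁻¹) centred²) (E-const (V * (1ℚ - β⁻¹ * β⁻¹))) ⟩
        (β⁻¹ * β⁻¹) * E centred² + V * (1ℚ - β⁻¹ * β⁻¹) ∎
        where open ℚ.≤-Reasoning
      expand : ∀ β γ e V → (β * β) * (((γ * γ) * e + V * (1ℚ - γ * γ)) - e) ≡
        (((β * γ) * (β * γ)) * e + V * (β * β - (β * γ) * (β * γ))) - (β * β) * e
      expand = solve-∀ ℚ-ring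
      collect : ∀ β e V → ((1ℚ * 1ℚ) * e + V * (β * β - 1ℚ * 1ℚ)) - (β * β) * e ≡
        ((β - 1ℚ) * (β - 1ℚ + fromℕ 2)) * V - ((β - 1ℚ) * (β - 1ℚ + fromℕ 2)) * e
      collect = solve-∀ ℚ-ring

    module _ (r : ℕ) (i : Fin n) where

      private
        p : Fin n → ℚ
        p = (P ^ᴹ r) i
        W : ℚ
        W = 1/^ b r

      tv-upper : tv p π ℚ.≤ (midpoint n + fromℕ (toℕ i)) * W
      tv-upper = duality (½sign-witness p π)
        where
        open ℚ.≤-Reasoning
        G : (Fin n → ℚ) → Fin n → ℚ
        G g = (P ^ᴹ r) ∙ g
        factor : ∀ q x y → q * x - q * y ≡ q * (x - y)
        factor = solve-∀ ℚ-ring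
        rearrange : ∀ W x μ → W * (0ℚ + (x + μ)) ≡ (μ + x) * W
        rearrange = solve-∀ ℚ-ring
        duality : ∃[ g ] ((∀ k l → ∣ g k - g l ∣ ℚ.≤ 1ℚ) × tv p π ≡ (sum λ x → p x * g x) - E g) →
                  tv p π ℚ.≤ (midpoint n + fromℕ (toℕ i)) * W
        duality (g , oscillation , tv≡) = begin
          tv p π
            ≡⟨ tv≡ ⟩
          G g i - E g
            -- `G g i` is constant under `π`, and invariance replaces `E g` by `E (G g)`, so both
            -- become averages over the same state `k`.
            ≡⟨ cong₂ _-_ (sym (E-const (G g i))) (sym (E-P^ r g)) ⟩
          E (λ _ → G g i) - E (G g)
            ≡⟨ sum-- (λ k → π k * G g i) (λ k → π k * G g k) ⟨
          sum (λ k → π k * G g i - π k * G g k)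
            ≡⟨ sum-cong (λ k → factor (π k) (G g i) (G g k)) ⟩
          E (λ k → G g i - G g k)
            ≤⟨ E-mono-≤ (Lipschitz⇒≤ {H = G g} (0≤1/^ b r) (P^-Lipschitz r {g} (oscillation≤1⇒Lipschitz {g = g} oscillation)) i) ⟩
          E (λ k → W * (centred k + (fromℕ (toℕ i) + midpoint n)))
            ≡⟨ E-*ˡ W (λ k → centred k + (fromℕ (toℕ i) + midpoint n)) ⟩
          W * E (λ k → centred k + (fromℕ (toℕ i) + midpoint n))
            ≡⟨ cong (W *_) (trans (E-+ centred (λ _ → fromℕ (toℕ i) + midpoint n))
                 (cong₂ _+_ E-centred (E-const (fromℕ (toℕ i) + midpoint n)))) ⟩
          W * (0ℚ + (fromℕ (toℕ i) + midpoint n))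
            ≡⟨ rearrange W (fromℕ (toℕ i)) (midpoint n) ⟩
          (midpoint n + fromℕ (toℕ i)) * W ∎

      -- The inequality of `overlap-bound` times b²ʳ, which clears the b⁻ʳ in the mean `a`. The
      -- factor 4 is 2 + 2: `p` is tested about its mean `a` and `π` about 0, each with second
      -- moment at most `V`.
      tv-lower : (1ℚ - tv p π) * centred² i ℚ.≤ (fromℕ 4 * V) * (fromℕ (b ^ r) * fromℕ (b ^ r))
      tv-lower = begin
        (1ℚ - tv p π) * centred² i
          ≡⟨ cong (λ f → (1ℚ - tv p π) * (f * f)) scaled ⟩
        (1ℚ - tv p π) * (((B * W) * centred i) * ((B * W) * centred i))
          ≡⟨ regroup (1ℚ - tv p π) B W (centred i) ⟩
        (B * B) * ((1ℚ - tv p π) * (a * a))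
          ≤⟨ *-monoˡ-≤ (B * B) (0≤² B) (overlap-bound p π (0≤P^ r i) 0≤π ∑p≡1 ∑π≡1 centred a) ⟩
        (B * B) * (sum (λ x → p x * h x) + sum (λ x → π x * (fromℕ 2 * centred² x)))
          ≡⟨ cong ((B * B) *_) (cong₂ _+_ p-part (E-*ˡ (fromℕ 2) centred²)) ⟩
        (B * B) * (fromℕ 2 * (Q - a * a) + fromℕ 2 * E centred²)
          ≤⟨ *-monoˡ-≤ (B * B) (0≤² B) (ℚ.+-mono-≤
               (*-monoˡ-≤ (fromℕ 2) (0≤fromℕ 2) variance) (*-monoˡ-≤ (fromℕ 2) (0≤fromℕ 2) E-centred²)) ⟩
        (B * B) * (fromℕ 2 * V + fromℕ 2 * V)
          ≡⟨ collect B V ⟩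
        (fromℕ 4 * V) * (B * B) ∎
        where
        open ℚ.≤-Reasoning
        B = fromℕ (b ^ r)
        a = W * centred i
        h : Fin n → ℚ
        h x = fromℕ 2 * centred² x + (- (fromℕ 4 * a) * centred x + fromℕ 2 * (a * a))
        Q = ((P ^ᴹ r) ∙ centred²) i
        ∑p≡1 : sum p ≡ 1ℚ
        ∑p≡1 = trans (sum-cong λ x → sym (ℚ.*-identityʳ (p x))) (P^∙const r 1ℚ i)
        scaled : centred i ≡ (B * W) * centred i
        scaled = trans (sym (ℚ.*-identityˡ (centred i))) (cong (_* centred i) (sym (1/^-inverse b r)))
        regroup : ∀ s B W f → s * (((B * W) * f) * ((B * W) * f)) ≡ (B * B) * (s * ((W * f) * (W * f)))
        regroup = solve-∀ ℚ-ring
        collect : ∀ B V → (B * B) * (fromℕ 2 * V + fromℕ 2 * V) ≡ (fromℕ 4 * V) * (B * B)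
        collect = solve-∀ ℚ-ring
        p-part : sum (λ x → p x * h x) ≡ fromℕ 2 * (Q - a * a)
        p-part = trans (∙-+ (P ^ᴹ r) (λ x → fromℕ 2 * centred² x) (λ x → - (fromℕ 4 * a) * centred x + fromℕ 2 * (a * a)) i)
          (trans (cong₂ _+_ (∙-*ˡ (P ^ᴹ r) (fromℕ 2) centred² i)
            (trans (∙-+ (P ^ᴹ r) (λ x → - (fromℕ 4 * a) * centred x) (λ _ → fromℕ 2 * (a * a)) i)
              (cong₂ _+_ (trans (∙-*ˡ (P ^ᴹ r) (- (fromℕ 4 * a)) centred i) (cong (- (fromℕ 4 * a) *_) (P^∙centred r i)))
                         (P^∙const r (fromℕ 2 * (a * a)) i))))
            (algebra Q a))
          where
          algebra : ∀ Q a → fromℕ 2 * Q + (- (fromℕ 4 * a) * a + fromℕ 2 * (a * a)) ≡ fromℕ 2 * (Q - a * a)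
          algebra = solve-∀ ℚ-ring
        0≤V : 0ℚ ℚ.≤ V
        0≤V = 0≤* (ℚ.<⇒≤ (0<1/ 12)) (0≤+ (0≤fromℕ m) (0≤fromℕ 4))
        variance : Q - a * a ℚ.≤ V
        variance = ≤-by ((((W * W) * centred² i + V * (1ℚ - W * W)) - Q) + V * (W * W))
          (algebra W (centred i) V Q)
          (0≤+ (0≤- (P^∙centred² 2≤b r i)) (0≤* 0≤V (0≤² W)))
          where
          algebra : ∀ W f V Q → (((W * W) * (f * f) + V * (1ℚ - W * W)) - Q) + V * (W * W) ≡
            V - (Q - (W * f) * (W * f))
          algebra = solve-∀ ℚ-ring

-- Sequences, prefix sums and blocks

Seq : Set
Seq = ℕ → ℚ

δ : ℕ → Seq
δ z m = ⟦ z ℕ.≡ᵇ m ⟧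

δ-≢ : ∀ {z m} → z ≢ m → δ z m ≡ 0ℚ
δ-≢ {zero}  {zero}  z≢m = contradiction refl z≢m
δ-≢ {zero}  {suc m} z≢m = refl
δ-≢ {suc z} {zero}  z≢m = refl
δ-≢ {suc z} {suc m} z≢m = δ-≢ (z≢m ∘ cong suc)

δ-+ : ∀ k z m → δ (k ℕ.+ z) (k ℕ.+ m) ≡ δ z m
δ-+ zero    z m = refl
δ-+ (suc k) z m = δ-+ k z m

sum-δ : ∀ {n z} → z ℕ.< n → (g : Seq) → sum {n} (λ j → δ z (toℕ j) * g (toℕ j)) ≡ g z
sum-δ {n} {z} z<n g = subst (λ y → sum {n} (λ j → δ y (toℕ j) * g (toℕ j)) ≡ g y)
  (Fin.toℕ-fromℕ< z<n) (sum-pick (fromℕ< z<n) (g ∘ toℕ))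

-- Linearity reduced to finite sums, the empty one included. Equality of sequences is pointwise, so
-- respecting it has to be part of the record.
record Additive (T : Seq → Seq) : Set where
  field
    respects : ∀ {f g} → f ≗ g → T f ≗ T g
    sums : ∀ {k} (f : Fin k → Seq) → T (λ m → sum (λ i → f i m)) ≗ λ m → sum (λ i → T (f i) m)

  ∑ʷ-sums : ∀ {k n} (f : Vec (Fin k) n → Seq) → T (λ m → ∑ʷ k n (λ x → f x m)) ≗ λ m → ∑ʷ k n (λ x → T (f x) m)
  ∑ʷ-sums {k} {zero}  f m = refl
  ∑ʷ-sums {k} {suc n} f m = trans (sums {k} (λ s m → ∑ʷ k n (λ x → f (s ∷ x) m)) m)
    (sum-cong {k} λ s → ∑ʷ-sums (λ x → f (s ∷ x)) m)

open Additive

id-additive : Additive id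
id-additive .respects f≗g = f≗g
id-additive .sums f m = refl

∘-additive : ∀ {T T′} → Additive T → Additive T′ → Additive (T ∘ T′)
∘-additive a a′ .respects f≗g = respects a (respects a′ f≗g)
∘-additive {T′ = T′} a a′ .sums f m = trans (respects a (sums a′ f) m) (sums a (λ i → T′ (f i)) m)

-- In generating functions `shift` is multiplication by x, `S` is division by 1 - x, and `U b` is
-- multiplication by 1 + x + ... + x^(b-1).
shift : Seq → Seq
shift f zero    = 0ℚ
shift f (suc m) = f m

shift-additive : Additive shift
shift-additive .respects f≗g zero    = refl
shift-additive .respects f≗g (suc m) = f≗g m
shift-additive .sums {k} f zero    = sym (sum-0 k)
shift-additive .sums f (suc m) = refl

shift^ : ℕ → Seq → Seq
shift^ zero    f = f
shift^ (suc s) f = shift (shift^ s f)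

shift^-additive : ∀ s → Additive (shift^ s)
shift^-additive zero    = id-additive
shift^-additive (suc s) = ∘-additive shift-additive (shift^-additive s)

shift^-δ : ∀ s z → δ (s ℕ.+ z) ≗ shift^ s (δ z)
shift^-δ zero    z m       = refl
shift^-δ (suc s) z zero    = refl
shift^-δ (suc s) z (suc m) = shift^-δ s z m

shift^-+ : ∀ b f m → shift^ b f (b ℕ.+ m) ≡ f m
shift^-+ zero    f m = refl
shift^-+ (suc b) f m = shift^-+ b f m

shift^-< : ∀ {b m} f → m ℕ.< b → shift^ b f m ≡ 0ℚ
shift^-< {suc b} {zero}  f m<b = refl
shift^-< {suc b} {suc m} f m<b = shift^-< f (ℕ.s<s⁻¹ m<b)

S : Seq → Seq
S f zero    = f zero
S f (suc m) = S f m + f (suc m)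

S-additive : Additive S
S-additive .respects f≗g zero    = f≗g zero
S-additive .respects f≗g (suc m) = cong₂ _+_ (S-additive .respects f≗g m) (f≗g (suc m))
S-additive .sums f zero    = refl
S-additive .sums f (suc m) = trans (cong (ℚ._+ sum (λ i → f i (suc m))) (S-additive .sums f m))
  (sym (∑-distrib-+ (λ i → S (f i) m) (λ i → f i (suc m))))

S-*ˡ : ∀ c f → S (λ m → c * f m) ≗ λ m → c * S f m
S-*ˡ c f zero    = refl
S-*ˡ c f (suc m) = trans (cong (ℚ._+ c * f (suc m)) (S-*ˡ c f m)) (sym (ℚ.*-distribˡ-+ c (S f m) (f (suc m))))

S-differences : ∀ {f h} → f 0 ≡ h 0 → (∀ m → f (suc m) ≡ h (suc m) - h m) → S f ≗ h
S-differences f₀ f₊ zero    = f₀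
S-differences {f} {h} f₀ f₊ (suc m) = trans (cong₂ _+_ (S-differences {f} {h} f₀ f₊ m) (f₊ m)) (cancel (h m) (h (suc m)))
  where
  cancel : ∀ p q → p + (q - p) ≡ q
  cancel = solve-∀ ℚ-ring

S-injective : ∀ {f g} → S f ≗ S g → f ≗ g
S-injective Sf≗Sg zero    = Sf≗Sg zero
S-injective {f} {g} Sf≗Sg (suc m) = begin
  f (suc m)                       ≡⟨ cancel (S f m) (f (suc m)) ⟩
  S f (suc m) - S f m             ≡⟨ cong₂ _-_ (Sf≗Sg (suc m)) (Sf≗Sg m) ⟩
  S g (suc m) - S g m             ≡⟨ cancel (S g m) (g (suc m)) ⟨
  g (suc m)                       ∎
  where
  open ≡-Reasoning
  cancel : ∀ p q → q ≡ (p + q) - p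
  cancel = solve-∀ ℚ-ring

S-shift : ∀ f → S (shift f) ≗ shift (S f)
S-shift f zero          = refl
S-shift f (suc zero)    = ℚ.+-identityˡ (f 0)
S-shift f (suc (suc m)) = cong (ℚ._+ f (suc m)) (S-shift f (suc m))

S-shift^ : ∀ s f → S (shift^ s f) ≗ shift^ s (S f)
S-shift^ zero    f m = refl
S-shift^ (suc s) f m = trans (S-shift (shift^ s f) m) (respects shift-additive (S-shift^ s f) m)

infixr 9 _^ˢ_
_^ˢ_ : (Seq → Seq) → ℕ → Seq → Seq
(T ^ˢ zero)  f = f
(T ^ˢ suc n) f = (T ^ˢ n) (T f)

^ˢ-additive : ∀ {T} → Additive T → ∀ n → Additive (T ^ˢ n)
^ˢ-additive a zero    = id-additive
^ˢ-additive a (suc n) = ∘-additive (^ˢ-additive a n) a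

^ˢ-comm : ∀ {T T′} → Additive T → (∀ f → T′ (T f) ≗ T (T′ f)) → Additive T′ →
          ∀ n f → T′ ((T ^ˢ n) f) ≗ (T ^ˢ n) (T′ f)
^ˢ-comm a comm a′ zero    f m = refl
^ˢ-comm {T} a comm a′ (suc n) f m = trans (^ˢ-comm a comm a′ n (T f) m) (respects (^ˢ-additive a n) (comm f) m)

S^-injective : ∀ n {f g} → (S ^ˢ n) f ≗ (S ^ˢ n) g → f ≗ g
S^-injective zero    eq = eq
S^-injective (suc n) eq = S-injective (S^-injective n eq)

S^-*ˡ : ∀ n c f → (S ^ˢ n) (λ m → c * f m) ≗ λ m → c * (S ^ˢ n) f m
S^-*ˡ zero    c f m = refl
S^-*ˡ (suc n) c f m = trans (respects (^ˢ-additive S-additive n) (S-*ˡ c f) m) (S^-*ˡ n c (S f) m)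

U : ℕ → Seq → Seq
U b f m = sum {b} λ s → shift^ (toℕ s) f m

U-additive : ∀ b → Additive (U b)
U-additive b .respects f≗g m = sum-cong {b} λ s → respects (shift^-additive (toℕ s)) f≗g m
U-additive b .sums {k} f m = trans (sum-cong {b} λ s → sums (shift^-additive (toℕ s)) f m)
  (∑-comm {b} {k} λ s i → shift^ (toℕ s) (f i) m)

S-U : ∀ b f → S (U b f) ≗ U b (S f)
S-U b f m = trans (sums S-additive {b} (λ s → shift^ (toℕ s) f) m) (sum-cong {b} λ s → S-shift^ (toℕ s) f m)

-- A window sum is the difference of two prefix sums at distance `b`. The shifted prefix sum is 0
-- below `b`, which covers the windows truncated at 0.
U+shift^S≡S : ∀ b f m → U b f m + shift^ b (S f) m ≡ S f m
U+shift^S≡S zero    f m       = ℚ.+-identityˡ (S f m)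
U+shift^S≡S (suc b) f zero    = trans (cong (λ z → (f 0 + z) + 0ℚ) (sum-0 b)) (drop (f 0))
  where
  drop : ∀ p → (p + 0ℚ) + 0ℚ ≡ p
  drop = solve-∀ ℚ-ring
U+shift^S≡S (suc b) f (suc m) = trans (ℚ.+-assoc (f (suc m)) _ _)
  (trans (cong (f (suc m) ℚ.+_) (U+shift^S≡S b f m)) (ℚ.+-comm (f (suc m)) (S f m)))

-- Push-forward under division by `b`: if `f` counts values, `block b f j` counts those with
-- quotient `j`.
block : ℕ → Seq → Seq
block b f j = sum {b} λ t → f (j ℕ.* b ℕ.+ toℕ t)

block-additive : ∀ b → Additive (block b)
block-additive b .respects f≗g j = sum-cong {b} λ t → f≗g (j ℕ.* b ℕ.+ toℕ t)
block-additive b .sums {k} f j = ∑-comm {b} {k} λ t i → f i (j ℕ.* b ℕ.+ toℕ t)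

-- For each residue `t` the windows ending at t, b + t, ..., jb + t tile the integers from 0 to jb +
-- t; the induction on `j` adds one window per residue.
S-block-U : ∀ b f → S (block b (U b f)) ≗ block b (S f)
S-block-U b f zero    = sum-cong {b} λ t → trans (sym (ℚ.+-identityʳ (U b f (toℕ t))))
  (trans (cong (U b f (toℕ t) ℚ.+_) (sym (shift^-< (S f) (Fin.toℕ<n t)))) (U+shift^S≡S b f (toℕ t)))
S-block-U b f (suc j) = begin
  S (block b (U b f)) j + block b (U b f) (suc j)
    ≡⟨ cong (ℚ._+ block b (U b f) (suc j)) (S-block-U b f j) ⟩
  block b (S f) j + block b (U b f) (suc j)
    ≡⟨ ∑-distrib-+ {b} (λ t → S f (at j t)) (λ t → U b f (at (suc j) t)) ⟨
  sum {b} (λ t → S f (at j t) + U b f (at (suc j) t))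
    ≡⟨ sum-cong {b} window ⟩
  block b (S f) (suc j) ∎
  where
  open ≡-Reasoning
  at : ℕ → Fin b → ℕ
  at j t = j ℕ.* b ℕ.+ toℕ t
  window : ∀ t → S f (at j t) + U b f (at (suc j) t) ≡ S f (at (suc j) t)
  window t = begin
    S f (at j t) + U b f (at (suc j) t)
      ≡⟨ ℚ.+-comm (S f (at j t)) (U b f (at (suc j) t)) ⟩
    U b f (at (suc j) t) + S f (at j t)
      ≡⟨ cong (U b f (at (suc j) t) ℚ.+_) (shift^-+ b (S f) (at j t)) ⟨
    U b f (at (suc j) t) + shift^ b (S f) (b ℕ.+ at j t)
      ≡⟨ cong (λ z → U b f (at (suc j) t) + shift^ b (S f) z) (ℕ.+-assoc b (j ℕ.* b) (toℕ t)) ⟨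
    U b f (at (suc j) t) + shift^ b (S f) (at (suc j) t)
      ≡⟨ U+shift^S≡S b f (at (suc j) t) ⟩
    S f (at (suc j) t) ∎

S^-block-U^ : ∀ b n f → (S ^ˢ n) (block b ((U b ^ˢ n) f)) ≗ block b ((S ^ˢ n) f)
S^-block-U^ b zero    f m = refl
S^-block-U^ b (suc n) f m = begin
  (S ^ˢ n) (S (block b ((U b ^ˢ n) (U b f)))) m
    ≡⟨ respects (^ˢ-additive S-additive n) (respects S-additive (respects (block-additive b)
         λ m → sym (^ˢ-comm (U-additive b) (λ _ _ → refl) (U-additive b) n f m))) m ⟩
  (S ^ˢ n) (S (block b (U b ((U b ^ˢ n) f)))) m
    ≡⟨ respects (^ˢ-additive S-additive n) (S-block-U b ((U b ^ˢ n) f)) m ⟩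
  (S ^ˢ n) (block b (S ((U b ^ˢ n) f))) m
    ≡⟨ respects (^ˢ-additive S-additive n) (respects (block-additive b)
         (^ˢ-comm (U-additive b) (S-U b) S-additive n f)) m ⟩
  (S ^ˢ n) (block b ((U b ^ˢ n) (S f))) m
    ≡⟨ S^-block-U^ b n (S f) m ⟩
  block b ((S ^ˢ n) (S f)) m ∎
  where open ≡-Reasoning

-- A uniform digit spreads a point mass over `b` consecutive integers, which is one application of
-- `U b`; `l` digits iterate it.
∑ʷ-δ : ∀ b l d m → ∑ʷ b l (λ x → δ (d ℕ.+ digitSum x) m) ≡ (U b ^ˢ l) (δ d) m
∑ʷ-δ b zero    d m = cong (λ z → δ z m) (ℕ.+-identityʳ d)
∑ʷ-δ b (suc l) d m = begin
  sum {b} (λ s → ∑ʷ b l (λ x → δ (d ℕ.+ (toℕ s ℕ.+ digitSum x)) m))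
    ≡⟨ sum-cong {b} (λ s → ∑ʷ-cong {b} {l} λ x → trans
         (cong (λ z → δ z m) (swap (toℕ s) (digitSum x))) (shift^-δ (toℕ s) (d ℕ.+ digitSum x) m)) ⟩
  sum {b} (λ s → ∑ʷ b l (λ x → shift^ (toℕ s) (δ (d ℕ.+ digitSum x)) m))
    ≡⟨ sum-cong {b} (λ s → ∑ʷ-sums (shift^-additive (toℕ s)) {b} {l} (λ x → δ (d ℕ.+ digitSum x)) m) ⟨
  U b (λ m → ∑ʷ b l (λ x → δ (d ℕ.+ digitSum x) m)) m
    ≡⟨ respects (U-additive b) (∑ʷ-δ b l d) m ⟩
  U b ((U b ^ˢ l) (δ d)) m
    ≡⟨ ^ˢ-comm (U-additive b) (λ _ _ → refl) (U-additive b) l (δ d) m ⟩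
  (U b ^ˢ suc l) (δ d) m ∎
  where
  open ≡-Reasoning
  swap : ∀ s e → d ℕ.+ (s ℕ.+ e) ≡ s ℕ.+ (d ℕ.+ e)
  swap s e = trans (sym (ℕ.+-assoc d s e)) (trans (cong (ℕ._+ e) (ℕ.+-comm d s)) (ℕ.+-assoc s d e))

block-δ-*+ : ∀ b q {r} → r ℕ.< b → block b (δ (q ℕ.* b ℕ.+ r)) ≗ δ q
block-δ-*+ b zero    r<b zero    = trans (sum-cong {b} λ t → sym (ℚ.*-identityʳ _)) (sum-δ r<b (λ _ → 1ℚ))
block-δ-*+ b zero    {r} r<b (suc j) = trans (sum-cong {b} λ t → δ-≢ (ℕ.<⇒≢ (ℕ.<-≤-trans r<b
  (ℕ.≤-trans (ℕ.m≤m+n b (j ℕ.* b)) (ℕ.m≤m+n (b ℕ.+ j ℕ.* b) (toℕ t)))))) (sum-0 b)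
block-δ-*+ b (suc q) {r} r<b zero    = trans (sum-cong {b} λ t → δ-≢ (ℕ.<⇒≢ (ℕ.<-≤-trans (Fin.toℕ<n t)
  (ℕ.≤-trans (ℕ.m≤m+n b (q ℕ.* b)) (ℕ.m≤m+n (b ℕ.+ q ℕ.* b) r))) ∘ sym)) (sum-0 b)
block-δ-*+ b (suc q) {r} r<b (suc j) = trans (sum-cong {b} λ t → trans
    (cong₂ δ (ℕ.+-assoc b (q ℕ.* b) r) (ℕ.+-assoc b (j ℕ.* b) (toℕ t)))
    (δ-+ b (q ℕ.* b ℕ.+ r) (j ℕ.* b ℕ.+ toℕ t)))
  (block-δ-*+ b q r<b j)

block-δ : ∀ b .{{_ : NonZero b}} z → block b (δ z) ≗ δ (z div b)
block-δ b z j = trans (cong (λ y → block b (δ y) j)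
    (trans (ℕ.m≡m%n+[m/n]*n z b) (ℕ.+-comm (z ℕ.% b) (z div b ℕ.* b))))
  (block-δ-*+ b (z div b) (ℕ.m%n<n z b) j)

^-distribʳ-* : ∀ j k n → (j ℕ.* k) ^ n ≡ j ^ n ℕ.* k ^ n
^-distribʳ-* j k zero    = refl
^-distribʳ-* j k (suc n) = trans (cong (j ℕ.* k ℕ.*_) (^-distribʳ-* j k n))
  (ℕ.[m*n]*[o*p]≡[m*o]*[n*p] j k (j ^ n) (k ^ n))

powerGap : ℕ → Seq
powerGap n m = fromℕ (suc m ^ n) - fromℕ (m ^ n)

block-powerGap : ∀ b n → block b (powerGap n) ≗ λ j → fromℕ (b ^ n) * powerGap n j
block-powerGap b n j = begin
  sum {b} (λ t → F (suc (j ℕ.* b ℕ.+ toℕ t)) - F (j ℕ.* b ℕ.+ toℕ t))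
    ≡⟨ sum-- {b} (λ t → F (suc (j ℕ.* b ℕ.+ toℕ t))) (λ t → F (j ℕ.* b ℕ.+ toℕ t)) ⟩
  sum {b} (λ t → F (suc (j ℕ.* b ℕ.+ toℕ t))) - Σh
    ≡⟨ cong (_- Σh) (sum-cong {b} λ t → cong F (sym (ℕ.+-suc (j ℕ.* b) (toℕ t)))) ⟩
  Σh⁺ - Σh
    ≡⟨ insert Σh⁺ Σh (h 0) ⟩
  ((Σh⁺ + h 0) - h 0) - Σh
    ≡⟨ cong (λ z → (z - h 0) - Σh) (sum-shift b h) ⟩
  ((Σh + h b) - h 0) - Σh
    ≡⟨ cancel Σh (h b) (h 0) ⟩
  h b - h 0
    ≡⟨ cong₂ _-_ (trans (cong F (ℕ.+-comm (j ℕ.* b) b)) (power (suc j)))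
                 (trans (cong F (ℕ.+-identityʳ (j ℕ.* b))) (power j)) ⟩
  fromℕ (b ^ n) * F (suc j) - fromℕ (b ^ n) * F j
    ≡⟨ factor (fromℕ (b ^ n)) (F (suc j)) (F j) ⟩
  fromℕ (b ^ n) * powerGap n j ∎
  where
  open ≡-Reasoning
  F h : Seq
  F m = fromℕ (m ^ n)
  h t = F (j ℕ.* b ℕ.+ t)
  Σh  = sum {b} (λ t → h (toℕ t))
  Σh⁺ = sum {b} (λ t → h (suc (toℕ t)))
  power : ∀ j → F (j ℕ.* b) ≡ fromℕ (b ^ n) * F j
  power j = trans (cong fromℕ (^-distribʳ-* j b n)) (trans (fromℕ-* (j ^ n) (b ^ n)) (ℚ.*-comm (F j) (fromℕ (b ^ n))))
  insert : ∀ p q r → p - q ≡ ((p + r) - r) - q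
  insert = solve-∀ ℚ-ring
  cancel : ∀ p q r → ((p + q) - r) - p ≡ q - r
  cancel = solve-∀ ℚ-ring
  factor : ∀ c p q → c * p - c * q ≡ c * (p - q)
  factor = solve-∀ ℚ-ring

-- Eulerian numbers

-- Sum over permutations in one-line notation: the first letter `k` is free, and `punchIn k`
-- relabels a permutation of `n` letters by the letters other than `k`.
∑ᵖ : ∀ n → (Vec (Fin n) n → ℚ) → ℚ
∑ᵖ zero    G = G []
∑ᵖ (suc n) G = sum λ k → ∑ᵖ n λ w → G (k ∷ Vec.map (punchIn k) w)

∑ᵖ-cong : ∀ n {G H : Vec (Fin n) n → ℚ} → (∀ w → G w ≡ H w) → ∑ᵖ n G ≡ ∑ᵖ n H
∑ᵖ-cong zero    G≡H = G≡H []
∑ᵖ-cong (suc n) G≡H = sum-cong {suc n} λ k → ∑ᵖ-cong n λ w → G≡H (k ∷ Vec.map (punchIn k) w)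

∑ᵖ-*ʳ : ∀ n c G → ∑ᵖ n (λ w → G w * c) ≡ ∑ᵖ n G * c
∑ᵖ-*ʳ zero    c G = refl
∑ᵖ-*ʳ (suc n) c G = trans (sum-cong {suc n} λ k → ∑ᵖ-*ʳ n c (λ w → G (k ∷ Vec.map (punchIn k) w)))
  (sum-*ʳ {suc n} c λ k → ∑ᵖ n λ w → G (k ∷ Vec.map (punchIn k) w))

∑ᵖ-sum : ∀ n {k} (f : Vec (Fin n) n → Fin k → ℚ) →
         ∑ᵖ n (λ w → sum (f w)) ≡ sum (λ j → ∑ᵖ n (λ w → f w j))
∑ᵖ-sum zero        f = refl
∑ᵖ-sum (suc n) {k} f = trans (sum-cong {suc n} λ l → ∑ᵖ-sum n (λ w → f (l ∷ Vec.map (punchIn l) w)))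
  (∑-comm {suc n} {k} λ l j → ∑ᵖ n λ w → f (l ∷ Vec.map (punchIn l) w) j)

∑ᵖ-1 : ∀ n → ∑ᵖ n (λ _ → 1ℚ) ≡ fromℕ (n !)
∑ᵖ-1 zero    = refl
∑ᵖ-1 (suc n) = begin
  sum {suc n} (λ k → ∑ᵖ n (λ _ → 1ℚ))   ≡⟨ sum-cong {suc n} (λ k → ∑ᵖ-1 n) ⟩
  sum {suc n} (λ k → fromℕ (n !))       ≡⟨ sum-const (suc n) (fromℕ (n !)) ⟩
  fromℕ (suc n) * fromℕ (n !)           ≡⟨ fromℕ-* (suc n) (n !) ⟨
  fromℕ (suc n !)                       ∎
  where open ≡-Reasoning

∑ᵖ-sums : ∀ {T} → Additive T → ∀ n (f : Vec (Fin n) n → Seq) →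
          T (λ m → ∑ᵖ n (λ w → f w m)) ≗ λ m → ∑ᵖ n (λ w → T (f w) m)
∑ᵖ-sums a zero    f m = refl
∑ᵖ-sums a (suc n) f m = trans (sums a {suc n} (λ k m → ∑ᵖ n (λ w → f (k ∷ Vec.map (punchIn k) w) m)) m)
  (sum-cong {suc n} λ k → ∑ᵖ-sums a n (λ w → f (k ∷ Vec.map (punchIn k) w)) m)

sum-punchIn : ∀ {n} (k : Fin (suc n)) (K : Fin (suc n) → ℚ) →
              sum (λ s → ⟦ not (does (k Fin.≟ s)) ⟧ * K s) ≡ sum (K ∘ punchIn k)
sum-punchIn {n} k K = begin
  sum t                             ≡⟨ sum-remove {i = k} t ⟩
  t k + sum (t ∘ punchIn k)         ≡⟨ cong₂ _+_ diagonal (sum-cong off-diagonal) ⟩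
  0ℚ + sum (K ∘ punchIn k)          ≡⟨ ℚ.+-identityˡ _ ⟩
  sum (K ∘ punchIn k)               ∎
  where
  open ≡-Reasoning
  t : Fin (suc n) → ℚ
  t s = ⟦ not (does (k Fin.≟ s)) ⟧ * K s
  diagonal : t k ≡ 0ℚ
  diagonal = trans (cong (λ d → ⟦ not d ⟧ * K k) (dec-true (k Fin.≟ k) refl)) (ℚ.*-zeroˡ (K k))
  off-diagonal : ∀ s → t (punchIn k s) ≡ K (punchIn k s)
  off-diagonal s = trans
    (cong (λ d → ⟦ not d ⟧ * K (punchIn k s)) (dec-false (k Fin.≟ punchIn k s) (Fin.punchInᵢ≢i k s ∘ sym)))
    (ℚ.*-identityˡ (K (punchIn k s)))

avoids? : ∀ {m l} (k : Fin m) (w : Vec (Fin m) l) → Dec (All (λ y → ¬ k ≡ y) w)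
avoids? k = All.all? (λ y → ¬? (k Fin.≟ y))

distinct? : ∀ {m l} (w : Vec (Fin m) l) → Dec (AllPairs (λ x y → ¬ x ≡ y) w)
distinct? = allPairs? (λ x y → ¬? (x Fin.≟ y))

-- `punchIn k` enumerates the letters other than `k`, so the words avoiding `k` are the relabelled
-- words over the smaller alphabet.
∑ʷ-avoids : ∀ {m} l (k : Fin (suc m)) (H : Vec (Fin (suc m)) l → ℚ) →
  ∑ʷ (suc m) l (λ w → ⟦ does (avoids? k w) ⟧ * H w) ≡ ∑ʷ m l (λ w → H (Vec.map (punchIn k) w))
∑ʷ-avoids zero    k H = ℚ.*-identityˡ (H [])
∑ʷ-avoids {m} (suc l) k H = begin
  sum {suc m} (λ s → ∑ʷ (suc m) l (λ w → ⟦ not (does (k Fin.≟ s)) ∧ does (avoids? k w) ⟧ * H (s ∷ w)))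
    ≡⟨ sum-cong {suc m} (λ s → trans (∑ʷ-cong {suc m} {l} λ w → trans
         (cong (_* H (s ∷ w)) (⟦∧⟧ (not (does (k Fin.≟ s))) (does (avoids? k w))))
         (ℚ.*-assoc ⟦ not (does (k Fin.≟ s)) ⟧ _ (H (s ∷ w))))
         (trans (∑ʷ-*ˡ {suc m} {l} ⟦ not (does (k Fin.≟ s)) ⟧ (λ w → ⟦ does (avoids? k w) ⟧ * H (s ∷ w)))
           (cong (⟦ not (does (k Fin.≟ s)) ⟧ *_) (∑ʷ-avoids l k λ w → H (s ∷ w))))) ⟩
  sum {suc m} (λ s → ⟦ not (does (k Fin.≟ s)) ⟧ * ∑ʷ m l (λ w → H (s ∷ Vec.map (punchIn k) w)))
    ≡⟨ sum-punchIn k (λ s → ∑ʷ m l (λ w → H (s ∷ Vec.map (punchIn k) w))) ⟩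
  sum {m} (λ s → ∑ʷ m l (λ w → H (punchIn k s ∷ Vec.map (punchIn k) w))) ∎
  where open ≡-Reasoning

does-punchIn-≟ : ∀ {m} (k : Fin (suc m)) (x y : Fin m) →
                 does (punchIn k x Fin.≟ punchIn k y) ≡ does (x Fin.≟ y)
does-punchIn-≟ k x y with x Fin.≟ y
... | yes refl = dec-true (punchIn k x Fin.≟ punchIn k x) refl
... | no  x≢y  = dec-false (punchIn k x Fin.≟ punchIn k y) (x≢y ∘ Fin.punchIn-injective k x y)

does-avoids-map : ∀ {m l} (k : Fin (suc m)) (x : Fin m) (w : Vec (Fin m) l) →
                  does (avoids? (punchIn k x) (Vec.map (punchIn k) w)) ≡ does (avoids? x w)
does-avoids-map k x []      = refl
does-avoids-map k x (y ∷ w) = cong₂ (λ c d → not c ∧ d) (does-punchIn-≟ k x y) (does-avoids-map k x w)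

does-distinct-map : ∀ {m l} (k : Fin (suc m)) (w : Vec (Fin m) l) →
                    does (distinct? (Vec.map (punchIn k) w)) ≡ does (distinct? w)
does-distinct-map k []      = refl
does-distinct-map k (x ∷ w) = cong₂ _∧_ (does-avoids-map k x w) (does-distinct-map k w)

∑ʷ-distinct : ∀ n (G : Vec (Fin n) n → ℚ) → ∑ʷ n n (λ w → ⟦ does (distinct? w) ⟧ * G w) ≡ ∑ᵖ n G
∑ʷ-distinct zero    G = ℚ.*-identityˡ (G [])
∑ʷ-distinct (suc n) G = sum-cong {suc n} λ k → begin
  ∑ʷ (suc n) n (λ w → ⟦ does (avoids? k w) ∧ does (distinct? w) ⟧ * G (k ∷ w))
    ≡⟨ ∑ʷ-cong {suc n} {n} (λ w → trans
         (cong (_* G (k ∷ w)) (⟦∧⟧ (does (avoids? k w)) (does (distinct? w))))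
         (ℚ.*-assoc ⟦ does (avoids? k w) ⟧ ⟦ does (distinct? w) ⟧ (G (k ∷ w)))) ⟩
  ∑ʷ (suc n) n (λ w → ⟦ does (avoids? k w) ⟧ * (⟦ does (distinct? w) ⟧ * G (k ∷ w)))
    ≡⟨ ∑ʷ-avoids n k (λ w → ⟦ does (distinct? w) ⟧ * G (k ∷ w)) ⟩
  ∑ʷ n n (λ w → ⟦ does (distinct? (Vec.map (punchIn k) w)) ⟧ * G (k ∷ Vec.map (punchIn k) w))
    ≡⟨ ∑ʷ-cong {n} {n} (λ w → cong (λ d → ⟦ d ⟧ * G (k ∷ Vec.map (punchIn k) w)) (does-distinct-map k w)) ⟩
  ∑ʷ n n (λ w → ⟦ does (distinct? w) ⟧ * G (k ∷ Vec.map (punchIn k) w))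
    ≡⟨ ∑ʷ-distinct n (λ w → G (k ∷ Vec.map (punchIn k) w)) ⟩
  ∑ᵖ n (λ w → G (k ∷ Vec.map (punchIn k) w)) ∎
  where open ≡-Reasoning

descentSeq : ℕ → Seq
descentSeq n m = ∑ᵖ n λ w → δ (descents w) m

eulerian-descentSeq : ∀ n j → fromℕ (eulerian n j) ≡ descentSeq n j
eulerian-descentSeq n j = begin
  fromℕ (eulerian n j)
    ≡⟨ count-words n n (λ w → distinct? w ×-dec (descents w ℕ.≟ j)) ⟩
  ∑ʷ n n (λ w → ⟦ does (distinct? w) ∧ (descents w ℕ.≡ᵇ j) ⟧)
    ≡⟨ ∑ʷ-cong {n} {n} (λ w → ⟦∧⟧ (does (distinct? w)) (descents w ℕ.≡ᵇ j)) ⟩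
  ∑ʷ n n (λ w → ⟦ does (distinct? w) ⟧ * δ (descents w) j)
    ≡⟨ ∑ʷ-distinct n (λ w → δ (descents w) j) ⟩
  descentSeq n j ∎
  where open ≡-Reasoning

punchIn-<ᵇ : ∀ {m} (k : Fin (suc m)) (x y : Fin m) →
             (toℕ (punchIn k x) ℕ.<ᵇ toℕ (punchIn k y)) ≡ (toℕ x ℕ.<ᵇ toℕ y)
punchIn-<ᵇ zero    x       y       = refl
punchIn-<ᵇ (suc k) zero    zero    = refl
punchIn-<ᵇ (suc k) zero    (suc y) = refl
punchIn-<ᵇ (suc k) (suc x) zero    = refl
punchIn-<ᵇ (suc k) (suc x) (suc y) = punchIn-<ᵇ k x y

-- Letters below the removed `k` keep their value and the others move above it. Hence passing from
-- `k` to the relabelled letter `l` is a descent exactly when l < k.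
punchIn-<ᵇ-pivot : ∀ {m} (k : Fin (suc m)) (x : Fin m) →
                   (toℕ (punchIn k x) ℕ.<ᵇ toℕ k) ≡ (toℕ x ℕ.<ᵇ toℕ k)
punchIn-<ᵇ-pivot zero    x       = refl
punchIn-<ᵇ-pivot (suc k) zero    = refl
punchIn-<ᵇ-pivot (suc k) (suc x) = punchIn-<ᵇ-pivot k x

⟪_⟫ : Bool → ℕ
⟪ c ⟫ = if c then 1 else 0

descents-∷∷ : ∀ {m l} (x y : Fin m) (w : Vec (Fin m) l) →
              descents (x ∷ y ∷ w) ≡ ⟪ toℕ y ℕ.<ᵇ toℕ x ⟫ ℕ.+ descents (y ∷ w)
descents-∷∷ x y w = cong (λ c → ⟪ c ⟫ ℕ.+ descents (y ∷ w)) (isYes≗does (y Fin.<? x))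

descents-map-punchIn : ∀ {m l} (k : Fin (suc m)) (w : Vec (Fin m) l) →
                       descents (Vec.map (punchIn k) w) ≡ descents w
descents-map-punchIn k []          = refl
descents-map-punchIn k (x ∷ [])    = refl
descents-map-punchIn k (x ∷ y ∷ w) = begin
  descents (punchIn k x ∷ punchIn k y ∷ Vec.map (punchIn k) w)
    ≡⟨ descents-∷∷ (punchIn k x) (punchIn k y) (Vec.map (punchIn k) w) ⟩
  ⟪ toℕ (punchIn k y) ℕ.<ᵇ toℕ (punchIn k x) ⟫ ℕ.+ descents (punchIn k y ∷ Vec.map (punchIn k) w)
    ≡⟨ cong₂ (λ c d → ⟪ c ⟫ ℕ.+ d) (punchIn-<ᵇ k y x) (descents-map-punchIn k (y ∷ w)) ⟩
  ⟪ toℕ y ℕ.<ᵇ toℕ x ⟫ ℕ.+ descents (y ∷ w)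
    ≡⟨ descents-∷∷ x y w ⟨
  descents (x ∷ y ∷ w) ∎
  where open ≡-Reasoning

⟪⟫≤1 : ∀ c → ⟪ c ⟫ ≤ 1
⟪⟫≤1 true  = ℕ.≤-refl
⟪⟫≤1 false = ℕ.z≤n

descents< : ∀ {m l} (w : Vec (Fin m) (suc l)) → descents w ℕ.< suc l
descents< (x ∷ [])    = ℕ.s≤s ℕ.z≤n
descents< (x ∷ y ∷ w) = ℕ.s≤s (ℕ.≤-trans (ℕ.≤-reflexive (descents-∷∷ x y w))
  (ℕ.+-mono-≤ (⟪⟫≤1 (toℕ y ℕ.<ᵇ toℕ x)) (ℕ.s≤s⁻¹ (descents< (y ∷ w)))))

startingWith : ∀ {n} → Fin (suc n) → Seq
startingWith {n} k m = ∑ᵖ n λ w → δ (descents (k ∷ Vec.map (punchIn k) w)) m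

-- Removing the first letter `k` leaves a permutation with some first letter `l`; the descent lost
-- when l < k is restored by a shift.
startingWith-suc : ∀ {n} (k : Fin (suc (suc n))) → startingWith k ≗
  λ m → sum λ (l : Fin (suc n)) → shift^ ⟪ toℕ l ℕ.<ᵇ toℕ k ⟫ (startingWith l) m
startingWith-suc {n} k m = sum-cong {suc n} λ l → trans
  (∑ᵖ-cong n λ w → trans (cong (λ d → δ d m) (first-step l w))
    (shift^-δ ⟪ toℕ l ℕ.<ᵇ toℕ k ⟫ (descents (l ∷ Vec.map (punchIn l) w)) m))
  (sym (∑ᵖ-sums (shift^-additive ⟪ toℕ l ℕ.<ᵇ toℕ k ⟫) n (λ w → δ (descents (l ∷ Vec.map (punchIn l) w))) m))
  where
  first-step : ∀ l (w : Vec (Fin n) n) →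
    descents (k ∷ Vec.map (punchIn k) (l ∷ Vec.map (punchIn l) w)) ≡
    ⟪ toℕ l ℕ.<ᵇ toℕ k ⟫ ℕ.+ descents (l ∷ Vec.map (punchIn l) w)
  first-step l w = trans (descents-∷∷ k (punchIn k l) (Vec.map (punchIn k) (Vec.map (punchIn l) w)))
    (cong₂ (λ c d → ⟪ c ⟫ ℕ.+ d) (punchIn-<ᵇ-pivot k l) (descents-map-punchIn k (l ∷ Vec.map (punchIn l) w)))

-- mixedPower k m = mᵏ (m + 1)ⁿ⁻¹⁻ᵏ
mixedPower : ∀ {n} → Fin n → Seq
mixedPower {suc n} zero    m = fromℕ (suc m ^ n)
mixedPower {suc n} (suc k) m = fromℕ m * mixedPower k m

fromℕ-^-suc : ∀ m n → fromℕ (suc m ^ suc n) ≡ (1ℚ + fromℕ m) * fromℕ (suc m ^ n)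
fromℕ-^-suc m n = trans (fromℕ-* (suc m) (suc m ^ n)) (cong (_* fromℕ (suc m ^ n)) (fromℕ-suc m))

-- Each summand is mˡ(m+1)ⁿ⁻ˡ - mˡ⁺¹(m+1)ⁿ⁻ˡ⁻¹, since (m+1) - m = 1, so the sum over l < k
-- telescopes. The complementary sum over l ≥ k telescopes in the same way.
sum-mixedPower-< : ∀ n (k : Fin (suc n)) m →
  sum (λ (l : Fin n) → ⟦ toℕ l ℕ.<ᵇ toℕ k ⟧ * mixedPower l m) ≡ fromℕ (suc m ^ n) - mixedPower k m
sum-mixedPower-< n zero m = trans
  (sum-cong {n} λ l → ℚ.*-zeroˡ (mixedPower l m)) (trans (sum-0 n) (sym (ℚ.+-inverseʳ (fromℕ (suc m ^ n)))))
sum-mixedPower-< (suc n) (suc k) m = begin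
  1ℚ * Y + sum (λ (l : Fin n) → ⟦ toℕ l ℕ.<ᵇ toℕ k ⟧ * (M * mixedPower l m))
    ≡⟨ cong (1ℚ * Y ℚ.+_) (trans (sum-cong {n} λ l → swap ⟦ toℕ l ℕ.<ᵇ toℕ k ⟧ M (mixedPower l m))
         (trans (sum-*ˡ {n} M (λ l → ⟦ toℕ l ℕ.<ᵇ toℕ k ⟧ * mixedPower l m))
           (cong (M *_) (sum-mixedPower-< n k m)))) ⟩
  1ℚ * Y + M * (Y - mixedPower k m)
    ≡⟨ algebra Y M (mixedPower k m) ⟩
  (1ℚ + M) * Y - M * mixedPower k m
    ≡⟨ cong (_- M * mixedPower k m) (fromℕ-^-suc m n) ⟨
  fromℕ (suc m ^ suc n) - M * mixedPower k m ∎
  where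
  open ≡-Reasoning
  Y = fromℕ (suc m ^ n)
  M = fromℕ m
  swap : ∀ p q r → p * (q * r) ≡ q * (p * r)
  swap = solve-∀ ℚ-ring
  algebra : ∀ Y M q → 1ℚ * Y + M * (Y - q) ≡ (1ℚ + M) * Y - M * q
  algebra = solve-∀ ℚ-ring

sum-mixedPower : ∀ n m → sum (λ (l : Fin n) → mixedPower l m) ≡ powerGap n m
sum-mixedPower zero    m = refl
sum-mixedPower (suc n) m = begin
  Y + sum (λ (l : Fin n) → M * mixedPower l m)
    ≡⟨ cong (Y ℚ.+_) (trans (sum-*ˡ {n} M (λ l → mixedPower l m)) (cong (M *_) (sum-mixedPower n m))) ⟩
  Y + M * (Y - fromℕ (m ^ n))
    ≡⟨ algebra Y M (fromℕ (m ^ n)) ⟩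
  (1ℚ + M) * Y - M * fromℕ (m ^ n)
    ≡⟨ cong₂ _-_ (fromℕ-^-suc m n) (fromℕ-* m (m ^ n)) ⟨
  powerGap (suc n) m ∎
  where
  open ≡-Reasoning
  Y = fromℕ (suc m ^ n)
  M = fromℕ m
  algebra : ∀ Y M q → Y + M * (Y - q) ≡ (1ℚ + M) * Y - M * q
  algebra = solve-∀ ℚ-ring

sum-mixedPower-≥ : ∀ n (k : Fin (suc n)) m →
  sum (λ (l : Fin n) → ⟦ not (toℕ l ℕ.<ᵇ toℕ k) ⟧ * mixedPower l m) ≡ mixedPower k m - fromℕ (m ^ n)
sum-mixedPower-≥ n zero m = trans (sum-cong {n} λ l → ℚ.*-identityˡ (mixedPower l m)) (sum-mixedPower n m)
sum-mixedPower-≥ (suc n) (suc k) m = begin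
  0ℚ * Y + sum (λ (l : Fin n) → ⟦ not (toℕ l ℕ.<ᵇ toℕ k) ⟧ * (M * mixedPower l m))
    ≡⟨ cong (0ℚ * Y ℚ.+_) (trans (sum-cong {n} λ l → swap ⟦ not (toℕ l ℕ.<ᵇ toℕ k) ⟧ M (mixedPower l m))
         (trans (sum-*ˡ {n} M (λ l → ⟦ not (toℕ l ℕ.<ᵇ toℕ k) ⟧ * mixedPower l m))
           (cong (M *_) (sum-mixedPower-≥ n k m)))) ⟩
  0ℚ * Y + M * (mixedPower k m - fromℕ (m ^ n))
    ≡⟨ algebra Y M (mixedPower k m) (fromℕ (m ^ n)) ⟩
  M * mixedPower k m - M * fromℕ (m ^ n)
    ≡⟨ cong (λ z → M * mixedPower k m - z) (fromℕ-* m (m ^ n)) ⟨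
  M * mixedPower k m - fromℕ (m ^ suc n) ∎
  where
  open ≡-Reasoning
  Y = fromℕ (suc m ^ n)
  M = fromℕ m
  swap : ∀ p q r → p * (q * r) ≡ q * (p * r)
  swap = solve-∀ ℚ-ring
  algebra : ∀ Y M p q → 0ℚ * Y + M * (p - q) ≡ M * p - M * q
  algebra = solve-∀ ℚ-ring

S^-suc : ∀ n f → (S ^ˢ suc n) f ≗ S ((S ^ˢ n) f)
S^-suc n f m = sym (^ˢ-comm S-additive (λ _ _ → refl) S-additive n f m)

-- At m + 1 the recursion on the first letter yields `mixedPower l` at m for l < k, where the shift
-- acts, and at m + 1 for l ≥ k. Both sums telescope, their pure powers of m + 1 cancel, and the
-- increment of `mixedPower k` remains for the last prefix sum.
S^-startingWith : ∀ n (k : Fin (suc n)) → (S ^ˢ suc n) (startingWith k) ≗ mixedPower k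
S^-startingWith zero    zero m = S-δ₀ m
  where
  S-δ₀ : ∀ m → S (δ 0) m ≡ 1ℚ
  S-δ₀ zero    = refl
  S-δ₀ (suc m) = trans (ℚ.+-identityʳ (S (δ 0) m)) (S-δ₀ m)
S^-startingWith (suc n) k m = begin
  (S ^ˢ suc (suc n)) (startingWith k) m
    ≡⟨ S^-suc (suc n) (startingWith k) m ⟩
  S ((S ^ˢ suc n) (startingWith k)) m
    ≡⟨ respects S-additive expand m ⟩
  S differences m
    ≡⟨ S-differences {differences} {mixedPower k} at-0 at-suc m ⟩
  mixedPower k m ∎
  where
  open ≡-Reasoning
  differences : Seq
  differences m = sum λ (l : Fin (suc n)) → shift^ ⟪ toℕ l ℕ.<ᵇ toℕ k ⟫ (mixedPower l) m
  S^ = ^ˢ-additive S-additive (suc n)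
  expand : (S ^ˢ suc n) (startingWith k) ≗ differences
  expand m = begin
    (S ^ˢ suc n) (startingWith k) m
      ≡⟨ respects S^ (startingWith-suc k) m ⟩
    (S ^ˢ suc n) (λ m → sum λ (l : Fin (suc n)) → shift^ ⟪ toℕ l ℕ.<ᵇ toℕ k ⟫ (startingWith l) m) m
      ≡⟨ sums S^ {suc n} (λ l → shift^ ⟪ toℕ l ℕ.<ᵇ toℕ k ⟫ (startingWith l)) m ⟩
    sum (λ (l : Fin (suc n)) → (S ^ˢ suc n) (shift^ ⟪ toℕ l ℕ.<ᵇ toℕ k ⟫ (startingWith l)) m)
      ≡⟨ sum-cong {suc n} (λ l → let s = ⟪ toℕ l ℕ.<ᵇ toℕ k ⟫ in trans
           (sym (^ˢ-comm S-additive (λ f m → sym (S-shift^ s f m)) (shift^-additive s) (suc n) (startingWith l) m))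
           (respects (shift^-additive s) (S^-startingWith n l) m)) ⟩
    differences m ∎
  at-0 : differences 0 ≡ mixedPower k 0
  at-0 = trans (sum-cong {suc n} λ l → shifted (toℕ l ℕ.<ᵇ toℕ k) (mixedPower l))
    (trans (sum-mixedPower-≥ (suc n) k 0) (ℚ.+-identityʳ (mixedPower k 0)))
    where
    shifted : ∀ c f → shift^ ⟪ c ⟫ f 0 ≡ ⟦ not c ⟧ * f 0
    shifted true  f = sym (ℚ.*-zeroˡ (f 0))
    shifted false f = sym (ℚ.*-identityˡ (f 0))
  at-suc : ∀ m → differences (suc m) ≡ mixedPower k (suc m) - mixedPower k m
  at-suc m = begin
    differences (suc m)
      ≡⟨ sum-cong {suc n} (λ l → shifted (toℕ l ℕ.<ᵇ toℕ k) (mixedPower l)) ⟩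
    sum (λ (l : Fin (suc n)) → ⟦ toℕ l ℕ.<ᵇ toℕ k ⟧ * mixedPower l m + ⟦ not (toℕ l ℕ.<ᵇ toℕ k) ⟧ * mixedPower l (suc m))
      ≡⟨ ∑-distrib-+ {suc n} (λ l → ⟦ toℕ l ℕ.<ᵇ toℕ k ⟧ * mixedPower l m)
           (λ l → ⟦ not (toℕ l ℕ.<ᵇ toℕ k) ⟧ * mixedPower l (suc m)) ⟩
    sum (λ (l : Fin (suc n)) → ⟦ toℕ l ℕ.<ᵇ toℕ k ⟧ * mixedPower l m)
      + sum (λ (l : Fin (suc n)) → ⟦ not (toℕ l ℕ.<ᵇ toℕ k) ⟧ * mixedPower l (suc m))
      ≡⟨ cong₂ _+_ (sum-mixedPower-< (suc n) k m) (sum-mixedPower-≥ (suc n) k (suc m)) ⟩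
    (fromℕ (suc m ^ suc n) - mixedPower k m) + (mixedPower k (suc m) - fromℕ (suc m ^ suc n))
      ≡⟨ cancel (fromℕ (suc m ^ suc n)) (mixedPower k m) (mixedPower k (suc m)) ⟩
    mixedPower k (suc m) - mixedPower k m ∎
    where
    shifted : ∀ c f → shift^ ⟪ c ⟫ f (suc m) ≡ ⟦ c ⟧ * f m + ⟦ not c ⟧ * f (suc m)
    shifted true  f = unit (f m) (f (suc m))
      where
      unit : ∀ p q → p ≡ 1ℚ * p + 0ℚ * q
      unit = solve-∀ ℚ-ring
    shifted false f = unit (f m) (f (suc m))
      where
      unit : ∀ p q → q ≡ 0ℚ * p + 1ℚ * q
      unit = solve-∀ ℚ-ring
    cancel : ∀ Y p q → (Y - p) + (q - Y) ≡ q - p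
    cancel = solve-∀ ℚ-ring

S^-descentSeq : ∀ n → (S ^ˢ suc n) (descentSeq (suc n)) ≗ powerGap (suc n)
S^-descentSeq n m = trans (sums (^ˢ-additive S-additive (suc n)) {suc n} startingWith m)
  (trans (sum-cong {suc n} λ k → S^-startingWith n k m) (sum-mixedPower (suc n) m))

-- Invariance before normalisation. Prefix sums are injective, so the identity may be checked after
-- `suc n` of them, where it concerns block sums of `powerGap`.
descentSeq-invariant : ∀ b n → block b ((U b ^ˢ suc n) (descentSeq (suc n))) ≗
                       λ j → fromℕ (b ^ suc n) * descentSeq (suc n) j
descentSeq-invariant b n = S^-injective (suc n) λ m → begin
  (S ^ˢ suc n) (block b ((U b ^ˢ suc n) (descentSeq (suc n)))) m
    ≡⟨ S^-block-U^ b (suc n) (descentSeq (suc n)) m ⟩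
  block b ((S ^ˢ suc n) (descentSeq (suc n))) m
    ≡⟨ respects (block-additive b) (S^-descentSeq n) m ⟩
  block b (powerGap (suc n)) m
    ≡⟨ block-powerGap b (suc n) m ⟩
  fromℕ (b ^ suc n) * powerGap (suc n) m
    ≡⟨ cong (fromℕ (b ^ suc n) *_) (S^-descentSeq n m) ⟨
  fromℕ (b ^ suc n) * (S ^ˢ suc n) (descentSeq (suc n)) m
    ≡⟨ S^-*ˡ (suc n) (fromℕ (b ^ suc n)) (descentSeq (suc n)) m ⟨
  (S ^ˢ suc n) (λ j → fromℕ (b ^ suc n) * descentSeq (suc n) j) m ∎
  where open ≡-Reasoning

-- Cauchy reals

-- From index 19 on the denominator is at least 20, and the estimate gives the ratio 19/21, rounded
-- down to 9/10. Together with the square of a further factor 9/10 this leaves 729/1000, still above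
-- 2/3.
√-seq-lower : ∀ n .{{_ : NonZero n}} k → 19 ≤ k →
  (+ 9 ℚ./ 10) * fromℕ n ℚ.≤ seq (√ n) k * seq (√ n) k
√-seq-lower n k 19≤k = subst₂ ℚ._≤_ left right
  (*-monoˡ-≤ (ι * ι) (0≤² ι) (*-cancelˡ-≤ (fromℕ 21) (0<fromℕ 21) 21α²))
  where
  K = suc k
  ι κ α ν : ℚ
  ι = + 1 ℚ./ K
  κ = fromℕ K
  α = fromℕ (isqrt (n ℕ.* (K ℕ.* K)))
  ν = fromℕ n
  s≡αι : seq (√ n) k ≡ α * ι
  s≡αι = /-fromℕ (isqrt (n ℕ.* (K ℕ.* K))) K
  upper : 1ℚ + ν * (κ * κ) ℚ.≤ (1ℚ + α) * (1ℚ + α)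
  upper = subst₂ ℚ._≤_
    (trans (fromℕ-suc (n ℕ.* (K ℕ.* K))) (cong (1ℚ ℚ.+_) (trans (fromℕ-* n (K ℕ.* K)) (cong (ν *_) (fromℕ-* K K)))))
    (trans (fromℕ-* (suc a) (suc a)) (cong₂ _*_ (fromℕ-suc a) (fromℕ-suc a)))
    (fromℕ-mono-≤ (isqrt-upper (n ℕ.* (K ℕ.* K))))
    where
    a = isqrt (n ℕ.* (K ℕ.* K))
  0≤κ-20 : 0ℚ ℚ.≤ κ - fromℕ 20
  0≤κ-20 = 0≤- (fromℕ-mono-≤ (ℕ.s≤s 19≤k))
  0≤ν-1 : 0ℚ ℚ.≤ ν - 1ℚ
  0≤ν-1 = 0≤- (fromℕ-mono-≤ (ℕ.>-nonZero⁻¹ n))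
  -- 2α ≤ α²/20 + 20 and 20 ≤ κ²/20 ≤ νκ²/20.
  21α² : fromℕ 21 * ((+ 9 ℚ./ 10) * (ν * (κ * κ))) ℚ.≤ fromℕ 21 * (α * α)
  21α² = ≤-by
    (fromℕ 20 * ((1ℚ + α) * (1ℚ + α) - (1ℚ + ν * (κ * κ)))
      + ((α - fromℕ 20) * (α - fromℕ 20)
      + ((κ - fromℕ 20) * ((κ - fromℕ 20) + fromℕ 40)
      + (ν - 1ℚ) * (κ * κ)
      + (+ 1 ℚ./ 10) * (((ν - 1ℚ) + 1ℚ) * (κ * κ)))))
    (algebra α κ ν)
    (0≤+ (0≤* (0≤fromℕ 20) (0≤- upper))
      (0≤+ (0≤² (α - fromℕ 20))
      (0≤+ (0≤+ (0≤* 0≤κ-20 (0≤+ 0≤κ-20 (0≤fromℕ 40)))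
        (0≤* 0≤ν-1 (0≤² κ)))
        (0≤* (ℚ.<⇒≤ (0<1/ 10)) (0≤* (0≤+ 0≤ν-1 0≤1) (0≤² κ))))))
    where
    algebra : ∀ α κ ν →
      fromℕ 20 * ((1ℚ + α) * (1ℚ + α) - (1ℚ + ν * (κ * κ)))
      + ((α - fromℕ 20) * (α - fromℕ 20)
      + ((κ - fromℕ 20) * ((κ - fromℕ 20) + fromℕ 40)
      + (ν - 1ℚ) * (κ * κ)
      + (+ 1 ℚ./ 10) * (((ν - 1ℚ) + 1ℚ) * (κ * κ))))
      ≡ fromℕ 21 * (α * α) - fromℕ 21 * ((+ 9 ℚ./ 10) * (ν * (κ * κ)))
    algebra = solve-∀ ℚ-ring
  left : (ι * ι) * ((+ 9 ℚ./ 10) * (ν * (κ * κ))) ≡ (+ 9 ℚ./ 10) * ν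
  left = trans (regroup ι κ ν) (trans (cong (λ z → (+ 9 ℚ./ 10) * (ν * (z * z))) (fromℕ-inverse K)) (unit ν))
    where
    regroup : ∀ ι κ ν → (ι * ι) * ((+ 9 ℚ./ 10) * (ν * (κ * κ))) ≡ (+ 9 ℚ./ 10) * (ν * ((κ * ι) * (κ * ι)))
    regroup = solve-∀ ℚ-ring
    unit : ∀ ν → (+ 9 ℚ./ 10) * (ν * (1ℚ * 1ℚ)) ≡ (+ 9 ℚ./ 10) * ν
    unit = solve-∀ ℚ-ring
  right : (ι * ι) * (α * α) ≡ seq (√ n) k * seq (√ n) k
  right = trans (regroup ι α) (sym (cong (λ z → z * z) s≡αι))
    where
    regroup : ∀ ι α → (ι * ι) * (α * α) ≡ (α * ι) * (α * ι)
    regroup = solve-∀ ℚ-ring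

0<√-seq : ∀ n .{{_ : NonZero n}} k → 0ℚ ℚ.< seq (√ n) k
0<√-seq n@(suc _) k = ℚ.<-≤-trans (ℚ.positive⁻¹ 1ℚ)
  (subst (ℚ._≤ seq (√ n) k) (ℚ.+-identityˡ 1ℚ) (proj₂ (proj₂ (proj₂ (√-positive n))) k ℕ.z≤n))

-- The slack between (n + 3)/3 and n absorbs the error of the rational approximations of √n,
-- so the bound holds exactly for all late terms of ε.
overlap≤ε : ∀ {ν B D s R e T} → fromℕ 3 ℚ.≤ ν → 1ℚ ℚ.≤ B → 0ℚ ℚ.≤ D → 0ℚ ℚ.< s → s * R ≡ 1ℚ →
  (+ 9 ℚ./ 10) * ν ℚ.≤ s * s → 0ℚ ℚ.≤ e → e ℚ.≤ 1ℚ →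
  B ℚ.≤ (e * D) * R + (+ 1 ℚ./ 10) →
  T * (D * D) ℚ.≤ ⅓ * (ν + fromℕ 3) * (B * B) → T ℚ.≤ e
overlap≤ε {ν} {B} {D} {s} {R} {e} {T} 3≤ν 1≤B 0≤D 0<s sR≡1 9ν/10≤s² 0≤e e≤1 B≤ TD² =
  *-cancelˡ-≤ (D * D) 0<D² (ℚ.≤-trans (ℚ.≤-reflexive (ℚ.*-comm (D * D) T)) (ℚ.≤-trans TD² (ℚ.≤-trans νB²≤u² (ℚ.≤-trans u²≤ eD²≤))))
  where
  u : ℚ
  u = (+ 9 ℚ./ 10) * (B * s)
  0≤s = ℚ.<⇒≤ 0<s
  0≤B = ℚ.≤-trans 0≤1 1≤B
  0≤9/10 : 0ℚ ℚ.≤ + 9 ℚ./ 10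
  0≤9/10 = ℚ.nonNegative⁻¹ (+ 9 ℚ./ 10)
  0≤u : 0ℚ ℚ.≤ u
  0≤u = 0≤* 0≤9/10 (0≤* 0≤B 0≤s)
  -- Since B ≥ 1, the tolerance 1/10 costs at most a tenth of `B`; this is the factor 9/10 in `u`.
  u≤eD : u ℚ.≤ e * D
  u≤eD = ≤-by (s * (((e * D) * R + (+ 1 ℚ./ 10)) - B) + (+ 1 ℚ./ 10) * (s * (B - 1ℚ)))
    (trans (algebra s e D R B) (trans (cong (λ z → (e * D) * z - u) sR≡1) (cong (_- u) (ℚ.*-identityʳ (e * D)))))
    (0≤+ (0≤* 0≤s (0≤- B≤)) (0≤* (ℚ.<⇒≤ (0<1/ 10)) (0≤* 0≤s (0≤- 1≤B))))
    where
    algebra : ∀ s e D R B → s * (((e * D) * R + (+ 1 ℚ./ 10)) - B) + (+ 1 ℚ./ 10) * (s * (B - 1ℚ))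
      ≡ (e * D) * (s * R) - (+ 9 ℚ./ 10) * (B * s)
    algebra = solve-∀ ℚ-ring
  u²≤ : u * u ℚ.≤ (e * D) * (e * D)
  u²≤ = ≤-by ((e * D - u) * (e * D + u)) (algebra (e * D) u)
    (0≤* (0≤- u≤eD) (0≤+ (0≤* 0≤e 0≤D) 0≤u))
    where
    algebra : ∀ p u → (p - u) * (p + u) ≡ p * p - u * u
    algebra = solve-∀ ℚ-ring
  eD²≤ : (e * D) * (e * D) ℚ.≤ (D * D) * e
  eD²≤ = ≤-by ((e * (1ℚ - e)) * (D * D)) (algebra e D) (0≤* (0≤* 0≤e (0≤- e≤1)) (0≤² D))
    where
    algebra : ∀ e D → (e * (1ℚ - e)) * (D * D) ≡ (D * D) * e - (e * D) * (e * D)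
    algebra = solve-∀ ℚ-ring
  νB²≤u² : ⅓ * (ν + fromℕ 3) * (B * B) ℚ.≤ u * u
  -- 81/100 · 9/10 - 1/3 = 1187/3000 is the surplus coefficient of ν, and at ν = 3 the total surplus
  -- is 3 · 1187/3000 - 1 = 561/3000.
  νB²≤u² = ≤-by ((((+ 81 ℚ./ 100) * (s * s - (+ 9 ℚ./ 10) * ν)) + ((+ 1187 ℚ./ 3000) * (ν - fromℕ 3) + (+ 561 ℚ./ 3000))) * (B * B))
    (algebra ν B s)
    (0≤* (0≤+ (0≤* (ℚ.nonNegative⁻¹ (+ 81 ℚ./ 100)) (0≤- 9ν/10≤s²))
      (0≤+ (0≤* (ℚ.nonNegative⁻¹ (+ 1187 ℚ./ 3000)) (0≤- 3≤ν)) (ℚ.nonNegative⁻¹ (+ 561 ℚ./ 3000)))) (0≤² B))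
    where
    algebra : ∀ ν B s → (((+ 81 ℚ./ 100) * (s * s - (+ 9 ℚ./ 10) * ν)) + ((+ 1187 ℚ./ 3000) * (ν - fromℕ 3) + (+ 561 ℚ./ 3000))) * (B * B)
      ≡ ((+ 9 ℚ./ 10) * (B * s)) * ((+ 9 ℚ./ 10) * (B * s)) - (+ 1 ℚ./ 3) * (ν + fromℕ 3) * (B * B)
    algebra = solve-∀ ℚ-ring
  0<u : 0ℚ ℚ.< u
  0<u = ℚ.positive⁻¹ u {{ℚ.pos*pos⇒pos (+ 9 ℚ./ 10) (B * s)
    {{ℚ.pos*pos⇒pos B {{ℚ.positive (ℚ.<-≤-trans (ℚ.positive⁻¹ 1ℚ) 1≤B)}} s {{ℚ.positive 0<s}}}}}}
  -- `u` is positive and at most `e * D`, so D = 0 is excluded and `D * D` can be cancelled.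
  0<D : 0ℚ ℚ.< D
  0<D = ℚ.<-≤-trans 0<u (ℚ.≤-trans u≤eD (≤-by ((1ℚ - e) * D) (algebra e D) (0≤* (0≤- e≤1) 0≤D)))
    where
    algebra : ∀ e D → (1ℚ - e) * D ≡ D - e * D
    algebra = solve-∀ ℚ-ring
  0<D² : 0ℚ ℚ.< D * D
  0<D² = ℚ.positive⁻¹ (D * D) {{ℚ.pos*pos⇒pos D {{ℚ.positive 0<D}} D {{ℚ.positive 0<D}}}}

-- `recip` starts `y` at the index `N` of its positivity witness, so the numerator at `k` meets the
-- denominator at `N + k`.
÷-seq : ∀ x y (0<y : fromℚ 0ℚ <ᴿ y) k → let N = proj₁ (proj₂ (proj₂ 0<y)) in
  ∃[ R ] (seq y (N ℕ.+ k) * R ≡ 1ℚ × seq (x ÷ y [ 0<y ]) k ≡ seq x k * R)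
÷-seq x y 0<y@(d , 0<d , N , d≤y) k = seq (recip y 0<y) k ,
  ℚ.*-inverseʳ (seq y (N ℕ.+ k)) {{ℚ.>-nonZero (ℚ.<-≤-trans 0<d
    (subst (ℚ._≤ seq y (N ℕ.+ k)) (ℚ.+-identityˡ d) (d≤y (N ℕ.+ k) (ℕ.m≤m+n N k))))}} ,
  refl

-- The real inequality is used at the single tolerance 1/10; each late index is then settled by
-- rational arithmetic. Matching `n@(suc _)` lets `√-positive n` reduce, so its starting index is 0
-- and the quotient at `k` uses `√ n` at `k`.
eventually-overlap≤ε : ∀ n .{{_ : NonZero n}} → 3 ≤ n → (ε : ℝ) → fromℚ 0ℚ <ᴿ ε → ε <ᴿ fromℚ 1ℚ →
  ∀ {B D T} → 1ℚ ℚ.≤ B → 0ℚ ℚ.≤ D →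
  fromℚ B ≤ᴿ ((ε *ᴿ fromℚ D) ÷ √ n [ √-positive n ]) →
  T * (D * D) ℚ.≤ ⅓ * (fromℕ n + fromℕ 3) * (B * B) →
  ∃[ N ] ∀ k → N ≤ k → T ℚ.≤ seq ε k
eventually-overlap≤ε n@(suc _) 3≤n ε (c , 0<c , M₀ , c≤ε) (d , 0<d , M₁ , ε≤1) {B} {D} {T} 1≤B 0≤D B≤ TD² =
  (M₀ ℕ.+ M₁) ℕ.+ (M ℕ.+ 19) , λ k N≤k → late k
    (ℕ.m+n≤o⇒m≤o M₀ (ℕ.m+n≤o⇒m≤o (M₀ ℕ.+ M₁) N≤k))
    (ℕ.m+n≤o⇒n≤o M₀ (ℕ.m+n≤o⇒m≤o (M₀ ℕ.+ M₁) N≤k))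
    (ℕ.m+n≤o⇒m≤o M (ℕ.m+n≤o⇒n≤o (M₀ ℕ.+ M₁) N≤k))
    (ℕ.m+n≤o⇒n≤o M (ℕ.m+n≤o⇒n≤o (M₀ ℕ.+ M₁) N≤k))
  where
  M = proj₁ (B≤ (+ 1 ℚ./ 10) (0<1/ 10))
  quotient = (ε *ᴿ fromℚ D) ÷ √ n [ √-positive n ]
  B≤′ : ∀ k → M ≤ k → B ℚ.≤ seq quotient k + (+ 1 ℚ./ 10)
  B≤′ = proj₂ (B≤ (+ 1 ℚ./ 10) (0<1/ 10))
  below : ∀ e c → (e - (0ℚ + c)) + c ≡ e - 0ℚ
  below = solve-∀ ℚ-ring
  above : ∀ e d → (1ℚ - (e + d)) + d ≡ 1ℚ - e
  above = solve-∀ ℚ-ring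
  late : ∀ k → M₀ ≤ k → M₁ ≤ k → M ≤ k → 19 ≤ k → T ℚ.≤ seq ε k
  late k M₀≤k M₁≤k M≤k 19≤k = conclude (÷-seq (ε *ᴿ fromℚ D) (√ n) (√-positive n) k)
    where
    conclude : ∃[ R ] (seq (√ n) k * R ≡ 1ℚ × seq quotient k ≡ (seq ε k * D) * R) → T ℚ.≤ seq ε k
    conclude (R , sR≡1 , quotient≡) = overlap≤ε {fromℕ n} {B} {D} {seq (√ n) k} {R} {seq ε k} {T}
      (fromℕ-mono-≤ 3≤n) 1≤B 0≤D (0<√-seq n k) sR≡1 (√-seq-lower n k 19≤k)
      (≤-by ((seq ε k - (0ℚ + c)) + c) (below (seq ε k) c) (0≤+ (0≤- (c≤ε k M₀≤k)) (ℚ.<⇒≤ 0<c)))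
      (≤-by ((1ℚ - (seq ε k + d)) + d) (above (seq ε k) d) (0≤+ (0≤- (ε≤1 k M₁≤k)) (ℚ.<⇒≤ 0<d)))
      (subst (λ q → B ℚ.≤ q + (+ 1 ℚ./ 10)) quotient≡ (B≤′ k M≤k)) TD²

-- Invariance of the Eulerian distribution

sum-descentSeq : ∀ m (h : Seq) → let n = suc m in
  sum {n} (λ i → descentSeq n (toℕ i) * h (toℕ i)) ≡ ∑ᵖ n (λ w → h (descents w))
sum-descentSeq m h = begin
  sum {n} (λ i → descentSeq n (toℕ i) * h (toℕ i))
    ≡⟨ sum-cong {n} (λ i → ∑ᵖ-*ʳ n (h (toℕ i)) (λ w → δ (descents w) (toℕ i))) ⟨
  sum {n} (λ i → ∑ᵖ n (λ w → δ (descents w) (toℕ i) * h (toℕ i)))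
    ≡⟨ ∑ᵖ-sum n {n} (λ w i → δ (descents w) (toℕ i) * h (toℕ i)) ⟨
  ∑ᵖ n (λ w → sum {n} (λ i → δ (descents w) (toℕ i) * h (toℕ i)))
    ≡⟨ ∑ᵖ-cong n (λ w → sum-δ (descents< w) h) ⟩
  ∑ᵖ n (λ w → h (descents w)) ∎
  where
  open ≡-Reasoning
  n = suc m

1/n! : ℕ → ℚ
1/n! n = (+ 1 ℚ./ (n !)) {{n ℕ.!≢0}}

stationary-descentSeq : ∀ n j → stationary n j ≡ descentSeq n (toℕ j) * 1/n! n
stationary-descentSeq n j = trans (/-fromℕ (eulerian n (toℕ j)) (n !) {{n ℕ.!≢0}})
  (cong (_* 1/n! n) (eulerian-descentSeq n (toℕ j)))

0≤stationary : ∀ n j → 0ℚ ℚ.≤ stationary n j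
0≤stationary n j = ℚ.nonNegative⁻¹ (stationary n j)
  {{ℚ.normalize-nonNeg (eulerian n (toℕ j)) (n !) {{n ℕ.!≢0}}}}

sum-stationary : ∀ m → sum (stationary (suc m)) ≡ 1ℚ
sum-stationary m = begin
  sum (stationary n)
    ≡⟨ sum-cong {n} (λ j → trans (stationary-descentSeq n j)
         (cong (_* 1/n! n) (sym (ℚ.*-identityʳ (descentSeq n (toℕ j)))))) ⟩
  sum {n} (λ j → descentSeq n (toℕ j) * 1ℚ * 1/n! n)
    ≡⟨ sum-*ʳ {n} (1/n! n) (λ j → descentSeq n (toℕ j) * 1ℚ) ⟩
  sum {n} (λ j → descentSeq n (toℕ j) * 1ℚ) * 1/n! n
    ≡⟨ cong (_* 1/n! n) (trans (sum-descentSeq m (λ _ → 1ℚ)) (∑ᵖ-1 n)) ⟩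
  fromℕ (n !) * 1/n! n
    ≡⟨ fromℕ-inverse (n !) {{n ℕ.!≢0}} ⟩
  1ℚ ∎
  where
  open ≡-Reasoning
  n = suc m

module _ (b m : ℕ) .{{_ : NonZero b}} where

  private
    n = suc m
    P = carriesMatrix b n

  -- The `n` digits spread the point mass at `d` by `U b`, and division by `b` collects blocks. Here
  -- `d` is any natural number, so that it can be a number of descents.
  digits-block : ∀ j d → ∑ʷ b n (λ x → δ (newCarry b d x) j) ≡ block b ((U b ^ˢ n) (δ d)) j
  digits-block j d = begin
    ∑ʷ b n (λ x → δ (newCarry b d x) j)
      ≡⟨ ∑ʷ-cong {b} {n} (λ x → block-δ b (d ℕ.+ digitSum x) j) ⟨
    ∑ʷ b n (λ x → block b (δ (d ℕ.+ digitSum x)) j)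
      ≡⟨ ∑ʷ-sums (block-additive b) {b} {n} (λ x → δ (d ℕ.+ digitSum x)) j ⟨
    block b (λ k → ∑ʷ b n (λ x → δ (d ℕ.+ digitSum x) k)) j
      ≡⟨ respects (block-additive b) (∑ʷ-δ b n d) j ⟩
    block b ((U b ^ˢ n) (δ d)) j ∎
    where open ≡-Reasoning

  descentSeq-step : ∀ j → sum {n} (λ i → descentSeq n (toℕ i) * ∑ʷ b n (λ x → δ (newCarry b (toℕ i) x) j)) ≡
                    fromℕ (b ^ n) * descentSeq n j
  descentSeq-step j = begin
    sum {n} (λ i → descentSeq n (toℕ i) * ∑ʷ b n (λ x → δ (newCarry b (toℕ i) x) j))
      ≡⟨ sum-descentSeq m (λ d → ∑ʷ b n (λ x → δ (newCarry b d x) j)) ⟩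
    ∑ᵖ n (λ w → ∑ʷ b n (λ x → δ (newCarry b (descents w) x) j))
      ≡⟨ ∑ᵖ-cong n (λ w → digits-block j (descents w)) ⟩
    ∑ᵖ n (λ w → block b ((U b ^ˢ n) (δ (descents w))) j)
      ≡⟨ ∑ᵖ-sums (∘-additive (block-additive b) (^ˢ-additive (U-additive b) n)) n (λ w → δ (descents w)) j ⟨
    block b ((U b ^ˢ n) (descentSeq n)) j
      ≡⟨ descentSeq-invariant b m j ⟩
    fromℕ (b ^ n) * descentSeq n j ∎
    where open ≡-Reasoning

  stationary-step : ∀ j → sum {n} (λ i → stationary n i * P i j) ≡ stationary n j
  stationary-step j = begin
    sum {n} (λ i → stationary n i * P i j)
      ≡⟨ sum-cong {n} (λ i → trans (cong₂ _*_ (stationary-descentSeq n i) (carriesMatrix-words b n i j))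
           (regroup (descentSeq n (toℕ i)) (1/n! n) (1/^ b n) (∑ʷ b n (λ x → δ (newCarry b (toℕ i) x) (toℕ j))))) ⟩
    sum {n} (λ i → (1/n! n * 1/^ b n) * (descentSeq n (toℕ i) * ∑ʷ b n (λ x → δ (newCarry b (toℕ i) x) (toℕ j))))
      ≡⟨ sum-*ˡ {n} (1/n! n * 1/^ b n) (λ i → descentSeq n (toℕ i) * ∑ʷ b n (λ x → δ (newCarry b (toℕ i) x) (toℕ j))) ⟩
    (1/n! n * 1/^ b n) * sum {n} (λ i → descentSeq n (toℕ i) * ∑ʷ b n (λ x → δ (newCarry b (toℕ i) x) (toℕ j)))
      ≡⟨ cong ((1/n! n * 1/^ b n) *_) (descentSeq-step (toℕ j)) ⟩
    (1/n! n * 1/^ b n) * (fromℕ (b ^ n) * descentSeq n (toℕ j))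
      ≡⟨ collect (1/n! n) (1/^ b n) (fromℕ (b ^ n)) (descentSeq n (toℕ j)) ⟩
    (fromℕ (b ^ n) * 1/^ b n) * (descentSeq n (toℕ j) * 1/n! n)
      ≡⟨ cong (_* (descentSeq n (toℕ j) * 1/n! n)) (1/^-inverse b n) ⟩
    1ℚ * (descentSeq n (toℕ j) * 1/n! n)
      ≡⟨ trans (ℚ.*-identityˡ _) (sym (stationary-descentSeq n j)) ⟩
    stationary n j ∎
    where
    open ≡-Reasoning
    regroup : ∀ p q r s → (p * q) * (r * s) ≡ (q * r) * (p * s)
    regroup = solve-∀ ℚ-ring
    collect : ∀ c w B d → (c * w) * (B * d) ≡ (B * w) * (d * c)
    collect = solve-∀ ℚ-ring

  stationary-∙ : ∀ g → sum (λ i → stationary n i * (P ∙ g) i) ≡ sum (λ j → stationary n j * g j)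
  stationary-∙ g = begin
    sum {n} (λ i → stationary n i * sum {n} (λ j → P i j * g j))
      ≡⟨ sum-cong {n} (λ i → trans (sym (sum-*ˡ {n} (stationary n i) (λ j → P i j * g j)))
           (sum-cong {n} λ j → sym (ℚ.*-assoc (stationary n i) (P i j) (g j)))) ⟩
    sum {n} (λ i → sum {n} (λ j → stationary n i * P i j * g j))
      ≡⟨ ∑-comm {n} {n} (λ i j → stationary n i * P i j * g j) ⟩
    sum {n} (λ j → sum {n} (λ i → stationary n i * P i j * g j))
      ≡⟨ sum-cong {n} (λ j → trans (sum-*ʳ {n} (g j) (λ i → stationary n i * P i j)) (cong (_* g j) (stationary-step j))) ⟩
    sum {n} (λ j → stationary n j * g j) ∎
    where open ≡-Reasoning

theorem3p3 : (n b : ℕ) .{{_ : NonZero n}} .{{_ : NonZero b}} → 3 ≤ n → 2 ≤ b →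
    (i : Fin n) →
    ((r : ℕ) →
    tv ((carriesMatrix b n ^ᴹ r) i) (stationary n)
    ℚ.≤ (midpoint n ℚ.+ fromℕ (toℕ i)) ℚ.* ((+ 1 ℚ./ (b ^ r)) {{m^n≢0 b r}}))
    ×
    ((ε : ℝ) → fromℚ 0ℚ <ᴿ ε → ε <ᴿ fromℚ 1ℚ →
    (r : ℕ) → 1 ≤ r →
    r ≤log[ b ] ((ε *ᴿ fromℚ ∣ fromℕ (toℕ i) ℚ.- midpoint n ∣) ÷ √ n [ √-positive n ]) →
    (fromℚ 1ℚ -ᴿ ε) ≤ᴿ fromℚ (tv ((carriesMatrix b n ^ᴹ r) i) (stationary n)))
theorem3p3 (suc m) b 3≤n 2≤b i = (λ r → tv-upper r i) , lower
  where
  n = suc m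
  open Powers.Stationary b m 2≤b (stationary n) (0≤stationary n) (sum-stationary m) (stationary-∙ b m)
  D = ∣ centred i ∣
  lower : (ε : ℝ) → fromℚ 0ℚ <ᴿ ε → ε <ᴿ fromℚ 1ℚ → (r : ℕ) → 1 ≤ r →
    r ≤log[ b ] ((ε *ᴿ fromℚ D) ÷ √ n [ √-positive n ]) →
    (fromℚ 1ℚ -ᴿ ε) ≤ᴿ fromℚ (tv ((carriesMatrix b n ^ᴹ r) i) (stationary n))
  -- The inequality `1ℚ - t ≤ seq ε k` is exact for late `k`, so one index serves every `δ`.
  lower ε 0<ε ε<1 r _ r≤log δ 0<δ = proj₁ late , λ k N≤k → ≤-by
      ((seq ε k - (1ℚ - t)) + δ) (rearrange (seq ε k) t δ) (0≤+ (0≤- (proj₂ late k N≤k)) (ℚ.<⇒≤ 0<δ))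
    where
    B t : ℚ
    B = fromℕ (b ^ r)
    t = tv ((carriesMatrix b n ^ᴹ r) i) (stationary n)
    D²≡ : D * D ≡ centred² i
    D²≡ = trans (sym (ℚ.∣p*q∣≡∣p∣*∣q∣ (centred i) (centred i))) (ℚ.0≤p⇒∣p∣≡p (0≤² (centred i)))
    4V≡ : fromℕ 4 * Chain.V b m ≡ ⅓ * (fromℕ n + fromℕ 3)
    4V≡ = trans (algebra (fromℕ m)) (cong (λ ν → ⅓ * (ν + fromℕ 3)) (sym (fromℕ-suc m)))
      where
      algebra : ∀ M → fromℕ 4 * ((+ 1 ℚ./ 12) * (M + fromℕ 4)) ≡ (+ 1 ℚ./ 3) * ((1ℚ + M) + fromℕ 3)
      algebra = solve-∀ ℚ-ring
    late : ∃[ N ] ∀ k → N ≤ k → 1ℚ - t ℚ.≤ seq ε k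
    late = eventually-overlap≤ε n 3≤n ε 0<ε ε<1 {B} {D} {1ℚ - t}
      (fromℕ-mono-≤ (ℕ.m^n>0 b r)) (ℚ.0≤∣p∣ (centred i)) r≤log
      (subst₂ ℚ._≤_ (cong ((1ℚ - t) *_) (sym D²≡)) (cong (_* (B * B)) 4V≡) (tv-lower r i))
    rearrange : ∀ e t δ → (e - (1ℚ - t)) + δ ≡ (t + δ) - (1ℚ - e)
    rearrange = solve-∀ ℚ-ring
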